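{- Let $G=C_{n_1}\cup C_{n_2}\cup\ldots\cup C_{n_k}$ be a vertex-disjoint union of $k\ge 1$ cycles (each $n_i\ge 3$). (i) If $G$ is one of $C_3$, $C_4$, $C_5$, $C_6$, $2C_3$, then there is no packing of three copies of $G$. (ii) If $G$ is one of $C_7$, $C_8$, $C_3\cup C_4$, $C_4\cup C_4$, $C_3\cup C_5$, $3C_3$, then $G$ has a unique packing of three copies. (iii) For any other such graph $G$, there exist at least two distinct packings of three copies of $G$.
   Context: All graphs are finite, undirected, without loops or multiple edges. $C_m$ ($m\ge 3$) denotes the cycle on $m$ vertices; $H_1\cup H_2$ denotes the union of vertex-disjoint graphs, and $mH$ the union of $m$ vertex-disjoint copies of $H$. The members of the lists are understood up to isomorphism. Packing of three copies: let $G_1,G_2,G_3$ be three copies of a graph $G$ of order $n$. A packing of three copies of $G$ (into the complete graph $K_n$) consists of injections $\alpha_i:V(G_i)\to V(K_n)$, $i\in\{1,2,3\}$, such that $\alpha_i^*(E(G_i))\cap\alpha_j^*(E(G_j))=\emptyset$ for $i\ne j$, where $\alpha_i^*:E(G_i)\to E(K_n)$ is the map on edges induced by $\alpha_i$. Write $\alpha_i(G)$ for the graph with vertex set $V(K_n)$ and edge set $\alpha_i^*(E(G_i))$. For graphs $H_1,H_2$ with the same vertex set and disjoint edge sets, $H_1\oplus H_2$ is the graph with that vertex set and edge set $E(H_1)\cup E(H_2)$. Two packings $\alpha,\alpha'$ of three copies of $G$ are distinct if the graphs $\alpha_1(G)\oplus\alpha_2(G)\oplus\alpha_3(G)$ and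 $\alpha_1'(G)\oplus\alpha_2'(G)\oplus\alpha_3'(G)$ are not isomorphic. $G$ has a unique packing of three copies if such a packing exists and no two packings of three copies of $G$ are distinct. -}

module Defs where

open import Data.Empty using (⊥)
open import Data.Fin using (Fin; toℕ; splitAt)
open import Data.Fin.Patterns using (0F; 1F; 2F)
open import Data.Fin.Properties using (any?) renaming (_≟_ to _≟ᶠ_)
open import Data.List using (List; []; _∷_)
open import Data.List.Relation.Unary.Any using (Any)
open import Data.Nat using (ℕ; suc; _+_; _≟_)
open import Data.Product using (∃; ∃₂; _×_; _,_; proj₂)
open import Data.Sum as Sum using (_⊎_; [_,_]′)
open import Data.Sum.Relation.Binary.Pointwise
  using (Pointwise; inj₁; inj₂; ⊎-symmetric; ⊎-decidable)
open import Data.Vec using (Vec; []; _∷_; sum)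
open import Function using (_∘_; _↔_; _↣_; _⇔_; Inverse; Injection)
open import Relation.Binary using (Rel; Symmetric; Irreflexive; Decidable)
open import Relation.Binary.PropositionalEquality using (_≡_; _≢_; refl; sym; trans)
open import Relation.Nullary using (¬_; ¬?; _×-dec_; _⊎-dec_)

record Graph (n : ℕ) : Set₁ where
  field
    Adj    : Fin n → Fin n → Set
    symm   : Symmetric Adj
    irrefl : Irreflexive _≡_ Adj
    adj?   : Decidable Adj

open Graph public using (Adj)
open Graph using (symm; irrefl; adj?)

infix 4 _≅_

record _≅_ {m n} (G : Graph m) (H : Graph n) : Set where
  field
    bijection : Fin m ↔ Fin n
    preserves : ∀ u v →
      Adj G u v ⇔ Adj H (Inverse.to bijection u) (Inverse.to bijection v)

EdgeDisjoint : ∀ {n} → Graph n → Graph n → Set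
EdgeDisjoint G H = ∀ u v → Adj G u v → ¬ Adj H u v

-- Cyclic successor on {0, …, m - 1}.
Next : ∀ {m} → Fin m → Fin m → Set
Next {m} i j = toℕ j ≡ suc (toℕ i) ⊎ (suc (toℕ i) ≡ m × toℕ j ≡ 0)

next? : ∀ {m} → Decidable (Next {m})
next? {m} i j =
  (toℕ j ≟ suc (toℕ i)) ⊎-dec ((suc (toℕ i) ≟ m) ×-dec (toℕ j ≟ 0))

-- A cycle for m ≥ 3.  The condition i ≢ j only excludes the loop
-- that Next would create for m = 1.
C : (m : ℕ) → Graph m
C m = record
  { Adj    = λ i j → i ≢ j × (Next i j ⊎ Next j i)
  ; symm   = λ { (i≢j , e) → i≢j ∘ sym , Sum.swap e }
  ; irrefl = λ { i≡j (i≢j , _) → i≢j i≡j }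
  ; adj?   = λ i j → ¬? (i ≟ᶠ j) ×-dec (next? i j ⊎-dec next? j i)
  }

infixr 6 _∪_

-- Vertex-disjoint union: the first m of the m + n vertices carry G,
-- the others carry H.
_∪_ : ∀ {m n} → Graph m → Graph n → Graph (m + n)
_∪_ {m} G H = record
  { Adj    = λ u v → Pointwise (Adj G) (Adj H) (splitAt m u) (splitAt m v)
  ; symm   = ⊎-symmetric (symm G) (symm H)
  ; irrefl = λ { {u} refl → loopless (splitAt m u) refl }
  ; adj?   = λ u v → ⊎-decidable (adj? G) (adj? H) (splitAt m u) (splitAt m v)
  }
  where
  loopless : ∀ x {y} → x ≡ y → ¬ Pointwise (Adj G) (Adj H) x y
  loopless _ refl (inj₁ e) = irrefl G refl e
  loopless _ refl (inj₂ e) = irrefl H refl e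

noVertices : Graph 0
noVertices = record
  { Adj    = λ _ _ → ⊥
  ; symm   = λ ()
  ; irrefl = λ _ ()
  ; adj?   = λ ()
  }

⋃C : ∀ {k} (ns : Vec ℕ k) → Graph (sum ns)
⋃C []       = noVertices
⋃C (n ∷ ns) = C n ∪ ⋃C ns

infix 8 _[_]

_[_] : ∀ {m n} → Fin m ↣ Fin n → Graph m → Graph n
α [ G ] = record
  { Adj    = λ x y → ∃₂ λ u v → to u ≡ x × to v ≡ y × Adj G u v
  ; symm   = λ { (u , v , p , q , e) → v , u , q , p , symm G e }
  ; irrefl = λ { x≡y (u , v , p , q , e) →
                   irrefl G (injective (trans p (trans x≡y (sym q)))) e }
  ; adj?   = λ x y → any? λ u → any? λ v →
                   (to u ≟ᶠ x) ×-dec ((to v ≟ᶠ y) ×-dec adj? G u v)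
  }
  where open Injection α using (to; injective)

infixr 6 _⊕_

_⊕_ : ∀ {n} → Graph n → Graph n → Graph n
G ⊕ H = record
  { Adj    = λ u v → Adj G u v ⊎ Adj H u v
  ; symm   = Sum.map (symm G) (symm H)
  ; irrefl = λ u≡v → [ irrefl G u≡v , irrefl H u≡v ]′
  ; adj?   = λ u v → adj? G u v ⊎-dec adj? H u v
  }

-- A packing of three copies of G into the complete graph on Fin n.
record Packing {n} (G : Graph n) : Set where
  field
    α        : Fin 3 → Fin n ↣ Fin n
    disjoint : ∀ i j → i ≢ j → EdgeDisjoint (α i [ G ]) (α j [ G ])

  total : Graph n
  total = α 0F [ G ] ⊕ α 1F [ G ] ⊕ α 2F [ G ]

Distinct : ∀ {n} {G : Graph n} → Packing G → Packing G → Set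
Distinct p q = ¬ (Packing.total p ≅ Packing.total q)

HasUniquePacking : ∀ {n} → Graph n → Set
HasUniquePacking G = Packing G × (∀ (p q : Packing G) → ¬ Distinct p q)

HasDistinctPackings : ∀ {n} → Graph n → Set
HasDistinctPackings G = ∃₂ λ (p q : Packing G) → Distinct p q

_IsOneOf_ : ∀ {n} → Graph n → List (∃ Graph) → Set₁
G IsOneOf Hs = Any (λ H → G ≅ proj₂ H) Hs

unpackable : List (∃ Graph)
unpackable =
    (_ , C 3)
  ∷ (_ , C 4)
  ∷ (_ , C 5)
  ∷ (_ , C 6)
  ∷ (_ , C 3 ∪ C 3)
  ∷ []

uniquelyPackable : List (∃ Graph)
uniquelyPackable =
    (_ , C 7)
  ∷ (_ , C 8)
  ∷ (_ , C 3 ∪ C 4)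
  ∷ (_ , C 4 ∪ C 4)
  ∷ (_ , C 3 ∪ C 5)
  ∷ (_ , C 3 ∪ C 3 ∪ C 3)
  ∷ []

{-# OPTIONS --safe #-}
module Submission where

-- The total of a packing is 6-regular, so n ≥ 7; for n = 7 it is complete, for n = 8
-- it is the complement of a perfect matching, and three copies of 3C₃ amount to a
-- Latin square of order 3, unique up to isotopy.
--
-- Otherwise G is a disjoint union of a shape that has a packing by computer search
-- and of a smaller G′, empty or of order at least 7.  If G′ is not empty, the disjoint
-- union of packings has a disconnected total.  Exchanging one vertex of each side in a
-- single copy gives another packing, whose total is connected provided that the other
-- two copies already connect their side.  If G′ is empty, two packings are told apart
-- by a colouring of one total and a clique, or at least an uncolourable part, of the
-- other.  The shapes with an arbitrarily long cycle are
-- obtained by subdividing pairwise disjoint edges, one in each copy, and identifying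
-- the three new vertices: this never creates a K₅, and it keeps any K₅ that contains
-- none of these edges.

open import Defs
open import Data.Bool using (Bool; true; false; if_then_else_; _∨_)
open import Data.Empty using (⊥)
open import Data.Fin as Fin using (Fin; zero; suc; toℕ; fromℕ; fromℕ<; inject₁; punchIn; splitAt; join; opposite; combine; remQuot)
open import Data.Fin.Induction using (<-weakInduction) renaming (<-wellFounded to <ᶠ-wellFounded)
open import Data.Fin.Patterns using (0F; 1F; 2F; 3F)
open import Data.Fin.Permutation using (↔⇒≡)
open import Data.Fin.Properties using (all?; any?; ¬∀⟶∃¬; pigeonhole; injective⇒≤; suc-injective; toℕ-injective; toℕ<n; toℕ-fromℕ; toℕ-fromℕ<; toℕ-inject₁; splitAt-join; join-splitAt; punchInᵢ≢i; punchIn-injective; <⇒≢; opposite-involutive; combine-injective; combine-remQuot; remQuot-combine) renaming (_≟_ to _≟ᶠ_)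
open import Data.Fin.Relation.Unary.Top using (view; ‵fromℕ; ‵inject₁; view-fromℕ; view-inject₁)
open import Data.List as List using (List; []; _∷_; _++_; length)
open import Data.List.Membership.Propositional using (_∈_; find)
open import Data.List.Membership.Propositional.Properties using (∈-++⁺ˡ; ∈-++⁺ʳ; ∈-++⁻)
import Data.List.Properties as List
open import Data.List.Relation.Binary.Permutation.Propositional as Perm using (_↭_; ↭-sym; ↭-trans; ↭-refl; ↭-reflexive)
open import Data.List.Relation.Binary.Permutation.Propositional.Properties using (All-resp-↭; ↭-length)
open import Data.List.Relation.Unary.All as All using ([]; _∷_) renaming (All to Allᴸ)
open import Data.List.Relation.Unary.All.Properties using (¬Any⇒All¬; ++⁻ʳ)
open import Data.List.Relation.Unary.Any as Any using (Any; here; there)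
open import Data.Maybe as Maybe using (Maybe; just; nothing; maybe)
open import Data.Maybe.Properties using (map-injective)
open import Data.Nat as ℕ using (ℕ; zero; suc; _+_; _∸_; _≤_; _<_; s≤s)
open import Data.Nat.DivMod using (_mod_)
open import Data.Nat.Induction using (<-wellFounded)
open import Data.Nat.ListAction using (sum)
open import Data.Nat.ListAction.Properties using (sum-↭)
import Data.Nat.Properties as ℕ
open import Data.Product as Product using (∃; ∃₂; _×_; _,_; proj₁; proj₂; uncurry)
open import Data.Product.Properties using () renaming (≡-dec to ×-≡-dec)
open import Data.Sum as Sum using (_⊎_; inj₁; inj₂)
open import Data.Sum.Properties using (inj₁-injective; inj₂-injective; ≡-dec)
open import Data.Sum.Relation.Binary.Pointwise using (Pointwise; inj₁; inj₂)
open import Data.Vec as Vec using (Vec; []; _∷_; lookup)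
open import Data.Vec.Functional using () renaming (_∷_ to _◂_)
open import Data.Vec.Properties using (length-toList)
open import Data.Vec.Relation.Unary.All using (All; []; _∷_)
open import Function using (_∘_; id; case_of_; Injection; Inverse; Equivalence; _⇔_; mk⇔; mk↣; mk↔ₛ′)
open import Induction.WellFounded using (Acc; acc)
open import Level using (0ℓ)
open import Relation.Binary using (Rel; Symmetric; DecidableEquality)
open import Relation.Binary.PropositionalEquality hiding ([_])
open import Relation.Nullary using (¬_; ¬?; Dec; does; yes; no; contradiction; _×-dec_; _⊎-dec_; _→-dec_)
open import Relation.Nullary.Decidable using (True; toWitness; decidable-stable)

-- The constant 5 comes from the subdivision. The new vertex has two neighbours in each copy, the
-- ends of an edge that has just been removed, so a clique through it contains at most one of them
-- per copy. A K₄ may thus appear, but no K₅.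
--
-- Subdivision must be repeatable without end, so every step has to leave vertex-disjoint edges for
-- the later ones. Each new vertex therefore waits in a queue until it has been an end of one
-- subdivided edge in every copy.
--
-- The list of shapes is dictated by the fact that a part of order below 7 has no packing. Such a
-- remainder, a single cycle of length at most 6 or two triangles, has to be absorbed into the shape
-- that is split off; this gives finitely many cases with short cycles and five families with a long
-- one next to a remainder or alone being the sixth.
--
-- In the induction over the parts, connectivity by two copies alone is required only of the shape
-- that is split off, so it has to be certified only for the tabulated and the growing packings.

private variable
  U U′ W W′ D : Set
  R : Rel U 0ℓ
  R′ : Rel U′ 0ℓ
  S : Rel W 0ℓ
  S′ : Rel W′ 0ℓ
  T : Rel D 0ℓ
  m n : ℕ

-- Isomorphism of graphs on arbitrary vertex types

infix 4 _≃_

-- Vertex types stay arbitrary because unions, subdivisions and coordinates live most naturally on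
-- sums, `Maybe` and pairs; `≃⇒≅` leads back to `Fin`.
record _≃_ {U W : Set} (R : Rel U 0ℓ) (S : Rel W 0ℓ) : Set where
  field
    to        : U → W
    from      : W → U
    to-from   : ∀ w → to (from w) ≡ w
    from-to   : ∀ u → from (to u) ≡ u
    to-edge   : ∀ {x y} → R x y → S (to x) (to y)
    from-edge : ∀ {x y} → S x y → R (from x) (from y)

  to-injective : ∀ {x y} → to x ≡ to y → x ≡ y
  to-injective {x} {y} e = trans (sym (from-to x)) (trans (cong from e) (from-to y))

  from-injective : ∀ {x y} → from x ≡ from y → x ≡ y
  from-injective {x} {y} e = trans (sym (to-from x)) (trans (cong to e) (to-from y))

≃-refl : R ≃ R
≃-refl = record
  { to = id ; from = id ; to-from = λ _ → refl ; from-to = λ _ → refl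
  ; to-edge = id ; from-edge = id }

≃-sym : R ≃ S → S ≃ R
≃-sym φ = record
  { to = from ; from = to ; to-from = from-to ; from-to = to-from
  ; to-edge = from-edge ; from-edge = to-edge }
  where open _≃_ φ

≃-trans : R ≃ S → S ≃ T → R ≃ T
≃-trans φ ψ = record
  { to        = ψ.to ∘ φ.to
  ; from      = φ.from ∘ ψ.from
  ; to-from   = λ b → trans (cong ψ.to (φ.to-from _)) (ψ.to-from b)
  ; from-to   = λ a → trans (cong φ.from (ψ.from-to _)) (φ.from-to a)
  ; to-edge   = ψ.to-edge ∘ φ.to-edge
  ; from-edge = φ.from-edge ∘ ψ.from-edge }
  where
  module φ = _≃_ φ
  module ψ = _≃_ ψ

⊎-cong : R ≃ R′ → S ≃ S′ → Pointwise R S ≃ Pointwise R′ S′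
⊎-cong φ ψ = record
  { to        = Sum.map φ.to ψ.to
  ; from      = Sum.map φ.from ψ.from
  ; to-from   = λ { (inj₁ a) → cong inj₁ (φ.to-from a) ; (inj₂ b) → cong inj₂ (ψ.to-from b) }
  ; from-to   = λ { (inj₁ a) → cong inj₁ (φ.from-to a) ; (inj₂ b) → cong inj₂ (ψ.from-to b) }
  ; to-edge   = λ { (inj₁ e) → inj₁ (φ.to-edge e) ; (inj₂ e) → inj₂ (ψ.to-edge e) }
  ; from-edge = λ { (inj₁ e) → inj₁ (φ.from-edge e) ; (inj₂ e) → inj₂ (ψ.from-edge e) } }
  where
  module φ = _≃_ φ
  module ψ = _≃_ ψ

⊎-swap : Pointwise R S ≃ Pointwise S R
⊎-swap = record
  { to        = Sum.swap
  ; from      = Sum.swap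
  ; to-from   = λ { (inj₁ _) → refl ; (inj₂ _) → refl }
  ; from-to   = λ { (inj₁ _) → refl ; (inj₂ _) → refl }
  ; to-edge   = λ { (inj₁ e) → inj₂ e ; (inj₂ e) → inj₁ e }
  ; from-edge = λ { (inj₁ e) → inj₂ e ; (inj₂ e) → inj₁ e } }

⊎-assoc : Pointwise (Pointwise R S) T ≃ Pointwise R (Pointwise S T)
⊎-assoc = record
  { to        = Sum.assocʳ
  ; from      = Sum.assocˡ
  ; to-from   = λ { (inj₁ _) → refl ; (inj₂ (inj₁ _)) → refl ; (inj₂ (inj₂ _)) → refl }
  ; from-to   = λ { (inj₁ (inj₁ _)) → refl ; (inj₁ (inj₂ _)) → refl ; (inj₂ _) → refl }
  ; to-edge   = λ { (inj₁ (inj₁ e)) → inj₁ e ; (inj₁ (inj₂ e)) → inj₂ (inj₁ e) ; (inj₂ e) → inj₂ (inj₂ e) }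
  ; from-edge = λ { (inj₁ e) → inj₁ (inj₁ e) ; (inj₂ (inj₁ e)) → inj₁ (inj₂ e) ; (inj₂ (inj₂ e)) → inj₂ e } }

≅⇒≃ : ∀ {m n} {G : Graph m} {H : Graph n} → G ≅ H → Adj G ≃ Adj H
≅⇒≃ {H = H} φ = record
  { to        = to
  ; from      = from
  ; to-from   = strictlyInverseˡ
  ; from-to   = strictlyInverseʳ
  ; to-edge   = λ {x} {y} → Equivalence.to (preserves x y)
  ; from-edge = λ {x} {y} e → Equivalence.from (preserves _ _)
      (subst₂ (Adj H) (sym (strictlyInverseˡ x)) (sym (strictlyInverseˡ y)) e) }
  where
  open _≅_ φ
  open Inverse bijection

≃⇒≅ : ∀ {m n} {G : Graph m} {H : Graph n} → Adj G ≃ Adj H → G ≅ H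
≃⇒≅ {G = G} φ = record
  { bijection = mk↔ₛ′ to from to-from from-to
  ; preserves = λ u v → mk⇔ to-edge
      (λ e → subst₂ (Adj G) (from-to u) (from-to v) (from-edge e)) }
  where open _≃_ φ

-- Unions of cycles indexed by the list of lengths

Vertex : List ℕ → Set
Vertex []       = ⊥
Vertex (n ∷ ns) = Fin n ⊎ Vertex ns

Edge : ∀ ns → Rel (Vertex ns) 0ℓ
Edge []       = λ _ _ → ⊥
Edge (n ∷ ns) = Pointwise (Adj (C n)) (Edge ns)

∪≃⊎ : ∀ {m n} {G : Graph m} {H : Graph n} → Adj (G ∪ H) ≃ Pointwise (Adj G) (Adj H)
∪≃⊎ {m} {n} {G} {H} = record
  { to        = splitAt m
  ; from      = join m n
  ; to-from   = splitAt-join m n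
  ; from-to   = join-splitAt m n
  ; to-edge   = id
  ; from-edge = λ {x} {y} e →
      subst₂ (Pointwise (Adj G) (Adj H)) (sym (splitAt-join m n x)) (sym (splitAt-join m n y)) e }

⋃C≃Edge : ∀ {k} (ns : Vec ℕ k) → Adj (⋃C ns) ≃ Edge (Vec.toList ns)
⋃C≃Edge []       = record
  { to = λ () ; from = λ () ; to-from = λ () ; from-to = λ () ; to-edge = λ () ; from-edge = λ () }
⋃C≃Edge (n ∷ ns) = ≃-trans (∪≃⊎ {G = C n} {H = ⋃C ns}) (⊎-cong ≃-refl (⋃C≃Edge ns))

Edge-++ : ∀ ns ms → Edge (ns ++ ms) ≃ Pointwise (Edge ns) (Edge ms)
Edge-++ []       ms = record
  { to        = inj₂
  ; from      = λ { (inj₂ v) → v }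
  ; to-from   = λ { (inj₂ _) → refl }
  ; from-to   = λ _ → refl
  ; to-edge   = inj₂
  ; from-edge = λ { (inj₂ e) → e } }
Edge-++ (n ∷ ns) ms = ≃-trans (⊎-cong ≃-refl (Edge-++ ns ms)) (≃-sym ⊎-assoc)

Edge-↭ : ∀ {ns ms} → ns ↭ ms → Edge ns ≃ Edge ms
Edge-↭ Perm.refl         = ≃-refl
Edge-↭ (Perm.prep _ p)   = ⊎-cong ≃-refl (Edge-↭ p)
Edge-↭ (Perm.swap _ _ p) =
  ≃-trans (≃-sym ⊎-assoc) (≃-trans (⊎-cong ⊎-swap (Edge-↭ p)) ⊎-assoc)
Edge-↭ (Perm.trans p q)  = ≃-trans (Edge-↭ p) (Edge-↭ q)

-- Packings, totals and their transport along isomorphisms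

record Packed {U : Set} (R : Rel U 0ℓ) : Set where
  field
    place     : Fin 3 → U → U
    injective : ∀ i {u v} → place i u ≡ place i v → u ≡ v
    apart     : ∀ {i j} → i ≢ j → ∀ {u v u′ v′} → R u v → R u′ v′ →
                place i u ≡ place j u′ → place i v ≡ place j v′ → ⊥

  Layer : Fin 3 → Rel U 0ℓ
  Layer i x y = ∃₂ λ u v → place i u ≡ x × place i v ≡ y × R u v

  Total : Rel U 0ℓ
  Total x y = ∃ λ i → Layer i x y

  LowerTotal : Rel U 0ℓ
  LowerTotal x y = ∃ λ i → i ≢ 2F × Layer i x y

open Packed public using (Total; LowerTotal)

transport : R ≃ S → Packed R → Packed S
transport φ P = record
  { place     = λ i → to ∘ place i ∘ from
  ; injective = λ i e → from-injective (injective i (to-injective e))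
  ; apart     = λ i≢j e e′ p q →
      apart i≢j (from-edge e) (from-edge e′) (to-injective p) (to-injective q) }
  where
  open _≃_ φ
  open Packed P

transport-Total : (φ : R ≃ S) (P : Packed R) → Total P ≃ Total (transport φ P)
transport-Total φ P = record
  { to        = to
  ; from      = from
  ; to-from   = to-from
  ; from-to   = from-to
  ; to-edge   = λ { (i , u , v , refl , refl , e) →
      i , to u , to v , cong (to ∘ place i) (from-to u) , cong (to ∘ place i) (from-to v) , to-edge e }
  ; from-edge = λ { (i , u , v , refl , refl , e) →
      i , from u , from v , sym (from-to _) , sym (from-to _) , from-edge e } }
  where
  open _≃_ φ
  open Packed P

module _ {n} {G : Graph n} where

  toPacking : Packed (Adj G) → Packing G
  toPacking P = record
    { α        = λ i → mk↣ (injective i)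
    ; disjoint = λ { i j i≢j x y (u , v , p , q , e) (u′ , v′ , p′ , q′ , e′) →
        apart i≢j e e′ (trans p (sym p′)) (trans q (sym q′)) } }
    where open Packed P

  total≃Total : (P : Packed (Adj G)) → Adj (Packing.total (toPacking P)) ≃ Total P
  total≃Total P = record
    { to        = id
    ; from      = id
    ; to-from   = λ _ → refl
    ; from-to   = λ _ → refl
    ; to-edge   = λ { (inj₁ e) → 0F , e ; (inj₂ (inj₁ e)) → 1F , e ; (inj₂ (inj₂ e)) → 2F , e }
    ; from-edge = λ { (0F , e) → inj₁ e ; (1F , e) → inj₂ (inj₁ e) ; (2F , e) → inj₂ (inj₂ e) } }

TwoTotals : Rel U 0ℓ → Set
TwoTotals R = ∃₂ λ (P Q : Packed R) → ¬ (Total P ≃ Total Q)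

distinctPackings : ∀ {n} {G : Graph n} → R ≃ Adj G → TwoTotals R → HasDistinctPackings G
distinctPackings {R = R} {G = G} φ (P , Q , P≄Q) =
  toPacking (transport φ P) , toPacking (transport φ Q) , λ ψ →
    P≄Q (≃-trans (totals P) (≃-trans (≅⇒≃ ψ) (≃-sym (totals Q))))
  where
  totals : ∀ P → Total P ≃ Adj (Packing.total (toPacking {G = G} (transport φ P)))
  totals P = ≃-trans (transport-Total φ P) (≃-sym (total≃Total {G = G} (transport φ P)))

transport-TwoTotals : R ≃ S → TwoTotals R → TwoTotals S
transport-TwoTotals φ (P , Q , P≄Q) = transport φ P , transport φ Q , λ ψ →
  P≄Q (≃-trans (transport-Total φ P) (≃-trans ψ (≃-sym (transport-Total φ Q))))

-- Two-valued functions replace walks: an isomorphism acts by mere composition, and a disconnection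
-- is witnessed by one function that is constant along all edges.
Connected : Rel U 0ℓ → Set
Connected T = ∀ (f : _ → Bool) → (∀ {x y} → T x y → f x ≡ f y) → ∀ x y → f x ≡ f y

Connected-≃ : R ≃ S → Connected R → Connected S
Connected-≃ φ conn f const x y =
  subst₂ (λ a b → f a ≡ f b) (to-from x) (to-from y)
    (conn (f ∘ to) (λ e → const (to-edge e)) (from x) (from y))
  where open _≃_ φ

Connected-⊆ : ∀ {R S : Rel U 0ℓ} → (∀ {x y} → R x y → S x y) → Connected R → Connected S
Connected-⊆ R⊆S conn f const = conn f (λ e → const (R⊆S e))

HasConnected : Rel U 0ℓ → Set
HasConnected R = ∃ λ (P : Packed R) → Connected (Total P)

-- The third copy can be moved freely without disconnecting the total.
HasRobust : Rel U 0ℓ → Set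
HasRobust R = ∃ λ (P : Packed R) → Connected (LowerTotal P)

robust⇒connected : HasRobust R → HasConnected R
robust⇒connected (P , conn) = P , Connected-⊆ (λ { (i , _ , e) → i , e }) conn

transport-HasConnected : R ≃ S → HasConnected R → HasConnected S
transport-HasConnected φ (P , conn) = transport φ P , Connected-≃ (transport-Total φ P) conn

transport-HasRobust : R ≃ S → HasRobust R → HasRobust S
transport-HasRobust φ (P , conn) = transport φ P , λ f const x y →
  subst₂ (λ a b → f a ≡ f b) (to-from x) (to-from y)
    (conn (f ∘ to)
      (λ { (i , i≢2 , u , v , refl , refl , e) →
           const (i , i≢2 , to u , to v , cong (to ∘ place i) (from-to u) , cong (to ∘ place i) (from-to v) , to-edge e) })
      (from x) (from y))
  where
  open _≃_ φ
  open Packed P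

-- Disjoint unions of packings, plain and with one exchange

module _ {U′ W′ : Set} {R : Rel U′ 0ℓ} {S : Rel W′ 0ℓ} (P : Packed R) (Q : Packed S) where
  private
    module P = Packed P
    module Q = Packed Q

  union : Packed (Pointwise R S)
  union = record
    { place     = λ i → Sum.map (P.place i) (Q.place i)
    ; injective = inj
    ; apart     = ap }
    where
    inj : ∀ i {u v} → Sum.map (P.place i) (Q.place i) u ≡ Sum.map (P.place i) (Q.place i) v → u ≡ v
    inj i {inj₁ _} {inj₁ _} e = cong inj₁ (P.injective i (inj₁-injective e))
    inj i {inj₂ _} {inj₂ _} e = cong inj₂ (Q.injective i (inj₂-injective e))
    ap : ∀ {i j} → i ≢ j → ∀ {u v u′ v′} → Pointwise R S u v → Pointwise R S u′ v′ →
         Sum.map (P.place i) (Q.place i) u ≡ Sum.map (P.place j) (Q.place j) u′ →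
         Sum.map (P.place i) (Q.place i) v ≡ Sum.map (P.place j) (Q.place j) v′ → ⊥
    ap i≢j (inj₁ e) (inj₁ e′) p q = P.apart i≢j e e′ (inj₁-injective p) (inj₁-injective q)
    ap i≢j (inj₂ e) (inj₂ e′) p q = Q.apart i≢j e e′ (inj₂-injective p) (inj₂-injective q)

  union-disconnected : U′ → W′ → ¬ Connected (Total union)
  union-disconnected x y conn = contradiction
    (conn side (λ { (_ , _ , _ , refl , refl , inj₁ _) → refl
                  ; (_ , _ , _ , refl , refl , inj₂ _) → refl }) (inj₁ x) (inj₂ y))
    λ ()
    where
    side : _ → Bool
    side (inj₁ _) = true
    side (inj₂ _) = false

  module _ (_≟₁_ : DecidableEquality U′) (_≟₂_ : DecidableEquality W′)
           (irrefl₁ : ∀ {u} → ¬ R u u) (irrefl₂ : ∀ {w} → ¬ S w w) (x : U′) (y : W′) where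

    private
      exchange : U′ ⊎ W′ → U′ ⊎ W′
      exchange (inj₁ u) with u ≟₁ x
      ... | yes _ = inj₂ y
      ... | no  _ = inj₁ u
      exchange (inj₂ w) with w ≟₂ y
      ... | yes _ = inj₁ x
      ... | no  _ = inj₂ w

      exchange-x : exchange (inj₁ x) ≡ inj₂ y
      exchange-x with x ≟₁ x
      ... | yes _  = refl
      ... | no x≢x = contradiction refl x≢x

      exchange-y : exchange (inj₂ y) ≡ inj₁ x
      exchange-y with y ≟₂ y
      ... | yes _  = refl
      ... | no y≢y = contradiction refl y≢y

      involutive : ∀ v → exchange (exchange v) ≡ v
      involutive (inj₁ u) with u ≟₁ x in eq
      ... | yes refl = exchange-y
      ... | no _ rewrite eq = refl
      involutive (inj₂ w) with w ≟₂ y in eq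
      ... | yes refl = exchange-x
      ... | no _ rewrite eq = refl

      module ∪ = Packed union

      twistedPlace : Fin 3 → U′ ⊎ W′ → U′ ⊎ W′
      twistedPlace 0F = ∪.place 0F
      twistedPlace 1F = ∪.place 1F
      twistedPlace 2F = exchange ∘ ∪.place 2F

      -- An edge of the third copy that the exchange affects joins the two sides.
      apart₂ : ∀ {j} → 2F ≢ j → ∀ {u v u′ v′} → Pointwise R S u v → Pointwise R S u′ v′ →
               exchange (∪.place 2F u) ≡ ∪.place j u′ → exchange (∪.place 2F v) ≡ ∪.place j v′ → ⊥
      apart₂ 2≢j {inj₁ u} {inj₁ v} (inj₁ e) e′ p q with P.place 2F u ≟₁ x | P.place 2F v ≟₁ x
      apart₂ 2≢j (inj₁ e) e′ p q | yes refl | yes r = irrefl₁ (subst (R _) (P.injective 2F r) e)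
      apart₂ 2≢j (inj₁ e) (inj₁ _) () q | yes _ | no _
      apart₂ 2≢j (inj₁ e) (inj₂ _) p () | yes _ | no _
      apart₂ 2≢j (inj₁ e) (inj₁ _) p () | no _ | yes _
      apart₂ 2≢j (inj₁ e) (inj₂ _) () q | no _ | yes _
      ... | no _ | no _ = ∪.apart 2≢j (inj₁ e) e′ p q
      apart₂ 2≢j {inj₂ u} {inj₂ v} (inj₂ e) e′ p q with Q.place 2F u ≟₂ y | Q.place 2F v ≟₂ y
      apart₂ 2≢j (inj₂ e) e′ p q | yes refl | yes r = irrefl₂ (subst (S _) (Q.injective 2F r) e)
      apart₂ 2≢j (inj₂ e) (inj₂ _) () q | yes _ | no _
      apart₂ 2≢j (inj₂ e) (inj₁ _) p () | yes _ | no _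
      apart₂ 2≢j (inj₂ e) (inj₂ _) p () | no _ | yes _
      apart₂ 2≢j (inj₂ e) (inj₁ _) () q | no _ | yes _
      ... | no _ | no _ = ∪.apart 2≢j (inj₂ e) e′ p q

    twistedUnion : Packed (Pointwise R S)
    twistedUnion = record { place = twistedPlace ; injective = inj ; apart = ap }
      where
      inj : ∀ i {u v} → twistedPlace i u ≡ twistedPlace i v → u ≡ v
      inj 0F e = ∪.injective 0F e
      inj 1F e = ∪.injective 1F e
      inj 2F e = ∪.injective 2F
        (trans (sym (involutive _)) (trans (cong exchange e) (involutive _)))
      ap : ∀ {i j} → i ≢ j → ∀ {u v u′ v′} → Pointwise R S u v → Pointwise R S u′ v′ →
           twistedPlace i u ≡ twistedPlace j u′ → twistedPlace i v ≡ twistedPlace j v′ → ⊥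
      ap {0F} {0F} i≢j e e′ p q = i≢j refl
      ap {0F} {1F} i≢j e e′ p q = ∪.apart i≢j e e′ p q
      ap {1F} {0F} i≢j e e′ p q = ∪.apart i≢j e e′ p q
      ap {1F} {1F} i≢j e e′ p q = i≢j refl
      ap {2F} {2F} i≢j e e′ p q = i≢j refl
      ap {2F} {0F} i≢j e e′ p q = apart₂ i≢j e e′ p q
      ap {2F} {1F} i≢j e e′ p q = apart₂ i≢j e e′ p q
      ap {0F} {2F} i≢j e e′ p q = apart₂ (i≢j ∘ sym) e′ e (sym p) (sym q)
      ap {1F} {2F} i≢j e e′ p q = apart₂ (i≢j ∘ sym) e′ e (sym p) (sym q)

    -- In the third copy, x and y trade their neighbours.  The neighbours of x are
    -- still connected to x by the other two copies of R, so y is linked to x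
    -- through them; the former neighbours of y are now adjacent to x.
    twistedUnion-connected : ∀ {u₀ u₁} → R u₀ u₁ → P.place 2F u₀ ≡ x →
      Connected (LowerTotal P) → Connected (Total Q) → Connected (Total twistedUnion)
    twistedUnion-connected {u₀} {u₁} e₀ refl conn₁ conn₂ f const = allEqual
      where
      layer₂ : ∀ {u v} → Pointwise R S u v →
               f (exchange (∪.place 2F u)) ≡ f (exchange (∪.place 2F v))
      layer₂ e = const (2F , _ , _ , refl , refl , e)

      const₁ : ∀ u v → f (inj₁ u) ≡ f (inj₁ v)
      const₁ = conn₁ (f ∘ inj₁) λ
        { (0F , _   , _ , _ , refl , refl , e) → const (0F , _ , _ , refl , refl , inj₁ e)
        ; (1F , _   , _ , _ , refl , refl , e) → const (1F , _ , _ , refl , refl , inj₁ e)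
        ; (2F , 2≢2 , _) → contradiction refl 2≢2 }

      y~x : f (inj₂ y) ≡ f (inj₁ x)
      y~x with layer₂ (inj₁ e₀)
      ... | eq rewrite exchange-x with P.place 2F u₁ ≟₁ x
      ... | yes r = contradiction (subst (R u₀) (P.injective 2F r) e₀) irrefl₁
      ... | no  _ = trans eq (const₁ _ _)

      step : ∀ {v w} → Total Q v w → f (inj₂ v) ≡ f (inj₂ w)
      step (0F , _ , _ , refl , refl , e) = const (0F , _ , _ , refl , refl , inj₂ e)
      step (1F , _ , _ , refl , refl , e) = const (1F , _ , _ , refl , refl , inj₂ e)
      step (2F , w , w′ , refl , refl , e) with layer₂ (inj₂ e)
      ... | eq with Q.place 2F w ≟₂ y | Q.place 2F w′ ≟₂ y
      ... | yes p | yes q = cong (f ∘ inj₂) (trans p (sym q))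
      ... | yes p | no _  = trans (cong (f ∘ inj₂) p) (trans y~x eq)
      ... | no _  | yes q = trans eq (trans (sym y~x) (cong (f ∘ inj₂) (sym q)))
      ... | no _  | no _  = eq

      const₂ : ∀ v w → f (inj₂ v) ≡ f (inj₂ w)
      const₂ = conn₂ (f ∘ inj₂) step

      allEqual : ∀ v w → f v ≡ f w
      allEqual (inj₁ v) (inj₁ w) = const₁ v w
      allEqual (inj₁ v) (inj₂ w) = trans (const₁ v x) (trans (sym y~x) (const₂ y w))
      allEqual (inj₂ v) (inj₁ w) = trans (const₂ v y) (trans y~x (const₁ x w))
      allEqual (inj₂ v) (inj₂ w) = const₂ v w

Nonloop : Rel U 0ℓ → Set
Nonloop R = ∀ {u} → ¬ R u u

module _ {U W : Set} {R : Rel U 0ℓ} {S : Rel W 0ℓ}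
         (_≟₁_ : DecidableEquality U) (_≟₂_ : DecidableEquality W)
         (irrefl₁ : Nonloop R) (irrefl₂ : Nonloop S)
         {u₀ u₁ : U} (edge : R u₀ u₁) (w₀ : W) where

  union-connected : HasRobust R → HasConnected S → HasConnected (Pointwise R S)
  union-connected (P , conn₁) (Q , conn₂) =
    -- The exchanged vertex on the left is the image of an end of a known edge in the third copy;
    -- the image of the other end is the neighbour that links the two sides. On the right any vertex
    -- will do.
    twistedUnion P Q _≟₁_ _≟₂_ irrefl₁ irrefl₂ (Packed.place P 2F u₀) w₀ ,
    twistedUnion-connected P Q _≟₁_ _≟₂_ irrefl₁ irrefl₂ _ w₀ edge refl conn₁ conn₂

  union-twoTotals : HasRobust R → HasConnected S → TwoTotals (Pointwise R S)
  union-twoTotals r@(P , _) c@(Q , _) with union-connected r c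
  ... | T , conn = union P Q , T , λ φ →
    union-disconnected P Q u₀ w₀ (Connected-≃ (≃-sym φ) conn)

-- Rotations of a cycle and subdivision of its closing edge

prev : ∀ {k} → Fin (suc k) → Fin (suc k)
prev zero    = fromℕ _
prev (suc i) = inject₁ i

next : ∀ {k} → Fin (suc k) → Fin (suc k)
next i with view i
... | ‵fromℕ     = zero
... | ‵inject₁ j = suc j

next-fromℕ : ∀ k → next (fromℕ k) ≡ zero
next-fromℕ k rewrite view-fromℕ k = refl

next-inject₁ : ∀ {k} (i : Fin k) → next (inject₁ i) ≡ suc i
next-inject₁ i rewrite view-inject₁ i = refl

next-prev : ∀ {k} (i : Fin (suc k)) → next (prev i) ≡ i
next-prev zero    = next-fromℕ _
next-prev (suc i) = next-inject₁ i

prev-next : ∀ {k} (i : Fin (suc k)) → prev (next i) ≡ i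
prev-next i with view i
... | ‵fromℕ     = refl
... | ‵inject₁ j = refl

Next⇒prev : ∀ {k} {i j : Fin (suc k)} → Next i j → i ≡ prev j
Next⇒prev {j = suc j} (inj₁ e)       =
  toℕ-injective (trans (sym (ℕ.suc-injective e)) (sym (toℕ-inject₁ j)))
Next⇒prev {j = zero}  (inj₂ (e , _)) =
  toℕ-injective (trans (ℕ.suc-injective e) (sym (toℕ-fromℕ _)))

prev⇒Next : ∀ {k} (j : Fin (suc k)) → Next (prev j) j
prev⇒Next zero    = inj₂ (cong suc (toℕ-fromℕ _) , refl)
prev⇒Next (suc j) = inj₁ (cong suc (sym (toℕ-inject₁ j)))

-- Both images are recorded because the closing edge, between the last vertex and the first, is to
-- be moved onto the edge between `prev u` and `u`. Any rotation is an iterate of the shift by one.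
rotation : ∀ {k} (u : Fin (suc k)) →
  ∃ λ (φ : Adj (C (suc k)) ≃ Adj (C (suc k))) → _≃_.to φ zero ≡ u × _≃_.to φ (fromℕ k) ≡ prev u
rotation {k} = <-weakInduction _ (≃-refl , refl , refl) λ { i (φ , p , q) →
  ≃-trans φ forward ,
  trans (cong next p) (next-inject₁ i) , trans (cong next q) (next-prev (inject₁ i)) }
  where
  next-Next : {i j : Fin (suc k)} → Next i j → Next (next i) (next j)
  next-Next {i} {j} e = subst (λ v → Next v (next j))
    (trans (prev-next j) (sym (trans (cong next (Next⇒prev e)) (next-prev j)))) (prev⇒Next (next j))
  prev-Next : {i j : Fin (suc k)} → Next i j → Next (prev i) (prev j)
  prev-Next {i} {j} e = subst (λ v → Next v (prev j)) (cong prev (sym (Next⇒prev e))) (prev⇒Next (prev j))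
  forward : Adj (C (suc k)) ≃ Adj (C (suc k))
  forward = record
    { to        = next
    ; from      = prev
    ; to-from   = next-prev
    ; from-to   = prev-next
    ; to-edge   = λ { (i≢j , e) → (λ p → i≢j (trans (sym (prev-next _)) (trans (cong prev p) (prev-next _))))
                                  , Sum.map next-Next next-Next e }
    ; from-edge = λ { (i≢j , e) → (λ p → i≢j (trans (sym (next-prev _)) (trans (cong next p) (next-prev _))))
                                  , Sum.map prev-Next prev-Next e } }

SamePair : {U : Set} → U → U → Rel U 0ℓ
SamePair a b x y = (x ≡ a × y ≡ b) ⊎ (x ≡ b × y ≡ a)

-- `nothing` is the new vertex on the subdivided edge ab.
data Subdivide {U : Set} (T : Rel U 0ℓ) (a b : U) : Rel (Maybe U) 0ℓ where
  kept     : ∀ {x y} → T x y → ¬ SamePair a b x y → Subdivide T a b (just x) (just y)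
  new-left : ∀ {y} → y ≡ a ⊎ y ≡ b → Subdivide T a b nothing (just y)
  new-right : ∀ {x} → x ≡ a ⊎ x ≡ b → Subdivide T a b (just x) nothing

module _ {W : Set} {k : ℕ} where

  fromNew : Fin (suc (suc k)) ⊎ W → Maybe (Fin (suc k) ⊎ W)
  fromNew (inj₁ zero)    = nothing
  fromNew (inj₁ (suc i)) = just (inj₁ i)
  fromNew (inj₂ w)       = just (inj₂ w)

  toNew : Maybe (Fin (suc k) ⊎ W) → Fin (suc (suc k)) ⊎ W
  toNew nothing         = inj₁ zero
  toNew (just (inj₁ i)) = inj₁ (suc i)
  toNew (just (inj₂ w)) = inj₂ w

  top : Fin (suc k) ⊎ W
  top = inj₁ (fromℕ k)

  bottom : Fin (suc k) ⊎ W
  bottom = inj₁ zero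

-- The new vertex takes number 0 and the old ones move up by one: all old steps remain steps, and
-- the closing edge is replaced by the two edges at 0.
C-subdivides : ∀ {W : Set} {S : Rel W 0ℓ} {k} →
  Subdivide (Pointwise (Adj (C (3 ℕ.+ k))) S) bottom top ≃ Pointwise (Adj (C (4 ℕ.+ k))) S
C-subdivides {W} {S} {k} = record
  { to        = toNew
  ; from      = fromNew
  ; to-from   = λ { (inj₁ zero) → refl ; (inj₁ (suc _)) → refl ; (inj₂ _) → refl }
  ; from-to   = λ { nothing → refl ; (just (inj₁ _)) → refl ; (just (inj₂ _)) → refl }
  ; to-edge   = to-edge
  ; from-edge = from-edge }
  where
  len = 3 ℕ.+ k
  to-Next : ∀ {i j : Fin len} → Next i j → ¬ SamePair bottom top (inj₁ i) (inj₁ j) → Next {suc len} (suc i) (suc j)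
  to-Next (inj₁ e) _ = inj₁ (cong suc e)
  to-Next {i} {zero} e@(inj₂ _) ¬ends with Next⇒prev {i = i} e
  ... | refl = contradiction (inj₂ (refl , refl)) ¬ends
  SamePair-sym : ∀ {x y : Fin len ⊎ W} → SamePair bottom top x y → SamePair bottom top y x
  SamePair-sym (inj₁ (p , q)) = inj₂ (q , p)
  SamePair-sym (inj₂ (p , q)) = inj₁ (q , p)
  from-Next : ∀ {i j : Fin len} → Next {suc len} (suc i) (suc j) → Next i j × ¬ SamePair {U = Fin len ⊎ W} bottom top (inj₁ i) (inj₁ j)
  from-Next (inj₁ e) = inj₁ (ℕ.suc-injective e) ,
    -- Length at least 3 keeps the first and the last vertex from being consecutive along the path.
    λ { (inj₁ (refl , refl)) → contradiction e λ ()
      ; (inj₂ (refl , refl)) → contradiction e λ () }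
  to-edge : ∀ {x y} → Subdivide (Pointwise (Adj (C len)) S) bottom top x y → Pointwise (Adj (C (suc len))) S (toNew x) (toNew y)
  to-edge (kept (inj₁ (i≢j , e)) ¬ends) = inj₁ (i≢j ∘ suc-injective ,
    Sum.map (λ e → to-Next e ¬ends) (λ e → to-Next e (¬ends ∘ SamePair-sym)) e)
  to-edge (kept (inj₂ e) _)       = inj₂ e
  to-edge (new-left (inj₁ refl))  = inj₁ ((λ ()) , inj₁ (inj₁ refl))
  to-edge (new-left (inj₂ refl))  = inj₁ ((λ ()) , inj₂ (inj₂ (cong (4 ℕ.+_) (toℕ-fromℕ k) , refl)))
  to-edge (new-right (inj₁ refl)) = inj₁ ((λ ()) , inj₂ (inj₁ refl))
  to-edge (new-right (inj₂ refl)) = inj₁ ((λ ()) , inj₁ (inj₂ (cong (4 ℕ.+_) (toℕ-fromℕ k) , refl)))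
  ends : ∀ {j : Fin len} → Next {suc len} zero (suc j) ⊎ Next {suc len} (suc j) zero → inj₁ j ≡ bottom {W} ⊎ inj₁ j ≡ top {W}
  ends {zero}  (inj₁ _) = inj₁ refl
  ends {suc j} (inj₁ (inj₁ ()))
  ends {j} (inj₂ e) = inj₂ (cong inj₁ (suc-injective (Next⇒prev {i = suc j} e)))
  from-edge : ∀ {x y} → Pointwise (Adj (C (suc len))) S x y → Subdivide (Pointwise (Adj (C len)) S) bottom top (fromNew x) (fromNew y)
  from-edge {inj₁ zero} {inj₁ zero} (inj₁ (0≢0 , _)) = contradiction refl 0≢0
  from-edge {inj₁ zero} {inj₁ (suc j)} (inj₁ (_ , e)) = new-left (ends e)
  from-edge {inj₁ (suc i)} {inj₁ zero} (inj₁ (_ , e)) = new-right (ends (Sum.swap e))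
  from-edge {inj₁ (suc i)} {inj₁ (suc j)} (inj₁ (i≢j , inj₁ e)) =
    kept (inj₁ (i≢j ∘ cong suc , inj₁ (proj₁ (from-Next e)))) (proj₂ (from-Next e))
  from-edge {inj₁ (suc i)} {inj₁ (suc j)} (inj₁ (i≢j , inj₂ e)) =
    kept (inj₁ (i≢j ∘ cong suc , inj₂ (proj₁ (from-Next e)))) (proj₂ (from-Next e) ∘ SamePair-sym)
  from-edge (inj₂ e) = kept (inj₂ e) λ { (inj₁ ()) ; (inj₂ ()) }

-- Inserting one vertex into all three copies at once

Clique : {U : Set} → ℕ → Rel U 0ℓ → Set
Clique k T = ∃ λ (q : Fin k → _) → ∀ {i j} → i ≢ j → T (q i) (q j)

Clique-≃ : ∀ {U W} {R : Rel U 0ℓ} {S : Rel W 0ℓ} {k} → R ≃ S → Clique k R → Clique k S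
Clique-≃ φ (q , adjacent) = _≃_.to φ ∘ q , λ i≢j → _≃_.to-edge φ (adjacent i≢j)

CopyEdge : {U V : Set} → Rel U 0ℓ → (U → V) → Rel V 0ℓ
CopyEdge R f x y = ∃₂ λ u v → f u ≡ x × f v ≡ y × R u v

NoEdge : {W : Set} → Rel W 0ℓ
NoEdge _ _ = ⊥

module Insertion {W : Set} {S : Rel W 0ℓ} {k : ℕ} (irreflS : Nonloop S) (symS : Symmetric S) where

  private
    len = 3 ℕ.+ k
    V  = Fin len ⊎ W
    V⁺ = Fin (suc len) ⊎ W

  Rᶜ : Rel V 0ℓ
  Rᶜ = Pointwise (Adj (C len)) S

  R⁺ : Rel V⁺ 0ℓ
  R⁺ = Pointwise (Adj (C (suc len))) S

  -- Only the head cycle is to be lengthened, so an edge chosen for subdivision must be known to lie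
  -- on it; `Rᶜ` also contains the edges of `S`.
  Cyc : Rel V 0ℓ
  Cyc = Pointwise (Adj (C len)) NoEdge

  Cyc⁺ : Rel V⁺ 0ℓ
  Cyc⁺ = Pointwise (Adj (C (suc len))) NoEdge

  irreflR : Nonloop Rᶜ
  irreflR (inj₁ (u≢u , _)) = u≢u refl
  irreflR (inj₂ e)         = irreflS e

  symR : Symmetric Rᶜ
  symR = λ { (inj₁ (i≢j , e)) → inj₁ (i≢j ∘ sym , Sum.swap e) ; (inj₂ e) → inj₂ (symS e) }

  SamePair-swap : ∀ {V : Set} {a b x y : V} → SamePair a b x y → SamePair b a x y
  SamePair-swap (inj₁ p) = inj₂ p
  SamePair-swap (inj₂ p) = inj₁ p

  -- `sound` and `complete` are the two inclusions between the copy `f⁺` of the longer cycle union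
  -- and the copy `f` with its edge ab subdivided. `cyc` keeps track of the head cycle alone, from
  -- which the edges for later subdivisions are taken.
  record Subdivision (f : V → V) (a b : V) : Set where
    field
      f⁺        : V⁺ → V⁺
      injective : ∀ {u v} → f⁺ u ≡ f⁺ v → u ≡ v
      sound     : ∀ {u v} → R⁺ u v → Subdivide (CopyEdge Rᶜ f) a b (fromNew (f⁺ u)) (fromNew (f⁺ v))
      complete  : ∀ {x y} → Subdivide (CopyEdge Rᶜ f) a b x y → CopyEdge R⁺ f⁺ (toNew x) (toNew y)
      cyc       : ∀ {x y} → Subdivide (CopyEdge Cyc f) a b x y → CopyEdge Cyc⁺ f⁺ (toNew x) (toNew y)

  private module ν {S : Rel W 0ℓ} = _≃_ (C-subdivides {S = S} {k = k})

  -- Since `f⁺` fixes the new vertex for every `f`, copies treated separately have their new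
  -- vertices at the same place: this is how the three are identified.
  closing : (f : V → V) → (∀ {u v} → f u ≡ f v → u ≡ v) → Subdivision f (f bottom) (f top)
  closing f inj = record
    { f⁺        = toNew ∘ Maybe.map f ∘ fromNew
    ; injective = λ e → ν.from-injective {S = S} (map-injective inj (ν.to-injective {S = S} e))
    ; sound     = λ e → subst₂ (Subdivide _ _ _) (sym (ν.from-to {S = S} _)) (sym (ν.from-to {S = S} _)) (image (ν.from-edge e))
    ; complete  = preimage
    ; cyc       = preimage }
    where
    image : ∀ {x y} → Subdivide Rᶜ bottom top x y →
            Subdivide (CopyEdge Rᶜ f) (f bottom) (f top) (Maybe.map f x) (Maybe.map f y)
    image (kept e ¬ends) = kept (_ , _ , refl , refl , e)
      (¬ends ∘ Sum.map (λ (p , q) → inj p , inj q) (λ (p , q) → inj p , inj q))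
    image (new-left e)   = new-left (Sum.map (cong f) (cong f) e)
    image (new-right e)  = new-right (Sum.map (cong f) (cong f) e)
    preimage : ∀ {S : Rel W 0ℓ} {x y} → Subdivide (CopyEdge (Pointwise (Adj (C len)) S) f) (f bottom) (f top) x y →
      CopyEdge (Pointwise (Adj (C (suc len))) S) (toNew ∘ Maybe.map f ∘ fromNew) (toNew x) (toNew y)
    preimage {S} {x} {y} s = lift s
      where
      eq : ∀ z → toNew (Maybe.map f (fromNew (toNew z))) ≡ toNew (Maybe.map f z)
      eq z = cong (toNew ∘ Maybe.map f) (ν.from-to {S = S} z)
      lift : ∀ {x y} → Subdivide (CopyEdge (Pointwise (Adj (C len)) S) f) (f bottom) (f top) x y →
        CopyEdge (Pointwise (Adj (C (suc len))) S) (toNew ∘ Maybe.map f ∘ fromNew) (toNew x) (toNew y)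
      lift (kept (u , v , refl , refl , e) ¬ends) =
        toNew (just u) , toNew (just v) , eq (just u) , eq (just v) ,
        ν.to-edge (kept e (¬ends ∘ Sum.map (λ (p , q) → cong f p , cong f q) (λ (p , q) → cong f p , cong f q)))
      lift (new-left (inj₁ refl))  = toNew nothing , toNew (just bottom) , eq nothing , eq (just bottom) , ν.to-edge (new-left (inj₁ refl))
      lift (new-left (inj₂ refl))  = toNew nothing , toNew (just top) , eq nothing , eq (just top) , ν.to-edge (new-left (inj₂ refl))
      lift (new-right (inj₁ refl)) = toNew (just bottom) , toNew nothing , eq (just bottom) , eq nothing , ν.to-edge (new-right (inj₁ refl))
      lift (new-right (inj₂ refl)) = toNew (just top) , toNew nothing , eq (just top) , eq nothing , ν.to-edge (new-right (inj₂ refl))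

  Subdivide-map : ∀ {T T′ : Rel V 0ℓ} {a b x y} → (∀ {x y} → T x y → T′ x y) →
    Subdivide T a b x y → Subdivide T′ a b x y
  Subdivide-map g (kept e ¬ends) = kept (g e) ¬ends
  Subdivide-map g (new-left e)   = new-left e
  Subdivide-map g (new-right e)  = new-right e

  Subdivide-swap : ∀ {T : Rel V 0ℓ} {a b x y} → Subdivide T a b x y → Subdivide T b a x y
  Subdivide-swap (kept e ¬ends) = kept e (¬ends ∘ SamePair-swap)
  Subdivide-swap (new-left e)   = new-left (Sum.swap e)
  Subdivide-swap (new-right e)  = new-right (Sum.swap e)

  swapEnds : ∀ {f a b} → Subdivision f a b → Subdivision f b a
  swapEnds s = record
    { f⁺ = f⁺ ; injective = injective ; sound = Subdivide-swap ∘ sound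
    ; complete = complete ∘ Subdivide-swap ; cyc = cyc ∘ Subdivide-swap }
    where open Subdivision s

  -- A rotation of the head cycle is an automorphism, so composing `f` with it leaves the edge set
  -- of the copy unchanged while the given edge becomes the closing one. The other orientation of
  -- the edge only swaps its ends.
  subdivide : (f : V → V) → (∀ {u v} → f u ≡ f v → u ≡ v) → ∀ {a b} → CopyEdge Cyc f a b → Subdivision f a b
  subdivide f inj (inj₁ u , inj₁ v , refl , refl , inj₁ (_ , inj₂ e)) with Next⇒prev e
  ... | refl = rotated u
    where
    rotated : ∀ u → Subdivision f (f (inj₁ u)) (f (inj₁ (prev u)))
    rotated u with rotation u
    ... | φ , refl , p = subst (Subdivision f _) (cong (f ∘ inj₁) p) record
      { f⁺        = f⁺
      ; injective = injective
      ; sound     = Subdivide-map (λ { (_ , _ , p , q , e) → _ , _ , p , q , ρ.to-edge e }) ∘ sound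
      ; complete  = complete ∘ Subdivide-map (λ { (u , v , p , q , e) → ρ.from u , ρ.from v ,
                      trans (cong f (ρ.to-from u)) p , trans (cong f (ρ.to-from v)) q , ρ.from-edge e })
      ; cyc       = cyc ∘ Subdivide-map (λ { (u , v , p , q , e) → κ.from u , κ.from v ,
                      trans (cong f (κ.to-from u)) p , trans (cong f (κ.to-from v)) q , κ.from-edge e }) }
      where
      module ρ = _≃_ (⊎-cong φ (≃-refl {R = S}))
      module κ = _≃_ (⊎-cong φ (≃-refl {R = NoEdge {W}}))
      open Subdivision (closing (f ∘ ρ.to) (ρ.to-injective ∘ inj))
  subdivide f inj (inj₁ u , inj₁ v , refl , refl , inj₁ (u≢v , inj₁ e)) =
    swapEnds (subdivide f inj (inj₁ v , inj₁ u , refl , refl , inj₁ (u≢v ∘ sym , inj₂ e)))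

  -- The three edges have to be vertex-disjoint so that no neighbour of the new vertex is shared by
  -- two copies; the kept edges are disjoint already.
  module Inserted (P : Packed Rᶜ) (a b : Fin 3 → V)
    (edges : ∀ i → CopyEdge Cyc (Packed.place P i) (a i) (b i))
    (a≢a : ∀ {i j} → i ≢ j → a i ≢ a j) (b≢b : ∀ {i j} → i ≢ j → b i ≢ b j)
    (a≢b : ∀ {i j} → i ≢ j → a i ≢ b j) where

    open Packed P hiding (Total; LowerTotal)

    private
      module s i = Subdivision (subdivide (place i) (injective i) (edges i))

    shared : ∀ {i j} → i ≢ j → ∀ {y} → y ≡ a i ⊎ y ≡ b i → y ≡ a j ⊎ y ≡ b j → ⊥
    shared i≢j (inj₁ p) (inj₁ q) = a≢a i≢j (trans (sym p) q)
    shared i≢j (inj₁ p) (inj₂ q) = a≢b i≢j (trans (sym p) q)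
    shared i≢j (inj₂ p) (inj₁ q) = a≢b (i≢j ∘ sym) (trans (sym q) p)
    shared i≢j (inj₂ p) (inj₂ q) = b≢b i≢j (trans (sym p) q)

    packed⁺ : Packed R⁺
    packed⁺ = record
      { place     = s.f⁺
      ; injective = s.injective
      ; apart     = λ {i} {j} i≢j {u} {v} {u′} {v′} e e′ p q →
          separate i≢j (s.sound i e)
            (subst₂ (Subdivide _ _ _) (cong fromNew (sym p)) (cong fromNew (sym q)) (s.sound j e′)) }
      where
      separate : ∀ {i j} → i ≢ j → ∀ {x y} → Subdivide (Layer i) (a i) (b i) x y →
                 Subdivide (Layer j) (a j) (b j) x y → ⊥
      separate i≢j (kept (_ , _ , p , q , e) _) (kept (_ , _ , p′ , q′ , e′) _) =
        apart i≢j e e′ (trans p (sym p′)) (trans q (sym q′))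
      separate i≢j (new-left p)  (new-left q)  = shared i≢j p q
      separate i≢j (new-right p) (new-right q) = shared i≢j p q

    private module P⁺ = Packed packed⁺

    layer-sound : ∀ i {x y} → P⁺.Layer i x y → Subdivide (Layer i) (a i) (b i) (fromNew x) (fromNew y)
    layer-sound i (_ , _ , refl , refl , e) = s.sound i e

    layer-complete : ∀ i {x y} → Subdivide (Layer i) (a i) (b i) x y → P⁺.Layer i (toNew x) (toNew y)
    layer-complete = s.complete

    cyc-complete : ∀ i {x y} → Subdivide (CopyEdge Cyc (place i)) (a i) (b i) x y →
                   CopyEdge Cyc⁺ (P⁺.place i) (toNew x) (toNew y)
    cyc-complete = s.cyc

    toNew-fromNew : ∀ x → toNew (fromNew x) ≡ x
    toNew-fromNew = ν.to-from {S = S}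

    fromNew-toNew : ∀ x → fromNew (toNew x) ≡ x
    fromNew-toNew = ν.from-to {S = S}

    layer-place : ∀ i → Layer i (a i) (b i)
    layer-place i with edges i
    ... | u , v , p , q , inj₁ e = u , v , p , q , inj₁ e

    T⁺ : Rel (Maybe V) 0ℓ
    T⁺ x y = ∃ λ i → Subdivide (Layer i) (a i) (b i) x y

    total-sound : ∀ {x y} → Total packed⁺ x y → T⁺ (fromNew x) (fromNew y)
    total-sound (i , e) = i , layer-sound i e

    -- A subdivided edge is replaced by the path through the new vertex in the same copy, and every
    -- other edge is kept.
    LowerTotal⁺-connected : DecidableEquality V → Connected (LowerTotal P) → Connected (LowerTotal packed⁺)
    LowerTotal⁺-connected _≟_ conn f const x y =
      subst₂ (λ x y → f x ≡ f y) (toNew-fromNew x) (toNew-fromNew y) (allEqual (fromNew x) (fromNew y))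
      where
      g : Maybe V → Bool
      g = f ∘ toNew
      new : ∀ i → i ≢ 2F → ∀ {y} → y ≡ a i ⊎ y ≡ b i → g nothing ≡ g (just y)
      new i i≢2 e = const (i , i≢2 , layer-complete i (new-left e))
      old : ∀ {x y} → LowerTotal P x y → g (just x) ≡ g (just y)
      old {x} {y} (i , i≢2 , e) with x ≟ a i | y ≟ b i | x ≟ b i | y ≟ a i
      ... | yes p | yes q | _     | _     = trans (sym (new i i≢2 (inj₁ p))) (new i i≢2 (inj₂ q))
      ... | yes _ | no ¬q | no ¬r | _     = const (i , i≢2 , layer-complete i (kept e λ { (inj₁ (_ , q)) → ¬q q ; (inj₂ (r , _)) → ¬r r }))
      ... | yes _ | no ¬q | yes _ | no ¬s = const (i , i≢2 , layer-complete i (kept e λ { (inj₁ (_ , q)) → ¬q q ; (inj₂ (_ , s)) → ¬s s }))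
      ... | _     | _     | yes r | yes s = trans (sym (new i i≢2 (inj₂ r))) (new i i≢2 (inj₁ s))
      ... | no ¬p | _     | no ¬r | _     = const (i , i≢2 , layer-complete i (kept e λ { (inj₁ (p , _)) → ¬p p ; (inj₂ (r , _)) → ¬r r }))
      ... | no ¬p | _     | yes _ | no ¬s = const (i , i≢2 , layer-complete i (kept e λ { (inj₁ (p , _)) → ¬p p ; (inj₂ (_ , s)) → ¬s s }))
      allEqual : ∀ x y → g x ≡ g y
      allEqual (just x) (just y) = conn (g ∘ just) old x y
      allEqual (just x) nothing  = trans (conn (g ∘ just) old x (a 0F)) (sym (new 0F (λ ()) (inj₁ refl)))
      allEqual nothing  (just y) = trans (new 0F (λ ()) (inj₁ refl)) (conn (g ∘ just) old (a 0F) y)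
      allEqual nothing  nothing  = refl

    -- The neighbourhood of the new vertex is covered by the three removed
    -- edges, so no two adjacent neighbours come from the same one.
    Clique-old : ¬ Clique 5 (Total P) → ¬ Clique 5 (Total packed⁺)
    Clique-old free (q , adjacent) with any? (λ i → isNew? (fromNew (q i)))
      where
      isNew? : (x : Maybe V) → Dec (x ≡ nothing)
      isNew? nothing  = yes refl
      isNew? (just _) = no λ ()
    ... | no none = free (proj₁ ∘ old , λ {i} {j} i≢j → oldEdge (subst₂ T⁺ (proj₂ (old i)) (proj₂ (old j)) (total-sound (adjacent i≢j))))
      where
      old : ∀ i → ∃ λ x → fromNew (q i) ≡ just x
      old i with fromNew (q i) in eq
      ... | just x  = x , refl
      ... | nothing = contradiction (i , eq) none
      oldEdge : ∀ {x y} → T⁺ (just x) (just y) → Total P x y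
      oldEdge (i , kept e _) = i , e
    ... | yes (i₀ , isNew) = collision
      where
      Side : Maybe V → Fin 3 → Set
      Side x l = x ≡ just (a l) ⊎ x ≡ just (b l)
      side : ∀ {x} → T⁺ nothing x → ∃ (Side x)
      side (l , new-left (inj₁ p)) = l , inj₁ (cong just p)
      side (l , new-left (inj₂ p)) = l , inj₂ (cong just p)
      sides : ∀ j → ∃ (Side (fromNew (q (punchIn i₀ j))))
      sides j = side (subst (λ x → T⁺ x (fromNew (q (punchIn i₀ j)))) isNew (total-sound (adjacent (punchInᵢ≢i i₀ j ∘ sym))))
      noLoop : ∀ {x} → ¬ T⁺ (just x) (just x)
      noLoop (l , kept (u , v , p , q , e) _) = irreflR (subst (λ v → Rᶜ u v) (injective l (trans q (sym p))) e)
      -- Copy `l` has lost this edge, and the other two never had it, the packing being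
      -- edge-disjoint.
      removed : ∀ {l} → ¬ T⁺ (just (a l)) (just (b l))
      removed {l} (l′ , kept e@(_ , _ , p , q , r) ¬ends) with l ≟ᶠ l′
      ... | yes refl = ¬ends (inj₁ (refl , refl))
      ... | no l≢l′ with layer-place l
      ...   | _ , _ , p′ , q′ , r′ = apart l≢l′ r′ r (trans p′ (sym p)) (trans q′ (sym q))
      T⁺-sym : ∀ {x y} → T⁺ (just x) (just y) → T⁺ (just y) (just x)
      T⁺-sym (l , kept (u , v , p , q , e) ¬ends) = l , kept (v , u , q , p , symR e)
        (λ { (inj₁ (r , s)) → ¬ends (inj₂ (s , r)) ; (inj₂ (r , s)) → ¬ends (inj₁ (s , r)) })
      clash : ∀ {x y l} → Side x l → Side y l → ¬ T⁺ x y
      clash (inj₁ refl) (inj₁ refl) = noLoop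
      clash (inj₁ refl) (inj₂ refl) = removed
      clash (inj₂ refl) (inj₁ refl) = removed ∘ T⁺-sym
      clash (inj₂ refl) (inj₂ refl) = noLoop
      collision : ⊥
      collision with pigeonhole (ℕ.n<1+n 3) (proj₁ ∘ sides)
      ... | i , j , i<j , eq = clash (subst (Side (fromNew (q (punchIn i₀ i)))) eq (proj₂ (sides i))) (proj₂ (sides j))
        (total-sound (adjacent (<⇒≢ i<j ∘ punchIn-injective i₀ i j)))

-- Unbounded growth of the head cycle

-- The three vertices w were inserted last.  In copy i, the edges from the last
-- i + 1 of them to the anchors p, q and r can be subdivided next, starting with
-- the oldest one; the marks certify that these three edges are always disjoint.
record Growable {W : Set} {S : Rel W 0ℓ} {m : ℕ} (P : Packed (Pointwise (Adj (C m)) S)) : Set where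
  open Packed P using (place)
  private
    Arc : Fin 3 → Rel (Fin m ⊎ W) 0ℓ
    Arc i = CopyEdge (Pointwise (Adj (C m)) NoEdge) (place i)
  field
    w      : Fin 3 → Fin m ⊎ W
    p      : Fin m ⊎ W
    q      : Fin 2 → Fin m ⊎ W
    r      : Fin 3 → Fin m ⊎ W
    arc-p  : Arc 0F (w 2F) p
    arc-q  : ∀ j → Arc 1F (w (suc j)) (q j)
    arc-r  : ∀ j → Arc 2F (w j) (r j)
    mark   : Fin m ⊎ W → ℕ
    mark-w : ∀ j → mark (w j) ≡ toℕ j
    mark-p : mark p ≡ 3
    mark-q : ∀ j → mark (q j) ≡ 4
    mark-r : ∀ j → mark (r j) ≡ 5

module Growth {W : Set} {S : Rel W 0ℓ} (_≟_ : DecidableEquality W) (irreflS : Nonloop S) (symS : Symmetric S) where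

  module Step {k : ℕ} {P : Packed (Pointwise (Adj (C (3 ℕ.+ k))) S)} (g : Growable P) where
    open Growable g
    open Packed P using (place)
    open Insertion {W = W} {S = S} {k = k} irreflS symS using (Cyc)

    private
      a b : Fin 3 → Fin (3 ℕ.+ k) ⊎ W
      a = w ∘ opposite
      b 0F = p
      b 1F = q 0F
      b 2F = r 0F

      mark-a : ∀ i → mark (a i) ≡ toℕ (opposite i)
      mark-a i = mark-w (opposite i)

      mark-b : ∀ i → mark (b i) ≡ 3 ℕ.+ toℕ i
      mark-b 0F = mark-p
      mark-b 1F = mark-q 0F
      mark-b 2F = mark-r 0F

      edges : ∀ i → CopyEdge Cyc (place i) (a i) (b i)
      edges 0F = arc-p
      edges 1F = arc-q 0F
      edges 2F = arc-r 0F

      clash : ∀ {x y c d} → mark x ≡ c → mark y ≡ d → x ≡ y → c ≡ d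
      clash refl refl refl = refl

      a≢a : ∀ {i j} → i ≢ j → a i ≢ a j
      a≢a {i} {j} i≢j e = i≢j (trans (sym (opposite-involutive i)) (trans (cong opposite
        (toℕ-injective (clash (mark-a i) (mark-a j) e))) (opposite-involutive j)))

      b≢b : ∀ {i j} → i ≢ j → b i ≢ b j
      b≢b {i} {j} i≢j e =
        i≢j (toℕ-injective (ℕ.+-cancelˡ-≡ 3 _ _ (clash (mark-b i) (mark-b j) e)))

      a≢b : ∀ {i j} → i ≢ j → a i ≢ b j
      a≢b {i} {j} _ e = ℕ.m+n≮m 3 (toℕ j)
        (subst (ℕ._< 3) (clash (mark-a i) (mark-b j) e) (toℕ<n (opposite i)))

    open Insertion.Inserted {W = W} {S = S} {k = k} irreflS symS P a b edges a≢a b≢b a≢b public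

    private
      old : Fin (3 ℕ.+ k) ⊎ W → Fin (4 ℕ.+ k) ⊎ W
      old = toNew ∘ just

      new : Fin (4 ℕ.+ k) ⊎ W
      new = toNew nothing

      -- The oldest vertex retires to 6, the mark of the bystanders; the marks 3, 4 and 5 of the
      -- anchors never change. The new vertex enters with mark 2.
      age : ℕ → ℕ
      age 0 = 6
      age 1 = 0
      age 2 = 1
      age n = n

      w⁺ r⁺ : Fin 3 → Fin (4 ℕ.+ k) ⊎ W
      w⁺ 0F = old (w 1F)
      w⁺ 1F = old (w 2F)
      w⁺ 2F = new
      r⁺ 0F = old (r 1F)
      r⁺ 1F = old (r 2F)
      r⁺ 2F = old (r 0F)

      q⁺ : Fin 2 → Fin (4 ℕ.+ k) ⊎ W
      q⁺ 0F = old (q 1F)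
      q⁺ 1F = old (q 0F)

      mark⁺ : Fin (4 ℕ.+ k) ⊎ W → ℕ
      mark⁺ = maybe (age ∘ mark) 2 ∘ fromNew

      mark-old : ∀ x → mark⁺ (old x) ≡ age (mark x)
      mark-old x = cong (maybe (age ∘ mark) 2) (fromNew-toNew (just x))

    -- The queue moves on by one. The new vertex lies on the edges to `p`, `q 0F` and `r 0F` that it
    -- has subdivided, so it takes over these anchors; the anchors of the copies `1F` and `2F` thus
    -- rotate with periods 2 and 3.
    growable⁺ : Growable packed⁺
    growable⁺ = record
      { w      = w⁺
      ; p      = old p
      ; q      = q⁺
      ; r      = r⁺
      ; arc-p  = cyc-complete 0F (new-left (inj₂ refl))
      ; arc-q  = λ
        { 0F → cyc-complete 1F (kept (arc-q 1F) λ
            { (inj₁ (e , _)) → contradiction (clash (mark-w 2F) (mark-w 1F) e) λ ()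
            ; (inj₂ (e , _)) → contradiction (clash (mark-w 2F) (mark-q 0F) e) λ () })
        ; 1F → cyc-complete 1F (new-left (inj₂ refl)) }
      ; arc-r  = λ
        { 0F → cyc-complete 2F (kept (arc-r 1F) λ
            { (inj₁ (e , _)) → contradiction (clash (mark-w 1F) (mark-w 0F) e) λ ()
            ; (inj₂ (e , _)) → contradiction (clash (mark-w 1F) (mark-r 0F) e) λ () })
        ; 1F → cyc-complete 2F (kept (arc-r 2F) λ
            { (inj₁ (e , _)) → contradiction (clash (mark-w 2F) (mark-w 0F) e) λ ()
            ; (inj₂ (e , _)) → contradiction (clash (mark-w 2F) (mark-r 0F) e) λ () })
        ; 2F → cyc-complete 2F (new-left (inj₂ refl)) }
      ; mark   = mark⁺
      ; mark-w = λ
        { 0F → trans (mark-old (w 1F)) (cong age (mark-w 1F))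
        ; 1F → trans (mark-old (w 2F)) (cong age (mark-w 2F))
        ; 2F → refl }
      ; mark-p = trans (mark-old p) (cong age mark-p)
      ; mark-q = λ
        { 0F → trans (mark-old (q 1F)) (cong age (mark-q 1F))
        ; 1F → trans (mark-old (q 0F)) (cong age (mark-q 0F)) }
      ; mark-r = λ
        { 0F → trans (mark-old (r 1F)) (cong age (mark-r 1F))
        ; 1F → trans (mark-old (r 2F)) (cong age (mark-r 2F))
        ; 2F → trans (mark-old (r 0F)) (cong age (mark-r 0F)) } }

    -- A clique among the vertices of mark at least 3 contains no subdivided edge.
    clique⁺ : ((c , _) : Clique 5 (Total P)) → (∀ i → 3 ≤ mark (c i)) →
              ∃ λ ((c⁺ , _) : Clique 5 (Total packed⁺)) → ∀ i → 3 ≤ mark⁺ (c⁺ i)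
    clique⁺ (c , adjacent) high = (old ∘ c , λ i≢j → keep (high _) (high _) (adjacent i≢j)) ,
      λ i → subst (3 ≤_) (sym (mark-old (c i))) (old-high (high i))
      where
      old-high : ∀ {n} → 3 ≤ n → 3 ≤ age n
      old-high 3≤n@(s≤s (s≤s (s≤s _))) = 3≤n
      low : ∀ i {x} → 3 ≤ mark x → x ≢ a i
      low i high refl = ℕ.≤⇒≯ high (subst (ℕ._< 3) (sym (mark-a i)) (toℕ<n (opposite i)))
      keep : ∀ {x y} → 3 ≤ mark x → 3 ≤ mark y → Total P x y → Total packed⁺ (old x) (old y)
      keep hx hy (i , e) = i , layer-complete i
        (kept e λ { (inj₁ (x≡a , _)) → low i hx x≡a ; (inj₂ (_ , y≡a)) → low i hy y≡a })

  private
    CS : ∀ k → Rel (Fin (3 ℕ.+ k) ⊎ W) 0ℓ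
    CS k = Pointwise (Adj (C (3 ℕ.+ k))) S

  GrowableRobustFree : ℕ → Set
  GrowableRobustFree k = ∃ λ (P : Packed (CS k)) → Growable P × Connected (LowerTotal P) × ¬ Clique 5 (Total P)

  GrowableClique : ℕ → Set
  GrowableClique k = ∃ λ (P : Packed (CS k)) → ∃ λ (g : Growable P) →
    ∃ λ ((c , _) : Clique 5 (Total P)) → ∀ i → 3 ≤ Growable.mark g (c i)

  grow-free : ∀ {k} → GrowableRobustFree k → GrowableRobustFree (suc k)
  grow-free (P , g , conn , free) =
    packed⁺ , growable⁺ , LowerTotal⁺-connected decU conn , Clique-old free
    where
    open Step g
    decU = ≡-dec _≟ᶠ_ _≟_

  grow-clique : ∀ {k} → GrowableClique k → GrowableClique (suc k)
  grow-clique (P , g , c , high) = packed⁺ , growable⁺ , clique⁺ c high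
    where open Step g

  grow : ∀ {k} → GrowableRobustFree k → GrowableClique k → ∀ j →
         HasRobust (CS (j ℕ.+ k)) × TwoTotals (CS (j ℕ.+ k))
  grow f c zero    = (proj₁ f , proj₁ (proj₂ (proj₂ f))) ,
    (proj₁ f , proj₁ c , λ φ → proj₂ (proj₂ (proj₂ f)) (Clique-≃ (≃-sym φ) (proj₁ (proj₂ (proj₂ c)))))
  grow {k} f c (suc j) = shift (grow (grow-free f) (grow-clique c) j)
    where
    shift : HasRobust (CS (j ℕ.+ suc k)) × TwoTotals (CS (j ℕ.+ suc k)) →
            HasRobust (CS (suc j ℕ.+ k)) × TwoTotals (CS (suc j ℕ.+ k))
    shift = subst (λ n → HasRobust (CS n) × TwoTotals (CS n)) (ℕ.+-suc j k)

-- Packings given by explicit lists, with decidable certificates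

vertexAt : ∀ ns → Fin (sum ns) → Vertex ns
vertexAt (n ∷ ns) = Sum.map₂ (vertexAt ns) ∘ splitAt n

position : ∀ ns → Vertex ns → Fin (sum ns)
position (n ∷ ns) = join n (sum ns) ∘ Sum.map₂ (position ns)

vertexAt-position : ∀ ns v → vertexAt ns (position ns v) ≡ v
vertexAt-position (n ∷ ns) (inj₁ i) = cong (Sum.map₂ (vertexAt ns)) (splitAt-join n (sum ns) (inj₁ i))
vertexAt-position (n ∷ ns) (inj₂ v) = trans
  (cong (Sum.map₂ (vertexAt ns)) (splitAt-join n (sum ns) (inj₂ (position ns v))))
  (cong inj₂ (vertexAt-position ns v))

position-vertexAt : ∀ ns i → position ns (vertexAt ns i) ≡ i
position-vertexAt (n ∷ ns) i = trans (cong (join n (sum ns)) (unmap (splitAt n i))) (join-splitAt n (sum ns) i)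
  where
  unmap : ∀ s → Sum.map₂ (position ns) (Sum.map₂ (vertexAt ns) s) ≡ s
  unmap (inj₁ _) = refl
  unmap (inj₂ j) = cong inj₂ (position-vertexAt ns j)

vertexAt-injective : ∀ ns {i j} → vertexAt ns i ≡ vertexAt ns j → i ≡ j
vertexAt-injective ns {i} {j} e =
  trans (sym (position-vertexAt ns i)) (trans (cong (position ns) e) (position-vertexAt ns j))

Colourable : {U : Set} → ℕ → Rel U 0ℓ → Set
Colourable k T = ∃ λ (c : _ → Fin k) → ∀ {x y} → T x y → c x ≢ c y

Colourable-≃ : ∀ {U W} {R : Rel U 0ℓ} {S : Rel W 0ℓ} {k} → R ≃ S → Colourable k S → Colourable k R
Colourable-≃ φ (c , proper) = c ∘ _≃_.to φ , λ e → proper (_≃_.to-edge φ e)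

colourable⇒¬clique : ∀ {U} {T : Rel U 0ℓ} {k} → Colourable k T → ¬ Clique (suc k) T
colourable⇒¬clique (c , proper) (q , adjacent) with pigeonhole (ℕ.n<1+n _) (c ∘ q)
... | i , j , i<j , eq = proper (adjacent (<⇒≢ i<j)) eq

-- With edge lists, disjointness and proper colouring are checked by running through the edges
-- instead of all pairs of vertices.
Arcs : Set → Set
Arcs A = List (A × A)

module _ {A : Set} where

  path : ∀ {n} → A → Vec A n → A → Arcs A
  path a []       z = (a , z) ∷ []
  path a (b ∷ bs) z = (a , b) ∷ path b bs z

  cycle : ∀ {n} → Vec A n → Arcs A
  cycle []       = []
  cycle (a ∷ as) = path a as a

  cycles : ∀ {ns} → Allᴸ (Vec A) ns → Arcs A
  cycles []       = []
  cycles (c ∷ cs) = cycle c ++ cycles cs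

  label : ∀ {ns} → Allᴸ (Vec A) ns → Vertex ns → A
  label (c ∷ cs) (inj₁ i) = lookup c i
  label (c ∷ cs) (inj₂ v) = label cs v

  label-head : ∀ {n ns} (cs : Allᴸ (Vec A) (n ∷ ns)) i → label cs (inj₁ i) ≡ lookup (All.head cs) i
  label-head (c ∷ cs) i = refl

  path-step : ∀ {n} a (as : Vec A n) z {i j} → toℕ j ≡ suc (toℕ i) →
              (lookup (a ∷ as) i , lookup (a ∷ as) j) ∈ path a as z
  path-step a (b ∷ bs) z {zero}  {suc zero} refl = here refl
  path-step a (b ∷ bs) z {suc i} {suc j}    e    = there (path-step b bs z (ℕ.suc-injective e))

  path-end : ∀ {n} a (as : Vec A n) z → (lookup (a ∷ as) (fromℕ n) , z) ∈ path a as z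
  path-end a []       z = here refl
  path-end a (b ∷ bs) z = there (path-end b bs z)

  Next⇒cycle : ∀ {n} (c : Vec A n) {i j} → Next i j → (lookup c i , lookup c j) ∈ cycle c
  Next⇒cycle (a ∷ as) (inj₁ e) = path-step a as a e
  Next⇒cycle (a ∷ as) {i} {zero} e@(inj₂ _) =
    subst (λ i → (lookup (a ∷ as) i , a) ∈ path a as a) (sym (Next⇒prev {i = i} e)) (path-end a as a)

  path⇒step : ∀ {n} a (as : Vec A n) z {x y} → (x , y) ∈ path a as z →
    (∃₂ λ i j → lookup (a ∷ as) i ≡ x × lookup (a ∷ as) j ≡ y × toℕ j ≡ suc (toℕ i)) ⊎
    (lookup (a ∷ as) (fromℕ n) ≡ x × z ≡ y)
  path⇒step a []       z (here refl) = inj₂ (refl , refl)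
  path⇒step a (b ∷ bs) z (here refl) = inj₁ (zero , suc zero , refl , refl , refl)
  path⇒step a (b ∷ bs) z (there e)   =
    Sum.map₁ (λ (i , j , p , q , s) → suc i , suc j , p , q , cong suc s) (path⇒step b bs z e)

  cycle⇒Next : ∀ {n} (c : Vec A n) {x y} → (x , y) ∈ cycle c →
    ∃₂ λ i j → lookup c i ≡ x × lookup c j ≡ y × Next i j
  cycle⇒Next (a ∷ as) e with path⇒step a as a e
  ... | inj₁ (i , j , p , q , s) = i , j , p , q , inj₁ s
  ... | inj₂ (p , refl)          = fromℕ _ , zero , p , refl , prev⇒Next zero

  Joined : Arcs A → Rel A 0ℓ
  Joined E x y = (x , y) ∈ E ⊎ (y , x) ∈ E

  Joined-mono : ∀ {E F : Arcs A} → (∀ {e} → e ∈ E → e ∈ F) → ∀ {x y} → Joined E x y → Joined F x y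
  Joined-mono E⊆F = Sum.map E⊆F E⊆F

  Edge⇒Joined : ∀ {ns} (cs : Allᴸ (Vec A) ns) {u v} → Edge ns u v → Joined (cycles cs) (label cs u) (label cs v)
  Edge⇒Joined (c ∷ cs) (inj₁ (_ , e)) =
    Joined-mono ∈-++⁺ˡ (Sum.map (Next⇒cycle c) (Next⇒cycle c) e)
  Edge⇒Joined (c ∷ cs) (inj₂ e)       = Joined-mono (∈-++⁺ʳ (cycle c)) (Edge⇒Joined cs e)

  Joined⇒Adj : ∀ {n} (c : Vec A n) {x y} → x ≢ y → Joined (cycle c) x y → CopyEdge (Adj (C n)) (lookup c) x y
  Joined⇒Adj c x≢y (inj₁ e) with cycle⇒Next c e
  ... | i , j , refl , refl , s = i , j , refl , refl , x≢y ∘ cong (lookup c) , inj₁ s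
  Joined⇒Adj c x≢y (inj₂ e) with cycle⇒Next c e
  ... | i , j , refl , refl , s = j , i , refl , refl , x≢y ∘ cong (lookup c) , inj₂ s

  Joined⇒Edge : ∀ {ns} (cs : Allᴸ (Vec A) ns) {x y} → x ≢ y → Joined (cycles cs) x y → CopyEdge (Edge ns) (label cs) x y
  Joined⇒Edge []       x≢y (inj₁ ())
  Joined⇒Edge []       x≢y (inj₂ ())
  Joined⇒Edge (c ∷ cs) x≢y e with split e
    where
    split : ∀ {x y} → Joined (cycle c ++ cycles cs) x y → Joined (cycle c) x y ⊎ Joined (cycles cs) x y
    split (inj₁ e) = Sum.map inj₁ inj₁ (∈-++⁻ (cycle c) e)
    split (inj₂ e) = Sum.map inj₂ inj₂ (∈-++⁻ (cycle c) e)
  ... | inj₁ e = let u , v , p , q , r = Joined⇒Adj c x≢y e in inj₁ u , inj₁ v , p , q , inj₁ r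
  ... | inj₂ e = let u , v , p , q , r = Joined⇒Edge cs x≢y e in inj₂ u , inj₂ v , p , q , inj₂ r

-- A layout lists, for each of the three copies, the vertices along its cycles;
-- the vertices are numbered as in the standard copy.
Layout : List ℕ → Set
Layout ns = Fin 3 → Allᴸ (Vec (Fin (sum ns))) ns

module Laid {ns : List ℕ} (c : Layout ns) where

  private
    N = sum ns

  arcs : Fin 3 → Arcs (Fin N)
  arcs i = cycles (c i)

  joined? : (E : Arcs (Fin N)) → ∀ x y → Dec (Joined E x y)
  joined? E x y = (_ ∈? E) ⊎-dec (_ ∈? E)
    where open import Data.List.Membership.DecPropositional (×-≡-dec (_≟ᶠ_ {N}) _≟ᶠ_) using (_∈?_)

  Valid : Set
  Valid = (∀ i x y → label (c i) (vertexAt ns x) ≡ label (c i) (vertexAt ns y) → x ≡ y) ×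
          (∀ i j → i ≡ j ⊎ Allᴸ (λ (x , y) → ¬ Joined (arcs j) x y) (arcs i))

  valid? : Dec Valid
  valid? =
    (all? λ i → all? λ x → all? λ y →
      (label (c i) (vertexAt ns x) ≟ᶠ label (c i) (vertexAt ns y)) →-dec (x ≟ᶠ y)) ×-dec
    (all? λ i → all? λ j → (i ≟ᶠ j) ⊎-dec All.all? (λ (x , y) → ¬? (joined? (arcs j) x y)) (arcs i))

  module _ (valid : Valid) where

    packed : Packed (Edge ns)
    packed = record
      { place     = λ i → vertexAt ns ∘ label (c i)
      ; injective = λ i {u} {v} e → trans (sym (vertexAt-position ns u)) (trans
          (cong (vertexAt ns) (proj₁ valid i _ _
            (trans (cong (label (c i)) (vertexAt-position ns u))
              (trans (vertexAt-injective ns e) (cong (label (c i)) (sym (vertexAt-position ns v)))))))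
          (vertexAt-position ns v))
      ; apart     = λ {i} {j} i≢j {u} {v} e e′ p q → clash i≢j (Edge⇒Joined (c i) e)
          (subst₂ (Joined (arcs j)) (sym (vertexAt-injective ns p)) (sym (vertexAt-injective ns q)) (Edge⇒Joined (c j) e′)) }
      where
      clash : ∀ {i j} → i ≢ j → ∀ {x y} → Joined (arcs i) x y → Joined (arcs j) x y → ⊥
      clash {i} {j} i≢j e e′ with proj₂ valid i j
      ... | inj₁ i≡j = i≢j i≡j
      ... | inj₂ ds with e
      ...   | inj₁ e = All.lookup ds e e′
      ...   | inj₂ e = All.lookup ds e (Sum.swap e′)

    private module P = Packed packed

    layer⇒joined : ∀ {i x y} → P.Layer i x y → Joined (arcs i) (position ns x) (position ns y)
    layer⇒joined {i} (u , v , refl , refl , e) =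
      subst₂ (Joined (arcs i)) (sym (position-vertexAt ns _)) (sym (position-vertexAt ns _)) (Edge⇒Joined (c i) e)

    joined⇒layer : ∀ {i x y} → x ≢ y → Joined (arcs i) x y → P.Layer i (vertexAt ns x) (vertexAt ns y)
    joined⇒layer {i} x≢y e with Joined⇒Edge (c i) x≢y e
    ... | u , v , p , q , r = u , v , cong (vertexAt ns) p , cong (vertexAt ns) q , r

  lowerArcs totalArcs : Arcs (Fin N)
  lowerArcs = arcs 0F ++ arcs 1F
  totalArcs = arcs 0F ++ arcs 1F ++ arcs 2F

  Descends : Fin N → Set
  Descends x = toℕ x ≡ 0 ⊎ Any (λ (y , z) → (z ≡ x × y Fin.< x) ⊎ (y ≡ x × z Fin.< x)) lowerArcs

  descends? : ∀ x → Dec (Descends x)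
  descends? x = (toℕ x ℕ.≟ 0) ⊎-dec
    Any.any? (λ (y , z) → ((z ≟ᶠ x) ×-dec (y Fin.<? x)) ⊎-dec ((y ≟ᶠ x) ×-dec (z Fin.<? x))) lowerArcs

  -- Every vertex but the first has a smaller neighbour, so all are connected to the first.
  lower-connected : (valid : Valid) → (∀ x → Descends x) → Connected (LowerTotal (packed valid))
  lower-connected valid descends f const x y =
    subst₂ (λ x y → f x ≡ f y) (vertexAt-position ns x) (vertexAt-position ns y)
      (toFirst (position ns x) (position ns y))
    where
    step : ∀ {i x y} → i ≢ 2F → x ≢ y → Joined (arcs i) x y → f (vertexAt ns x) ≡ f (vertexAt ns y)
    step i≢2 x≢y e = const (_ , i≢2 , joined⇒layer valid x≢y e)
    layerStep : ∀ {x y} → x ≢ y → Joined lowerArcs x y → f (vertexAt ns x) ≡ f (vertexAt ns y)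
    layerStep x≢y (inj₁ e) with ∈-++⁻ (arcs 0F) e
    ... | inj₁ e₀ = step {0F} (λ ()) x≢y (inj₁ e₀)
    ... | inj₂ e₁ = step {1F} (λ ()) x≢y (inj₁ e₁)
    layerStep x≢y (inj₂ e) = sym (layerStep (x≢y ∘ sym) (inj₁ e))
    toZero : ∀ {x} → Acc Fin._<_ x → ∀ z → toℕ z ≡ 0 → f (vertexAt ns x) ≡ f (vertexAt ns z)
    toZero {x} (acc rec) z z≡0 with descends x
    ... | inj₁ x≡0 = cong (f ∘ vertexAt ns) (toℕ-injective (trans x≡0 (sym z≡0)))
    ... | inj₂ d with find d
    ...   | (y , _) , e , inj₁ (refl , y<x) = trans (layerStep (<⇒≢ y<x ∘ sym) (inj₂ e)) (toZero (rec y<x) z z≡0)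
    ...   | (_ , y) , e , inj₂ (refl , y<x) = trans (layerStep (<⇒≢ y<x ∘ sym) (inj₁ e)) (toZero (rec y<x) z z≡0)
    -- The order `sum ns` is not known to be positive, so the first vertex has to be obtained from a
    -- given one.
    least : ∀ {n} → Fin n → Fin n
    least zero    = zero
    least (suc _) = zero
    least≡0 : ∀ {n} (i : Fin n) → toℕ (least i) ≡ 0
    least≡0 zero    = refl
    least≡0 (suc _) = refl
    toFirst : ∀ x y → f (vertexAt ns x) ≡ f (vertexAt ns y)
    toFirst x y = trans (toZero (<ᶠ-wellFounded x) (least x) (least≡0 x))
      (sym (toZero (<ᶠ-wellFounded y) (least x) (least≡0 x)))

  total⇒joined : (valid : Valid) → ∀ {x y} → Total (packed valid) x y →
                 Joined totalArcs (position ns x) (position ns y)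
  total⇒joined valid (0F , e) = Joined-mono ∈-++⁺ˡ (layer⇒joined valid e)
  total⇒joined valid (1F , e) = Joined-mono (∈-++⁺ʳ (arcs 0F) ∘ ∈-++⁺ˡ) (layer⇒joined valid e)
  total⇒joined valid (2F , e) = Joined-mono (∈-++⁺ʳ (arcs 0F) ∘ ∈-++⁺ʳ (arcs 1F)) (layer⇒joined valid e)

  joined⇒total : (valid : Valid) → ∀ {x y} → x ≢ y → Joined totalArcs x y →
                 Total (packed valid) (vertexAt ns x) (vertexAt ns y)
  joined⇒total valid x≢y (inj₁ e) with ∈-++⁻ (arcs 0F) e
  ... | inj₁ e₀ = 0F , joined⇒layer valid x≢y (inj₁ e₀)
  ... | inj₂ e′ with ∈-++⁻ (arcs 1F) e′
  ...   | inj₁ e₁ = 1F , joined⇒layer valid x≢y (inj₁ e₁)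
  ...   | inj₂ e₂ = 2F , joined⇒layer valid x≢y (inj₁ e₂)
  joined⇒total valid x≢y (inj₂ e) with ∈-++⁻ (arcs 0F) e
  ... | inj₁ e₀ = 0F , joined⇒layer valid x≢y (inj₂ e₀)
  ... | inj₂ e′ with ∈-++⁻ (arcs 1F) e′
  ...   | inj₁ e₁ = 1F , joined⇒layer valid x≢y (inj₂ e₁)
  ...   | inj₂ e₂ = 2F , joined⇒layer valid x≢y (inj₂ e₂)

  module _ {k : ℕ} where

    ProperColours : Vec (Fin k) N → Set
    ProperColours cs = Allᴸ (λ (x , y) → lookup cs x ≢ lookup cs y) totalArcs

    properColours? : ∀ cs → Dec (ProperColours cs)
    properColours? cs = All.all? (λ (x , y) → ¬? (lookup cs x ≟ᶠ lookup cs y)) totalArcs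

    colourable : (valid : Valid) → ∀ {cs} → ProperColours cs → Colourable k (Total (packed valid))
    colourable valid {cs} proper = lookup cs ∘ position ns , λ e eq → case total⇒joined valid e of λ
      { (inj₁ e) → All.lookup proper e eq
      ; (inj₂ e) → All.lookup proper e (sym eq) }

    -- No proper colouring extends the given partial one to the listed vertices.
    Uncolourable : List (Fin N × Fin k) → List (Fin N) → Set
    Uncolourable done []       = ⊥
    Uncolourable done (x ∷ xs) = ∀ c →
      Any (λ (y , d) → d ≡ c × x ≢ y × Joined totalArcs x y) done ⊎ Uncolourable ((x , c) ∷ done) xs

    uncolourable? : ∀ done xs → Dec (Uncolourable done xs)
    uncolourable? done []       = no id
    uncolourable? done (x ∷ xs) = all? λ c →
      Any.any? (λ (y , d) → (d ≟ᶠ c) ×-dec ¬? (x ≟ᶠ y) ×-dec joined? totalArcs x y) done ⊎-dec uncolourable? ((x , c) ∷ done) xs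

    -- A proper colouring would select one branch of the exhausted search, namely its own colour at
    -- each listed vertex, and this branch ends at an edge whose ends have equal colours.
    refute : (valid : Valid) → ∀ {xs} → Uncolourable [] xs → ¬ Colourable k (Total (packed valid))
    refute valid {xs} u (f , proper) = go [] xs [] u
      where
      go : ∀ done xs → Allᴸ (λ (y , d) → f (vertexAt ns y) ≡ d) done → ¬ Uncolourable done xs
      go done (x ∷ xs) agree u with u (f (vertexAt ns x))
      ... | inj₂ u′ = go _ xs (refl ∷ agree) u′
      ... | inj₁ c with find c
      ...   | (y , d) , y∈ , refl , x≢y , e = proper (joined⇒total valid x≢y e) (sym (All.lookup agree y∈))

  Pairwise : Vec (Fin N) 5 → Set
  Pairwise q = ∀ i j → i ≡ j ⊎ lookup q i ≢ lookup q j × Joined totalArcs (lookup q i) (lookup q j)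

  pairwise? : ∀ q → Dec (Pairwise q)
  pairwise? q = all? λ i → all? λ j →
    (i ≟ᶠ j) ⊎-dec (¬? (lookup q i ≟ᶠ lookup q j) ×-dec joined? totalArcs (lookup q i) (lookup q j))

  clique : (valid : Valid) → ∀ {q} → Pairwise q → Clique 5 (Total (packed valid))
  clique valid {q} adjacent = vertexAt ns ∘ lookup q , λ {i} {j} i≢j → case adjacent i j of λ
    { (inj₁ i≡j)       → contradiction i≡j i≢j
    ; (inj₂ (x≢y , e)) → joined⇒total valid x≢y e }

module Head {m : ℕ} {ns : List ℕ} (c : Layout (m ∷ ns))
            (w : Vec (Fin (m ℕ.+ sum ns)) 3) (p : Fin (m ℕ.+ sum ns))
            (q : Vec (Fin (m ℕ.+ sum ns)) 2) (r : Vec (Fin (m ℕ.+ sum ns)) 3) where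

  open Laid c

  private
    N = m ℕ.+ sum ns

  Arc : Fin 3 → Rel (Fin N) 0ℓ
  Arc i x y = x ≢ y × Joined (cycle (All.head (c i))) x y

  arc? : ∀ i x y → Dec (Arc i x y)
  arc? i x y = ¬? (x ≟ᶠ y) ×-dec joined? (cycle (All.head (c i))) x y

  -- A vertex with two roles gets the mark of the first one that applies, so the equations in
  -- `Growing` fail when roles with different marks collide. Anchors of the same copy share a mark
  -- and may coincide: only one of their edges is subdivided at a time.
  mark : Fin N → ℕ
  mark x =
    if does (x ≟ᶠ lookup w 0F) then 0 else
    if does (x ≟ᶠ lookup w 1F) then 1 else
    if does (x ≟ᶠ lookup w 2F) then 2 else
    if does (x ≟ᶠ p) then 3 else
    if does (x ≟ᶠ lookup q 0F) ∨ does (x ≟ᶠ lookup q 1F) then 4 else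
    if does (any? λ j → x ≟ᶠ lookup r j) then 5 else 6

  mark-at : ∀ x → mark (position (m ∷ ns) (vertexAt (m ∷ ns) x)) ≡ mark x
  mark-at x = cong mark (position-vertexAt (m ∷ ns) x)

  Growing : Set
  Growing = Arc 0F (lookup w 2F) p ×
            (∀ j → Arc 1F (lookup w (suc j)) (lookup q j)) ×
            (∀ j → Arc 2F (lookup w j) (lookup r j)) ×
            (∀ j → mark (lookup w j) ≡ toℕ j) × mark p ≡ 3 ×
            (∀ j → mark (lookup q j) ≡ 4) × (∀ j → mark (lookup r j) ≡ 5)

  growing? : Dec Growing
  growing? = arc? _ _ _ ×-dec (all? λ _ → arc? _ _ _) ×-dec (all? λ _ → arc? _ _ _) ×-dec
    (all? λ _ → _ ℕ.≟ _) ×-dec (_ ℕ.≟ _) ×-dec (all? λ _ → _ ℕ.≟ _) ×-dec (all? λ _ → _ ℕ.≟ _)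

  growable : (valid : Valid) → Growing → Growable (packed valid)
  growable valid (arc-p , arc-q , arc-r , mark-w , mark-p , mark-q , mark-r) = record
    { w      = at ∘ lookup w
    ; p      = at p
    ; q      = at ∘ lookup q
    ; r      = at ∘ lookup r
    ; arc-p  = arc arc-p
    ; arc-q  = arc ∘ arc-q
    ; arc-r  = arc ∘ arc-r
    ; mark   = mark ∘ position (m ∷ ns)
    ; mark-w = λ j → trans (mark-at (lookup w j)) (mark-w j)
    ; mark-p = trans (mark-at p) mark-p
    ; mark-q = λ j → trans (mark-at (lookup q j)) (mark-q j)
    ; mark-r = λ j → trans (mark-at (lookup r j)) (mark-r j) }
    where
    at = vertexAt (m ∷ ns)
    arc : ∀ {i x y} → Arc i x y →
      CopyEdge (Pointwise (Adj (C m)) NoEdge) (Packed.place (packed valid) i) (at x) (at y)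
    arc {i} (x≢y , e) with Joined⇒Adj (All.head (c i)) x≢y e
    ... | u , v , p , q , a = inj₁ u , inj₁ v ,
      cong at (trans (label-head (c i) u) p) , cong at (trans (label-head (c i) v) q) , inj₁ a

_≟ⱽ_ : ∀ {ns} → DecidableEquality (Vertex ns)
_≟ⱽ_ {n ∷ ns} = ≡-dec _≟ᶠ_ _≟ⱽ_

Edge-irrefl : ∀ ns → Nonloop (Edge ns)
Edge-irrefl (n ∷ ns) (inj₁ (i≢i , _)) = i≢i refl
Edge-irrefl (n ∷ ns) (inj₂ e)         = Edge-irrefl ns e

Edge-sym : ∀ ns → Symmetric (Edge ns)
Edge-sym (n ∷ ns) (inj₁ (i≢j , e)) = inj₁ (i≢j ∘ sym , Sum.swap e)
Edge-sym (n ∷ ns) (inj₂ e)         = inj₂ (Edge-sym ns e)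

numbering : ∀ {A : Set} ns → (Fin (sum ns) → A) → Allᴸ (Vec A) ns
numbering []       f = []
numbering (n ∷ ns) f = Vec.tabulate (f ∘ (Fin._↑ˡ sum ns)) ∷ numbering ns (f ∘ (n Fin.↑ʳ_))

Cycles : List ℕ → Set
Cycles = Allᴸ (Vec ℕ)

layout : ∀ {ns} .{{_ : ℕ.NonZero (sum ns)}} → Cycles ns → Cycles ns → Layout ns
layout {ns} c₁ c₂ 0F = numbering ns id
layout {ns} c₁ c₂ 1F = All.map (Vec.map (_mod sum ns)) c₁
layout {ns} c₁ c₂ 2F = All.map (Vec.map (_mod sum ns)) c₂

Robust : List ℕ → Set
Robust ns = HasRobust (Edge ns)

RobustTwo : List ℕ → Set
RobustTwo ns = Robust ns × TwoTotals (Edge ns)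

module _ ns .{{_ : ℕ.NonZero (sum ns)}} (c₁ c₂ : Cycles ns) where

  open Laid (layout c₁ c₂)

  robust : {v : True valid?} {d : True (all? descends?)} → Robust ns
  robust {v} {d} = packed (toWitness v) , lower-connected (toWitness v) (toWitness d)

  module _ k (cs : Vec (Fin k) (sum ns)) (d₁ d₂ : Cycles ns) (xs : List ℕ) where

    private module L = Laid (layout d₁ d₂)

    robustTwo : {v : True valid?} {d : True (all? descends?)} {p : True (properColours? cs)}
                {v′ : True L.valid?} {u : True (L.uncolourable? {k} [] (List.map (_mod sum ns) xs))} → RobustTwo ns
    robustTwo {v} {d} {p} {v′} {u} = robust {v} {d} ,
      packed (toWitness v) , L.packed (toWitness v′) , λ φ →
        L.refute (toWitness v′) (toWitness u) (Colourable-≃ (≃-sym φ) (colourable (toWitness v) {cs} (toWitness p)))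

module _ k ns (c₁ c₂ : Cycles (3 ℕ.+ k ∷ ns)) (cs : Vec (Fin 4) (sum (3 ℕ.+ k ∷ ns)))
         (cw : Vec ℕ 3) (cp : ℕ) (cq : Vec ℕ 2) (cr : Vec ℕ 3)
         (d₁ d₂ : Cycles (3 ℕ.+ k ∷ ns)) (xs : Vec ℕ 5)
         (dw : Vec ℕ 3) (dp : ℕ) (dq : Vec ℕ 2) (dr : Vec ℕ 3) where

  private
    N = sum (3 ℕ.+ k ∷ ns)
    number : ∀ {l} → Vec ℕ l → Vec (Fin N) l
    number = Vec.map (_mod N)
    module L = Laid (layout c₁ c₂)
    module M = Laid (layout d₁ d₂)
    module LH = Head (layout c₁ c₂) (number cw) (cp mod N) (number cq) (number cr)
    module MH = Head (layout d₁ d₂) (number dw) (dp mod N) (number dq) (number dr)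

  growingFamily : {v : True L.valid?} {d : True (all? L.descends?)} {p : True (L.properColours? cs)}
                  {g : True LH.growing?} {v′ : True M.valid?} {a : True (M.pairwise? (number xs))}
                  {g′ : True MH.growing?} {h : True (all? λ i → 3 ℕ.≤? MH.mark (lookup (number xs) i))} →
                  ∀ j → RobustTwo (3 ℕ.+ (j ℕ.+ k) ∷ ns)
  growingFamily {v} {d} {p} {g} {v′} {a} {g′} {h} =
    Growth.grow _≟ⱽ_ (λ {u} → Edge-irrefl ns {u}) (Edge-sym ns)
      (L.packed (toWitness v) , LH.growable (toWitness v) (toWitness g) ,
       L.lower-connected (toWitness v) (toWitness d) ,
       -- The 4-colouring only excludes a K₅ at the start. Growth preserves the absence of a K₅,
       -- whereas a proper colouring need not extend to the new vertex.
       colourable⇒¬clique (L.colourable (toWitness v) {cs} (toWitness p)))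
      (M.packed (toWitness v′) , MH.growable (toWitness v′) (toWitness g′) ,
       M.clique (toWitness v′) {number xs} (toWitness a) , λ i →
         subst (3 ℕ.≤_) (sym (MH.mark-at (lookup (number xs) i))) (toWitness h i))

-- Tables of packings and the starting points of the families

robustTable : List (∃ Robust)
robustTable =
  (_ , robust (7 ∷ [])
    ((0 ∷ 2 ∷ 4 ∷ 1 ∷ 6 ∷ 3 ∷ 5 ∷ []) ∷ [])
    ((3 ∷ 0 ∷ 4 ∷ 6 ∷ 2 ∷ 5 ∷ 1 ∷ []) ∷ [])) ∷
  (_ , robust (8 ∷ [])
    ((0 ∷ 3 ∷ 7 ∷ 2 ∷ 4 ∷ 6 ∷ 1 ∷ 5 ∷ []) ∷ [])
    ((4 ∷ 1 ∷ 7 ∷ 5 ∷ 3 ∷ 6 ∷ 2 ∷ 0 ∷ []) ∷ [])) ∷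
  (_ , robust (5 ∷ 3 ∷ [])
    ((3 ∷ 5 ∷ 2 ∷ 7 ∷ 0 ∷ []) ∷ (4 ∷ 6 ∷ 1 ∷ []) ∷ [])
    ((4 ∷ 7 ∷ 3 ∷ 1 ∷ 5 ∷ []) ∷ (2 ∷ 0 ∷ 6 ∷ []) ∷ [])) ∷
  (_ , robust (4 ∷ 4 ∷ [])
    ((4 ∷ 3 ∷ 6 ∷ 1 ∷ []) ∷ (0 ∷ 2 ∷ 5 ∷ 7 ∷ []) ∷ [])
    ((6 ∷ 0 ∷ 4 ∷ 2 ∷ []) ∷ (7 ∷ 3 ∷ 5 ∷ 1 ∷ []) ∷ [])) ∷
  (_ , robust (4 ∷ 3 ∷ [])
    ((6 ∷ 0 ∷ 5 ∷ 2 ∷ []) ∷ (1 ∷ 4 ∷ 3 ∷ []) ∷ [])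
    ((6 ∷ 3 ∷ 5 ∷ 1 ∷ []) ∷ (2 ∷ 4 ∷ 0 ∷ []) ∷ [])) ∷
  (_ , robust (3 ∷ 3 ∷ 3 ∷ [])
    ((6 ∷ 4 ∷ 2 ∷ []) ∷ (3 ∷ 1 ∷ 8 ∷ []) ∷ (0 ∷ 5 ∷ 7 ∷ []) ∷ [])
    ((1 ∷ 4 ∷ 7 ∷ []) ∷ (3 ∷ 6 ∷ 0 ∷ []) ∷ (5 ∷ 2 ∷ 8 ∷ []) ∷ [])) ∷
  []

-- Found by computer search.  After the shape: the second and third copies of a
-- packing, whose first copy is the standard one; k and a proper k-colouring of its
-- total; the second and third copies of another packing; vertices whose induced
-- subgraph in the other total is not k-colourable (mostly a clique).
robustTwoTable : List (∃ RobustTwo)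
robustTwoTable =
  (_ , robustTwo (9 ∷ [])
    ((6 ∷ 0 ∷ 2 ∷ 4 ∷ 8 ∷ 3 ∷ 7 ∷ 5 ∷ 1 ∷ []) ∷ [])
    ((3 ∷ 6 ∷ 4 ∷ 0 ∷ 7 ∷ 2 ∷ 5 ∷ 8 ∷ 1 ∷ []) ∷ [])
    3 (0F ∷ 2F ∷ 1F ∷ 0F ∷ 2F ∷ 0F ∷ 1F ∷ 2F ∷ 1F ∷ [])
    ((0 ∷ 3 ∷ 8 ∷ 1 ∷ 6 ∷ 2 ∷ 4 ∷ 7 ∷ 5 ∷ []) ∷ [])
    ((6 ∷ 8 ∷ 4 ∷ 1 ∷ 3 ∷ 5 ∷ 2 ∷ 7 ∷ 0 ∷ []) ∷ [])
    (0 ∷ 1 ∷ 3 ∷ 8 ∷ [])) ∷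
  (_ , robustTwo (6 ∷ 6 ∷ [])
    ((4 ∷ 11 ∷ 1 ∷ 3 ∷ 10 ∷ 6 ∷ []) ∷ (8 ∷ 2 ∷ 9 ∷ 5 ∷ 7 ∷ 0 ∷ []) ∷ [])
    ((7 ∷ 9 ∷ 4 ∷ 8 ∷ 10 ∷ 1 ∷ []) ∷ (11 ∷ 5 ∷ 3 ∷ 6 ∷ 0 ∷ 2 ∷ []) ∷ [])
    3 (2F ∷ 0F ∷ 1F ∷ 2F ∷ 1F ∷ 0F ∷ 0F ∷ 1F ∷ 0F ∷ 2F ∷ 1F ∷ 2F ∷ [])
    ((0 ∷ 2 ∷ 7 ∷ 5 ∷ 1 ∷ 6 ∷ []) ∷ (3 ∷ 9 ∷ 11 ∷ 4 ∷ 8 ∷ 10 ∷ []) ∷ [])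
    ((10 ∷ 1 ∷ 11 ∷ 8 ∷ 0 ∷ 7 ∷ []) ∷ (3 ∷ 6 ∷ 4 ∷ 9 ∷ 2 ∷ 5 ∷ []) ∷ [])
    (4 ∷ 8 ∷ 9 ∷ 11 ∷ [])) ∷
  (_ , robustTwo (6 ∷ 5 ∷ [])
    ((8 ∷ 1 ∷ 6 ∷ 4 ∷ 9 ∷ 2 ∷ []) ∷ (5 ∷ 3 ∷ 7 ∷ 0 ∷ 10 ∷ []) ∷ [])
    ((6 ∷ 5 ∷ 8 ∷ 10 ∷ 7 ∷ 2 ∷ []) ∷ (0 ∷ 9 ∷ 3 ∷ 1 ∷ 4 ∷ []) ∷ [])
    3 (1F ∷ 2F ∷ 0F ∷ 1F ∷ 0F ∷ 2F ∷ 1F ∷ 2F ∷ 1F ∷ 2F ∷ 0F ∷ [])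
    ((3 ∷ 5 ∷ 6 ∷ 2 ∷ 4 ∷ 0 ∷ []) ∷ (9 ∷ 7 ∷ 10 ∷ 8 ∷ 1 ∷ []) ∷ [])
    ((6 ∷ 0 ∷ 7 ∷ 1 ∷ 10 ∷ 3 ∷ []) ∷ (4 ∷ 9 ∷ 2 ∷ 5 ∷ 8 ∷ []) ∷ [])
    (2 ∷ 3 ∷ 5 ∷ 6 ∷ [])) ∷
  (_ , robustTwo (6 ∷ 4 ∷ [])
    ((3 ∷ 0 ∷ 9 ∷ 5 ∷ 2 ∷ 7 ∷ []) ∷ (6 ∷ 4 ∷ 1 ∷ 8 ∷ []) ∷ [])
    ((1 ∷ 9 ∷ 3 ∷ 8 ∷ 5 ∷ 7 ∷ []) ∷ (6 ∷ 2 ∷ 4 ∷ 0 ∷ []) ∷ [])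
    3 (2F ∷ 0F ∷ 2F ∷ 0F ∷ 1F ∷ 0F ∷ 0F ∷ 1F ∷ 2F ∷ 1F ∷ [])
    ((3 ∷ 6 ∷ 4 ∷ 2 ∷ 8 ∷ 1 ∷ []) ∷ (0 ∷ 7 ∷ 5 ∷ 9 ∷ []) ∷ [])
    ((2 ∷ 9 ∷ 4 ∷ 7 ∷ 1 ∷ 5 ∷ []) ∷ (6 ∷ 0 ∷ 3 ∷ 8 ∷ []) ∷ [])
    (2 ∷ 4 ∷ 5 ∷ 9 ∷ [])) ∷
  (_ , robustTwo (6 ∷ 3 ∷ [])
    ((6 ∷ 3 ∷ 8 ∷ 1 ∷ 7 ∷ 5 ∷ []) ∷ (4 ∷ 0 ∷ 2 ∷ []) ∷ [])
    ((2 ∷ 6 ∷ 0 ∷ 8 ∷ 4 ∷ 7 ∷ []) ∷ (3 ∷ 5 ∷ 1 ∷ []) ∷ [])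
    3 (1F ∷ 2F ∷ 0F ∷ 1F ∷ 2F ∷ 0F ∷ 2F ∷ 1F ∷ 0F ∷ [])
    ((1 ∷ 4 ∷ 2 ∷ 7 ∷ 0 ∷ 8 ∷ []) ∷ (5 ∷ 3 ∷ 6 ∷ []) ∷ [])
    ((1 ∷ 5 ∷ 7 ∷ 4 ∷ 8 ∷ 3 ∷ []) ∷ (0 ∷ 2 ∷ 6 ∷ []) ∷ [])
    (1 ∷ 2 ∷ 3 ∷ 4 ∷ [])) ∷
  -- The one entry that uses four colours; its obstruction spans nine vertices. With three colours,
  -- the four listed vertices always form a K₄.
  (_ , robustTwo (5 ∷ 5 ∷ [])
    ((3 ∷ 5 ∷ 0 ∷ 8 ∷ 1 ∷ []) ∷ (6 ∷ 4 ∷ 9 ∷ 7 ∷ 2 ∷ []) ∷ [])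
    ((1 ∷ 5 ∷ 4 ∷ 8 ∷ 6 ∷ []) ∷ (9 ∷ 2 ∷ 0 ∷ 7 ∷ 3 ∷ []) ∷ [])
    4 (3F ∷ 0F ∷ 2F ∷ 1F ∷ 0F ∷ 2F ∷ 3F ∷ 0F ∷ 1F ∷ 3F ∷ [])
    ((0 ∷ 8 ∷ 1 ∷ 7 ∷ 5 ∷ []) ∷ (3 ∷ 9 ∷ 4 ∷ 2 ∷ 6 ∷ []) ∷ [])
    ((4 ∷ 1 ∷ 5 ∷ 8 ∷ 6 ∷ []) ∷ (3 ∷ 0 ∷ 9 ∷ 2 ∷ 7 ∷ []) ∷ [])
    (8 ∷ 1 ∷ 0 ∷ 5 ∷ 7 ∷ 3 ∷ 6 ∷ 2 ∷ 4 ∷ [])) ∷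
  (_ , robustTwo (5 ∷ 4 ∷ [])
    ((1 ∷ 8 ∷ 6 ∷ 2 ∷ 4 ∷ []) ∷ (7 ∷ 3 ∷ 5 ∷ 0 ∷ []) ∷ [])
    ((0 ∷ 6 ∷ 4 ∷ 8 ∷ 3 ∷ []) ∷ (2 ∷ 7 ∷ 1 ∷ 5 ∷ []) ∷ [])
    3 (2F ∷ 1F ∷ 2F ∷ 1F ∷ 0F ∷ 0F ∷ 1F ∷ 0F ∷ 2F ∷ [])
    ((1 ∷ 5 ∷ 3 ∷ 6 ∷ 4 ∷ []) ∷ (8 ∷ 0 ∷ 7 ∷ 2 ∷ []) ∷ [])
    ((1 ∷ 3 ∷ 0 ∷ 5 ∷ 7 ∷ []) ∷ (4 ∷ 8 ∷ 6 ∷ 2 ∷ []) ∷ [])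
    (0 ∷ 1 ∷ 3 ∷ 5 ∷ [])) ∷
  (_ , robustTwo (6 ∷ 6 ∷ 6 ∷ [])
    ((0 ∷ 17 ∷ 15 ∷ 3 ∷ 8 ∷ 13 ∷ []) ∷ (11 ∷ 2 ∷ 7 ∷ 10 ∷ 16 ∷ 4 ∷ []) ∷ (5 ∷ 1 ∷ 6 ∷ 12 ∷ 9 ∷ 14 ∷ []) ∷ [])
    ((7 ∷ 3 ∷ 10 ∷ 14 ∷ 6 ∷ 0 ∷ []) ∷ (15 ∷ 5 ∷ 2 ∷ 16 ∷ 12 ∷ 11 ∷ []) ∷ (8 ∷ 17 ∷ 9 ∷ 4 ∷ 13 ∷ 1 ∷ []) ∷ [])
    3 (0F ∷ 2F ∷ 0F ∷ 1F ∷ 0F ∷ 1F ∷ 1F ∷ 2F ∷ 0F ∷ 1F ∷ 0F ∷ 2F ∷ 0F ∷ 1F ∷ 2F ∷ 0F ∷ 1F ∷ 2F ∷ [])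
    ((2 ∷ 8 ∷ 14 ∷ 3 ∷ 11 ∷ 9 ∷ []) ∷ (16 ∷ 0 ∷ 10 ∷ 5 ∷ 15 ∷ 6 ∷ []) ∷ (12 ∷ 4 ∷ 13 ∷ 1 ∷ 17 ∷ 7 ∷ []) ∷ [])
    ((5 ∷ 6 ∷ 0 ∷ 15 ∷ 10 ∷ 17 ∷ []) ∷ (13 ∷ 8 ∷ 4 ∷ 1 ∷ 7 ∷ 3 ∷ []) ∷ (11 ∷ 2 ∷ 12 ∷ 9 ∷ 14 ∷ 16 ∷ []) ∷ [])
    (0 ∷ 5 ∷ 10 ∷ 15 ∷ [])) ∷
  (_ , robustTwo (6 ∷ 6 ∷ 5 ∷ [])
    ((13 ∷ 4 ∷ 2 ∷ 16 ∷ 10 ∷ 0 ∷ []) ∷ (11 ∷ 15 ∷ 9 ∷ 6 ∷ 3 ∷ 14 ∷ []) ∷ (7 ∷ 12 ∷ 8 ∷ 5 ∷ 1 ∷ []) ∷ [])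
    ((5 ∷ 15 ∷ 7 ∷ 14 ∷ 4 ∷ 6 ∷ []) ∷ (16 ∷ 1 ∷ 9 ∷ 12 ∷ 11 ∷ 0 ∷ []) ∷ (3 ∷ 10 ∷ 2 ∷ 13 ∷ 8 ∷ []) ∷ [])
    3 (2F ∷ 0F ∷ 2F ∷ 1F ∷ 0F ∷ 1F ∷ 2F ∷ 1F ∷ 2F ∷ 1F ∷ 0F ∷ 1F ∷ 0F ∷ 1F ∷ 2F ∷ 0F ∷ 1F ∷ [])
    ((6 ∷ 5 ∷ 3 ∷ 9 ∷ 0 ∷ 14 ∷ []) ∷ (2 ∷ 10 ∷ 1 ∷ 16 ∷ 13 ∷ 8 ∷ []) ∷ (11 ∷ 4 ∷ 7 ∷ 12 ∷ 15 ∷ []) ∷ [])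
    ((14 ∷ 2 ∷ 7 ∷ 15 ∷ 6 ∷ 4 ∷ []) ∷ (5 ∷ 1 ∷ 12 ∷ 8 ∷ 16 ∷ 9 ∷ []) ∷ (11 ∷ 13 ∷ 10 ∷ 0 ∷ 3 ∷ []) ∷ [])
    (0 ∷ 3 ∷ 5 ∷ 9 ∷ [])) ∷
  (_ , robustTwo (6 ∷ 6 ∷ 4 ∷ [])
    ((13 ∷ 11 ∷ 2 ∷ 14 ∷ 5 ∷ 9 ∷ []) ∷ (10 ∷ 6 ∷ 0 ∷ 8 ∷ 3 ∷ 12 ∷ []) ∷ (15 ∷ 4 ∷ 7 ∷ 1 ∷ []) ∷ [])
    ((13 ∷ 3 ∷ 15 ∷ 9 ∷ 0 ∷ 4 ∷ []) ∷ (2 ∷ 7 ∷ 10 ∷ 1 ∷ 5 ∷ 6 ∷ []) ∷ (14 ∷ 8 ∷ 11 ∷ 12 ∷ []) ∷ [])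
    3 (2F ∷ 1F ∷ 0F ∷ 2F ∷ 1F ∷ 0F ∷ 1F ∷ 2F ∷ 0F ∷ 1F ∷ 0F ∷ 2F ∷ 1F ∷ 0F ∷ 2F ∷ 0F ∷ [])
    ((10 ∷ 14 ∷ 9 ∷ 12 ∷ 3 ∷ 1 ∷ []) ∷ (15 ∷ 6 ∷ 13 ∷ 11 ∷ 4 ∷ 0 ∷ []) ∷ (7 ∷ 2 ∷ 8 ∷ 5 ∷ []) ∷ [])
    ((12 ∷ 8 ∷ 14 ∷ 7 ∷ 11 ∷ 1 ∷ []) ∷ (2 ∷ 10 ∷ 13 ∷ 4 ∷ 6 ∷ 0 ∷ []) ∷ (15 ∷ 3 ∷ 5 ∷ 9 ∷ []) ∷ [])
    (4 ∷ 6 ∷ 11 ∷ 13 ∷ [])) ∷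
  (_ , robustTwo (6 ∷ 6 ∷ 3 ∷ [])
    ((7 ∷ 13 ∷ 1 ∷ 8 ∷ 3 ∷ 14 ∷ []) ∷ (9 ∷ 6 ∷ 5 ∷ 2 ∷ 10 ∷ 4 ∷ []) ∷ (12 ∷ 11 ∷ 0 ∷ []) ∷ [])
    ((2 ∷ 14 ∷ 11 ∷ 3 ∷ 13 ∷ 9 ∷ []) ∷ (1 ∷ 6 ∷ 12 ∷ 8 ∷ 5 ∷ 10 ∷ []) ∷ (7 ∷ 0 ∷ 4 ∷ []) ∷ [])
    3 (1F ∷ 0F ∷ 2F ∷ 0F ∷ 2F ∷ 0F ∷ 1F ∷ 0F ∷ 2F ∷ 0F ∷ 1F ∷ 2F ∷ 0F ∷ 2F ∷ 1F ∷ [])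
    ((14 ∷ 3 ∷ 6 ∷ 10 ∷ 4 ∷ 1 ∷ []) ∷ (11 ∷ 5 ∷ 13 ∷ 2 ∷ 7 ∷ 9 ∷ []) ∷ (8 ∷ 0 ∷ 12 ∷ []) ∷ [])
    ((12 ∷ 6 ∷ 13 ∷ 3 ∷ 5 ∷ 10 ∷ []) ∷ (8 ∷ 14 ∷ 0 ∷ 4 ∷ 9 ∷ 2 ∷ []) ∷ (1 ∷ 11 ∷ 7 ∷ []) ∷ [])
    (2 ∷ 7 ∷ 8 ∷ 9 ∷ [])) ∷
  (_ , robustTwo (6 ∷ 5 ∷ 5 ∷ [])
    ((2 ∷ 14 ∷ 6 ∷ 3 ∷ 0 ∷ 11 ∷ []) ∷ (12 ∷ 10 ∷ 7 ∷ 13 ∷ 1 ∷ []) ∷ (4 ∷ 15 ∷ 8 ∷ 5 ∷ 9 ∷ []) ∷ [])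
    ((14 ∷ 5 ∷ 11 ∷ 6 ∷ 1 ∷ 4 ∷ []) ∷ (0 ∷ 15 ∷ 12 ∷ 3 ∷ 7 ∷ []) ∷ (9 ∷ 2 ∷ 10 ∷ 8 ∷ 13 ∷ []) ∷ [])
    3 (2F ∷ 1F ∷ 2F ∷ 0F ∷ 2F ∷ 0F ∷ 2F ∷ 1F ∷ 2F ∷ 1F ∷ 0F ∷ 1F ∷ 2F ∷ 0F ∷ 1F ∷ 0F ∷ [])
    ((4 ∷ 9 ∷ 7 ∷ 13 ∷ 8 ∷ 14 ∷ []) ∷ (1 ∷ 10 ∷ 11 ∷ 6 ∷ 3 ∷ []) ∷ (5 ∷ 12 ∷ 15 ∷ 0 ∷ 2 ∷ []) ∷ [])
    ((7 ∷ 1 ∷ 15 ∷ 6 ∷ 8 ∷ 12 ∷ []) ∷ (9 ∷ 5 ∷ 3 ∷ 0 ∷ 13 ∷ []) ∷ (11 ∷ 4 ∷ 10 ∷ 2 ∷ 14 ∷ []) ∷ [])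
    (7 ∷ 8 ∷ 9 ∷ 13 ∷ [])) ∷
  (_ , robustTwo (6 ∷ 5 ∷ 4 ∷ [])
    ((7 ∷ 13 ∷ 5 ∷ 6 ∷ 3 ∷ 1 ∷ []) ∷ (14 ∷ 8 ∷ 2 ∷ 12 ∷ 9 ∷ []) ∷ (0 ∷ 11 ∷ 10 ∷ 4 ∷ []) ∷ [])
    ((1 ∷ 9 ∷ 0 ∷ 12 ∷ 3 ∷ 5 ∷ []) ∷ (6 ∷ 13 ∷ 4 ∷ 8 ∷ 11 ∷ []) ∷ (2 ∷ 14 ∷ 7 ∷ 10 ∷ []) ∷ [])
    3 (1F ∷ 2F ∷ 0F ∷ 1F ∷ 2F ∷ 0F ∷ 2F ∷ 0F ∷ 1F ∷ 0F ∷ 1F ∷ 0F ∷ 2F ∷ 1F ∷ 2F ∷ [])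
    ((0 ∷ 3 ∷ 10 ∷ 4 ∷ 6 ∷ 8 ∷ []) ∷ (1 ∷ 9 ∷ 13 ∷ 11 ∷ 5 ∷ []) ∷ (14 ∷ 7 ∷ 12 ∷ 2 ∷ []) ∷ [])
    ((11 ∷ 7 ∷ 2 ∷ 6 ∷ 12 ∷ 4 ∷ []) ∷ (0 ∷ 13 ∷ 10 ∷ 1 ∷ 14 ∷ []) ∷ (9 ∷ 5 ∷ 8 ∷ 3 ∷ []) ∷ [])
    (2 ∷ 6 ∷ 7 ∷ 12 ∷ [])) ∷
  (_ , robustTwo (6 ∷ 5 ∷ 3 ∷ [])
    ((6 ∷ 1 ∷ 8 ∷ 13 ∷ 2 ∷ 12 ∷ []) ∷ (10 ∷ 7 ∷ 9 ∷ 4 ∷ 0 ∷ []) ∷ (11 ∷ 5 ∷ 3 ∷ []) ∷ [])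
    ((4 ∷ 6 ∷ 11 ∷ 0 ∷ 8 ∷ 12 ∷ []) ∷ (10 ∷ 1 ∷ 13 ∷ 7 ∷ 3 ∷ []) ∷ (2 ∷ 5 ∷ 9 ∷ []) ∷ [])
    3 (2F ∷ 1F ∷ 0F ∷ 2F ∷ 0F ∷ 1F ∷ 2F ∷ 1F ∷ 0F ∷ 2F ∷ 0F ∷ 0F ∷ 1F ∷ 2F ∷ [])
    ((12 ∷ 8 ∷ 13 ∷ 10 ∷ 1 ∷ 5 ∷ []) ∷ (2 ∷ 0 ∷ 7 ∷ 3 ∷ 9 ∷ []) ∷ (11 ∷ 6 ∷ 4 ∷ []) ∷ [])
    ((12 ∷ 2 ∷ 8 ∷ 10 ∷ 11 ∷ 1 ∷ []) ∷ (3 ∷ 5 ∷ 7 ∷ 9 ∷ 6 ∷ []) ∷ (4 ∷ 0 ∷ 13 ∷ []) ∷ [])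
    (3 ∷ 6 ∷ 7 ∷ 9 ∷ [])) ∷
  (_ , robustTwo (6 ∷ 4 ∷ 4 ∷ [])
    ((6 ∷ 8 ∷ 5 ∷ 13 ∷ 0 ∷ 2 ∷ []) ∷ (3 ∷ 7 ∷ 1 ∷ 11 ∷ []) ∷ (12 ∷ 4 ∷ 10 ∷ 9 ∷ []) ∷ [])
    ((6 ∷ 0 ∷ 3 ∷ 9 ∷ 5 ∷ 11 ∷ []) ∷ (1 ∷ 13 ∷ 7 ∷ 4 ∷ []) ∷ (12 ∷ 2 ∷ 10 ∷ 8 ∷ []) ∷ [])
    3 (2F ∷ 0F ∷ 1F ∷ 0F ∷ 1F ∷ 0F ∷ 0F ∷ 2F ∷ 1F ∷ 2F ∷ 0F ∷ 2F ∷ 0F ∷ 1F ∷ [])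
    ((12 ∷ 0 ∷ 7 ∷ 1 ∷ 9 ∷ 4 ∷ []) ∷ (13 ∷ 11 ∷ 5 ∷ 8 ∷ []) ∷ (2 ∷ 10 ∷ 3 ∷ 6 ∷ []) ∷ [])
    ((10 ∷ 4 ∷ 11 ∷ 0 ∷ 6 ∷ 8 ∷ []) ∷ (13 ∷ 5 ∷ 9 ∷ 2 ∷ []) ∷ (7 ∷ 3 ∷ 1 ∷ 12 ∷ []) ∷ [])
    (0 ∷ 1 ∷ 7 ∷ 12 ∷ [])) ∷
  (_ , robustTwo (6 ∷ 4 ∷ 3 ∷ [])
    ((2 ∷ 11 ∷ 9 ∷ 7 ∷ 0 ∷ 6 ∷ []) ∷ (4 ∷ 1 ∷ 3 ∷ 12 ∷ []) ∷ (10 ∷ 8 ∷ 5 ∷ []) ∷ [])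
    ((0 ∷ 11 ∷ 1 ∷ 6 ∷ 4 ∷ 8 ∷ []) ∷ (2 ∷ 5 ∷ 9 ∷ 12 ∷ []) ∷ (10 ∷ 3 ∷ 7 ∷ []) ∷ [])
    3 (0F ∷ 2F ∷ 0F ∷ 1F ∷ 0F ∷ 2F ∷ 1F ∷ 2F ∷ 1F ∷ 0F ∷ 0F ∷ 1F ∷ 2F ∷ [])
    ((0 ∷ 7 ∷ 11 ∷ 4 ∷ 12 ∷ 6 ∷ []) ∷ (8 ∷ 1 ∷ 9 ∷ 3 ∷ []) ∷ (2 ∷ 10 ∷ 5 ∷ []) ∷ [])
    ((2 ∷ 9 ∷ 11 ∷ 5 ∷ 1 ∷ 6 ∷ []) ∷ (7 ∷ 4 ∷ 8 ∷ 12 ∷ []) ∷ (3 ∷ 0 ∷ 10 ∷ []) ∷ [])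
    (1 ∷ 2 ∷ 6 ∷ 9 ∷ [])) ∷
  (_ , robustTwo (6 ∷ 3 ∷ 3 ∷ [])
    ((11 ∷ 5 ∷ 8 ∷ 10 ∷ 2 ∷ 4 ∷ []) ∷ (0 ∷ 6 ∷ 9 ∷ []) ∷ (3 ∷ 7 ∷ 1 ∷ []) ∷ [])
    ((2 ∷ 6 ∷ 1 ∷ 11 ∷ 3 ∷ 8 ∷ []) ∷ (7 ∷ 9 ∷ 5 ∷ []) ∷ (10 ∷ 4 ∷ 0 ∷ []) ∷ [])
    3 (0F ∷ 1F ∷ 0F ∷ 2F ∷ 1F ∷ 2F ∷ 2F ∷ 0F ∷ 1F ∷ 1F ∷ 2F ∷ 0F ∷ [])
    ((7 ∷ 5 ∷ 11 ∷ 1 ∷ 6 ∷ 3 ∷ []) ∷ (4 ∷ 9 ∷ 8 ∷ []) ∷ (0 ∷ 10 ∷ 2 ∷ []) ∷ [])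
    ((4 ∷ 1 ∷ 5 ∷ 3 ∷ 8 ∷ 10 ∷ []) ∷ (11 ∷ 2 ∷ 6 ∷ []) ∷ (0 ∷ 9 ∷ 7 ∷ []) ∷ [])
    (4 ∷ 8 ∷ 9 ∷ 10 ∷ [])) ∷
  (_ , robustTwo (5 ∷ 5 ∷ 5 ∷ [])
    ((14 ∷ 0 ∷ 12 ∷ 3 ∷ 11 ∷ []) ∷ (9 ∷ 7 ∷ 2 ∷ 5 ∷ 10 ∷ []) ∷ (6 ∷ 8 ∷ 1 ∷ 4 ∷ 13 ∷ []) ∷ [])
    ((3 ∷ 6 ∷ 0 ∷ 11 ∷ 9 ∷ []) ∷ (14 ∷ 1 ∷ 12 ∷ 8 ∷ 5 ∷ []) ∷ (2 ∷ 13 ∷ 7 ∷ 4 ∷ 10 ∷ []) ∷ [])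
    3 (1F ∷ 0F ∷ 2F ∷ 1F ∷ 2F ∷ 0F ∷ 2F ∷ 0F ∷ 1F ∷ 2F ∷ 1F ∷ 0F ∷ 2F ∷ 1F ∷ 2F ∷ [])
    ((5 ∷ 0 ∷ 10 ∷ 6 ∷ 8 ∷ []) ∷ (2 ∷ 9 ∷ 13 ∷ 11 ∷ 14 ∷ []) ∷ (4 ∷ 12 ∷ 3 ∷ 7 ∷ 1 ∷ []) ∷ [])
    ((1 ∷ 12 ∷ 0 ∷ 14 ∷ 3 ∷ []) ∷ (13 ∷ 6 ∷ 9 ∷ 11 ∷ 8 ∷ []) ∷ (10 ∷ 2 ∷ 4 ∷ 5 ∷ 7 ∷ []) ∷ [])
    (6 ∷ 8 ∷ 9 ∷ 13 ∷ [])) ∷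
  (_ , robustTwo (5 ∷ 5 ∷ 4 ∷ [])
    ((3 ∷ 0 ∷ 2 ∷ 8 ∷ 10 ∷ []) ∷ (12 ∷ 4 ∷ 5 ∷ 13 ∷ 6 ∷ []) ∷ (1 ∷ 11 ∷ 9 ∷ 7 ∷ []) ∷ [])
    ((9 ∷ 2 ∷ 5 ∷ 11 ∷ 3 ∷ []) ∷ (1 ∷ 6 ∷ 4 ∷ 8 ∷ 13 ∷ []) ∷ (0 ∷ 12 ∷ 10 ∷ 7 ∷ []) ∷ [])
    3 (2F ∷ 0F ∷ 1F ∷ 0F ∷ 1F ∷ 0F ∷ 2F ∷ 1F ∷ 0F ∷ 2F ∷ 2F ∷ 1F ∷ 0F ∷ 1F ∷ [])
    ((11 ∷ 2 ∷ 7 ∷ 10 ∷ 4 ∷ []) ∷ (0 ∷ 5 ∷ 3 ∷ 1 ∷ 8 ∷ []) ∷ (12 ∷ 6 ∷ 13 ∷ 9 ∷ []) ∷ [])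
    ((1 ∷ 5 ∷ 2 ∷ 8 ∷ 11 ∷ []) ∷ (13 ∷ 7 ∷ 12 ∷ 3 ∷ 0 ∷ []) ∷ (10 ∷ 6 ∷ 4 ∷ 9 ∷ []) ∷ [])
    (1 ∷ 2 ∷ 8 ∷ 11 ∷ [])) ∷
  (_ , robustTwo (5 ∷ 5 ∷ 3 ∷ [])
    ((12 ∷ 2 ∷ 11 ∷ 8 ∷ 0 ∷ []) ∷ (6 ∷ 9 ∷ 3 ∷ 1 ∷ 10 ∷ []) ∷ (5 ∷ 7 ∷ 4 ∷ []) ∷ [])
    ((8 ∷ 2 ∷ 6 ∷ 0 ∷ 10 ∷ []) ∷ (12 ∷ 3 ∷ 7 ∷ 1 ∷ 5 ∷ []) ∷ (9 ∷ 11 ∷ 4 ∷ []) ∷ [])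
    3 (0F ∷ 1F ∷ 2F ∷ 0F ∷ 1F ∷ 0F ∷ 1F ∷ 2F ∷ 1F ∷ 2F ∷ 2F ∷ 0F ∷ 1F ∷ [])
    ((9 ∷ 6 ∷ 2 ∷ 4 ∷ 7 ∷ []) ∷ (12 ∷ 8 ∷ 11 ∷ 0 ∷ 5 ∷ []) ∷ (10 ∷ 1 ∷ 3 ∷ []) ∷ [])
    ((4 ∷ 1 ∷ 7 ∷ 3 ∷ 6 ∷ []) ∷ (10 ∷ 5 ∷ 11 ∷ 2 ∷ 8 ∷ []) ∷ (0 ∷ 12 ∷ 9 ∷ []) ∷ [])
    (2 ∷ 3 ∷ 4 ∷ 6 ∷ [])) ∷
  (_ , robustTwo (5 ∷ 4 ∷ 4 ∷ [])
    ((9 ∷ 0 ∷ 12 ∷ 10 ∷ 1 ∷ []) ∷ (6 ∷ 4 ∷ 8 ∷ 2 ∷ []) ∷ (3 ∷ 7 ∷ 11 ∷ 5 ∷ []) ∷ [])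
    ((11 ∷ 2 ∷ 9 ∷ 5 ∷ 4 ∷ []) ∷ (8 ∷ 12 ∷ 3 ∷ 1 ∷ []) ∷ (6 ∷ 0 ∷ 7 ∷ 10 ∷ []) ∷ [])
    3 (2F ∷ 0F ∷ 2F ∷ 1F ∷ 0F ∷ 2F ∷ 1F ∷ 0F ∷ 1F ∷ 1F ∷ 2F ∷ 1F ∷ 0F ∷ [])
    ((5 ∷ 9 ∷ 6 ∷ 3 ∷ 11 ∷ []) ∷ (0 ∷ 8 ∷ 1 ∷ 10 ∷ []) ∷ (2 ∷ 12 ∷ 4 ∷ 7 ∷ []) ∷ [])
    ((1 ∷ 11 ∷ 8 ∷ 2 ∷ 6 ∷ []) ∷ (7 ∷ 9 ∷ 4 ∷ 10 ∷ []) ∷ (3 ∷ 12 ∷ 5 ∷ 0 ∷ []) ∷ [])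
    (4 ∷ 7 ∷ 9 ∷ 10 ∷ [])) ∷
  (_ , robustTwo (5 ∷ 4 ∷ 3 ∷ [])
    ((0 ∷ 7 ∷ 1 ∷ 10 ∷ 5 ∷ []) ∷ (6 ∷ 11 ∷ 2 ∷ 4 ∷ []) ∷ (8 ∷ 9 ∷ 3 ∷ []) ∷ [])
    ((10 ∷ 4 ∷ 5 ∷ 2 ∷ 7 ∷ []) ∷ (6 ∷ 9 ∷ 0 ∷ 3 ∷ []) ∷ (11 ∷ 8 ∷ 1 ∷ []) ∷ [])
    3 (0F ∷ 1F ∷ 0F ∷ 2F ∷ 1F ∷ 2F ∷ 0F ∷ 2F ∷ 0F ∷ 1F ∷ 0F ∷ 2F ∷ [])
    ((8 ∷ 4 ∷ 9 ∷ 5 ∷ 3 ∷ []) ∷ (7 ∷ 10 ∷ 6 ∷ 1 ∷ []) ∷ (0 ∷ 2 ∷ 11 ∷ []) ∷ [])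
    ((6 ∷ 0 ∷ 3 ∷ 10 ∷ 8 ∷ []) ∷ (4 ∷ 7 ∷ 9 ∷ 2 ∷ []) ∷ (11 ∷ 1 ∷ 5 ∷ []) ∷ [])
    (0 ∷ 2 ∷ 3 ∷ 4 ∷ [])) ∷
  (_ , robustTwo (5 ∷ 3 ∷ 3 ∷ [])
    ((0 ∷ 7 ∷ 2 ∷ 4 ∷ 9 ∷ []) ∷ (1 ∷ 8 ∷ 6 ∷ []) ∷ (3 ∷ 5 ∷ 10 ∷ []) ∷ [])
    ((1 ∷ 5 ∷ 9 ∷ 2 ∷ 10 ∷ []) ∷ (8 ∷ 4 ∷ 7 ∷ []) ∷ (0 ∷ 3 ∷ 6 ∷ []) ∷ [])
    3 (2F ∷ 0F ∷ 2F ∷ 0F ∷ 1F ∷ 2F ∷ 1F ∷ 0F ∷ 2F ∷ 0F ∷ 1F ∷ [])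
    ((0 ∷ 10 ∷ 3 ∷ 5 ∷ 8 ∷ []) ∷ (9 ∷ 7 ∷ 2 ∷ []) ∷ (1 ∷ 4 ∷ 6 ∷ []) ∷ [])
    ((1 ∷ 5 ∷ 2 ∷ 4 ∷ 10 ∷ []) ∷ (3 ∷ 7 ∷ 8 ∷ []) ∷ (9 ∷ 6 ∷ 0 ∷ []) ∷ [])
    (2 ∷ 3 ∷ 5 ∷ 7 ∷ [])) ∷
  (_ , robustTwo (4 ∷ 4 ∷ 4 ∷ [])
    ((3 ∷ 11 ∷ 6 ∷ 1 ∷ []) ∷ (10 ∷ 7 ∷ 9 ∷ 5 ∷ []) ∷ (0 ∷ 8 ∷ 2 ∷ 4 ∷ []) ∷ [])
    ((10 ∷ 0 ∷ 6 ∷ 2 ∷ []) ∷ (11 ∷ 4 ∷ 1 ∷ 9 ∷ []) ∷ (7 ∷ 8 ∷ 5 ∷ 3 ∷ []) ∷ [])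
    3 (0F ∷ 2F ∷ 0F ∷ 1F ∷ 1F ∷ 2F ∷ 1F ∷ 2F ∷ 1F ∷ 0F ∷ 1F ∷ 2F ∷ [])
    ((8 ∷ 2 ∷ 5 ∷ 1 ∷ []) ∷ (6 ∷ 11 ∷ 9 ∷ 4 ∷ []) ∷ (10 ∷ 3 ∷ 7 ∷ 0 ∷ []) ∷ [])
    ((4 ∷ 10 ∷ 6 ∷ 1 ∷ []) ∷ (5 ∷ 0 ∷ 2 ∷ 11 ∷ []) ∷ (3 ∷ 9 ∷ 7 ∷ 8 ∷ []) ∷ [])
    (1 ∷ 4 ∷ 5 ∷ 6 ∷ [])) ∷
  (_ , robustTwo (4 ∷ 4 ∷ 3 ∷ [])
    ((2 ∷ 8 ∷ 6 ∷ 10 ∷ []) ∷ (9 ∷ 5 ∷ 0 ∷ 7 ∷ []) ∷ (4 ∷ 1 ∷ 3 ∷ []) ∷ [])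
    ((6 ∷ 3 ∷ 9 ∷ 1 ∷ []) ∷ (4 ∷ 10 ∷ 0 ∷ 8 ∷ []) ∷ (2 ∷ 5 ∷ 7 ∷ []) ∷ [])
    3 (0F ∷ 1F ∷ 0F ∷ 2F ∷ 0F ∷ 2F ∷ 0F ∷ 1F ∷ 2F ∷ 0F ∷ 1F ∷ [])
    ((6 ∷ 3 ∷ 9 ∷ 0 ∷ []) ∷ (7 ∷ 8 ∷ 5 ∷ 2 ∷ []) ∷ (4 ∷ 10 ∷ 1 ∷ []) ∷ [])
    ((8 ∷ 6 ∷ 2 ∷ 0 ∷ []) ∷ (4 ∷ 3 ∷ 1 ∷ 9 ∷ []) ∷ (7 ∷ 10 ∷ 5 ∷ []) ∷ [])
    (5 ∷ 7 ∷ 8 ∷ 10 ∷ [])) ∷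
  (_ , robustTwo (4 ∷ 3 ∷ 3 ∷ [])
    ((0 ∷ 6 ∷ 2 ∷ 7 ∷ []) ∷ (8 ∷ 5 ∷ 1 ∷ []) ∷ (4 ∷ 3 ∷ 9 ∷ []) ∷ [])
    ((2 ∷ 9 ∷ 0 ∷ 5 ∷ []) ∷ (8 ∷ 6 ∷ 3 ∷ []) ∷ (1 ∷ 7 ∷ 4 ∷ []) ∷ [])
    3 (1F ∷ 0F ∷ 1F ∷ 2F ∷ 1F ∷ 2F ∷ 0F ∷ 2F ∷ 1F ∷ 0F ∷ [])
    ((5 ∷ 8 ∷ 2 ∷ 0 ∷ []) ∷ (3 ∷ 7 ∷ 4 ∷ []) ∷ (1 ∷ 9 ∷ 6 ∷ []) ∷ [])
    ((3 ∷ 9 ∷ 2 ∷ 5 ∷ []) ∷ (7 ∷ 6 ∷ 0 ∷ []) ∷ (4 ∷ 8 ∷ 1 ∷ []) ∷ [])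
    (1 ∷ 2 ∷ 8 ∷ 9 ∷ [])) ∷
  (_ , robustTwo (6 ∷ 3 ∷ 3 ∷ 3 ∷ [])
    ((14 ∷ 11 ∷ 12 ∷ 6 ∷ 3 ∷ 8 ∷ []) ∷ (9 ∷ 2 ∷ 13 ∷ []) ∷ (1 ∷ 5 ∷ 10 ∷ []) ∷ (0 ∷ 7 ∷ 4 ∷ []) ∷ [])
    ((0 ∷ 12 ∷ 2 ∷ 11 ∷ 5 ∷ 8 ∷ []) ∷ (7 ∷ 13 ∷ 10 ∷ []) ∷ (14 ∷ 3 ∷ 1 ∷ []) ∷ (4 ∷ 9 ∷ 6 ∷ []) ∷ [])
    3 (0F ∷ 2F ∷ 0F ∷ 1F ∷ 2F ∷ 1F ∷ 0F ∷ 1F ∷ 2F ∷ 1F ∷ 0F ∷ 2F ∷ 1F ∷ 2F ∷ 0F ∷ [])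
    ((12 ∷ 8 ∷ 5 ∷ 6 ∷ 10 ∷ 0 ∷ []) ∷ (2 ∷ 9 ∷ 14 ∷ []) ∷ (3 ∷ 13 ∷ 1 ∷ []) ∷ (7 ∷ 11 ∷ 4 ∷ []) ∷ [])
    ((7 ∷ 13 ∷ 8 ∷ 2 ∷ 4 ∷ 10 ∷ []) ∷ (12 ∷ 9 ∷ 1 ∷ []) ∷ (0 ∷ 11 ∷ 6 ∷ []) ∷ (3 ∷ 14 ∷ 5 ∷ []) ∷ [])
    (4 ∷ 7 ∷ 10 ∷ 11 ∷ [])) ∷
  (_ , robustTwo (5 ∷ 3 ∷ 3 ∷ 3 ∷ [])
    ((6 ∷ 10 ∷ 0 ∷ 2 ∷ 12 ∷ []) ∷ (13 ∷ 1 ∷ 9 ∷ []) ∷ (7 ∷ 4 ∷ 8 ∷ []) ∷ (11 ∷ 5 ∷ 3 ∷ []) ∷ [])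
    ((10 ∷ 4 ∷ 1 ∷ 8 ∷ 2 ∷ []) ∷ (3 ∷ 6 ∷ 13 ∷ []) ∷ (9 ∷ 12 ∷ 5 ∷ []) ∷ (11 ∷ 7 ∷ 0 ∷ []) ∷ [])
    3 (2F ∷ 1F ∷ 0F ∷ 1F ∷ 0F ∷ 2F ∷ 0F ∷ 1F ∷ 2F ∷ 0F ∷ 1F ∷ 0F ∷ 1F ∷ 2F ∷ [])
    ((10 ∷ 1 ∷ 8 ∷ 5 ∷ 11 ∷ []) ∷ (13 ∷ 7 ∷ 0 ∷ []) ∷ (6 ∷ 3 ∷ 12 ∷ []) ∷ (4 ∷ 2 ∷ 9 ∷ []) ∷ [])
    ((9 ∷ 6 ∷ 2 ∷ 10 ∷ 3 ∷ []) ∷ (13 ∷ 1 ∷ 4 ∷ []) ∷ (8 ∷ 7 ∷ 11 ∷ []) ∷ (5 ∷ 0 ∷ 12 ∷ []) ∷ [])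
    (2 ∷ 3 ∷ 6 ∷ 9 ∷ [])) ∷
  (_ , robustTwo (4 ∷ 3 ∷ 3 ∷ 3 ∷ [])
    ((11 ∷ 9 ∷ 0 ∷ 7 ∷ []) ∷ (5 ∷ 1 ∷ 10 ∷ []) ∷ (3 ∷ 8 ∷ 6 ∷ []) ∷ (2 ∷ 4 ∷ 12 ∷ []) ∷ [])
    ((0 ∷ 12 ∷ 8 ∷ 10 ∷ []) ∷ (5 ∷ 7 ∷ 3 ∷ []) ∷ (4 ∷ 11 ∷ 1 ∷ []) ∷ (2 ∷ 9 ∷ 6 ∷ []) ∷ [])
    3 (0F ∷ 2F ∷ 0F ∷ 1F ∷ 1F ∷ 0F ∷ 2F ∷ 2F ∷ 0F ∷ 1F ∷ 1F ∷ 0F ∷ 2F ∷ [])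
    ((9 ∷ 5 ∷ 10 ∷ 3 ∷ []) ∷ (2 ∷ 12 ∷ 6 ∷ []) ∷ (4 ∷ 0 ∷ 7 ∷ []) ∷ (1 ∷ 8 ∷ 11 ∷ []) ∷ [])
    ((1 ∷ 5 ∷ 3 ∷ 7 ∷ []) ∷ (0 ∷ 8 ∷ 12 ∷ []) ∷ (9 ∷ 10 ∷ 6 ∷ []) ∷ (11 ∷ 4 ∷ 2 ∷ []) ∷ [])
    (0 ∷ 1 ∷ 7 ∷ 8 ∷ [])) ∷
  (_ , robustTwo (3 ∷ 3 ∷ 3 ∷ 3 ∷ [])
    ((7 ∷ 5 ∷ 10 ∷ []) ∷ (11 ∷ 0 ∷ 4 ∷ []) ∷ (8 ∷ 3 ∷ 2 ∷ []) ∷ (9 ∷ 1 ∷ 6 ∷ []) ∷ [])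
    ((7 ∷ 2 ∷ 4 ∷ []) ∷ (10 ∷ 6 ∷ 0 ∷ []) ∷ (1 ∷ 11 ∷ 3 ∷ []) ∷ (9 ∷ 8 ∷ 5 ∷ []) ∷ [])
    3 (2F ∷ 0F ∷ 1F ∷ 2F ∷ 0F ∷ 1F ∷ 1F ∷ 2F ∷ 0F ∷ 2F ∷ 0F ∷ 1F ∷ [])
    ((5 ∷ 9 ∷ 2 ∷ []) ∷ (6 ∷ 4 ∷ 1 ∷ []) ∷ (7 ∷ 0 ∷ 10 ∷ []) ∷ (8 ∷ 11 ∷ 3 ∷ []) ∷ [])
    ((1 ∷ 8 ∷ 10 ∷ []) ∷ (7 ∷ 2 ∷ 4 ∷ []) ∷ (11 ∷ 5 ∷ 0 ∷ []) ∷ (6 ∷ 3 ∷ 9 ∷ []) ∷ [])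
    (3 ∷ 5 ∷ 9 ∷ 11 ∷ [])) ∷
  (_ , robustTwo (3 ∷ 3 ∷ 3 ∷ 3 ∷ 3 ∷ [])
    ((14 ∷ 7 ∷ 0 ∷ []) ∷ (2 ∷ 3 ∷ 11 ∷ []) ∷ (6 ∷ 10 ∷ 4 ∷ []) ∷ (9 ∷ 12 ∷ 1 ∷ []) ∷ (13 ∷ 5 ∷ 8 ∷ []) ∷ [])
    ((14 ∷ 3 ∷ 6 ∷ []) ∷ (9 ∷ 5 ∷ 7 ∷ []) ∷ (0 ∷ 4 ∷ 13 ∷ []) ∷ (1 ∷ 8 ∷ 11 ∷ []) ∷ (12 ∷ 10 ∷ 2 ∷ []) ∷ [])
    3 (0F ∷ 1F ∷ 2F ∷ 1F ∷ 2F ∷ 0F ∷ 0F ∷ 1F ∷ 2F ∷ 2F ∷ 1F ∷ 0F ∷ 0F ∷ 1F ∷ 2F ∷ [])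
    ((11 ∷ 1 ∷ 13 ∷ []) ∷ (5 ∷ 8 ∷ 2 ∷ []) ∷ (14 ∷ 0 ∷ 6 ∷ []) ∷ (9 ∷ 12 ∷ 3 ∷ []) ∷ (7 ∷ 4 ∷ 10 ∷ []) ∷ [])
    ((8 ∷ 0 ∷ 13 ∷ []) ∷ (9 ∷ 14 ∷ 1 ∷ []) ∷ (5 ∷ 10 ∷ 6 ∷ []) ∷ (3 ∷ 7 ∷ 2 ∷ []) ∷ (4 ∷ 12 ∷ 11 ∷ []) ∷ [])
    (0 ∷ 1 ∷ 13 ∷ 14 ∷ [])) ∷
  []

-- For both packings, the data of the copies is followed by the vertices w, p, q and r
-- of Growable; the clique in the second total comes before them.
growing : ∀ j → RobustTwo (3 ℕ.+ (j ℕ.+ 7) ∷ [])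
-- A single cycle cannot start earlier than at length 10: on 9 vertices the complement of a total is
-- 2-regular, hence has no five independent vertices, and the total has no K₅.
growing = growingFamily 7 ([])
  ((3 ∷ 5 ∷ 9 ∷ 2 ∷ 6 ∷ 4 ∷ 1 ∷ 7 ∷ 0 ∷ 8 ∷ []) ∷ [])
  ((7 ∷ 2 ∷ 8 ∷ 4 ∷ 9 ∷ 1 ∷ 3 ∷ 6 ∷ 0 ∷ 5 ∷ []) ∷ [])
  (3F ∷ 2F ∷ 3F ∷ 1F ∷ 3F ∷ 0F ∷ 2F ∷ 1F ∷ 0F ∷ 1F ∷ [])
  (3 ∷ 2 ∷ 0 ∷ []) 1 (9 ∷ 8 ∷ []) (6 ∷ 7 ∷ 5 ∷ [])
  ((2 ∷ 8 ∷ 5 ∷ 1 ∷ 9 ∷ 6 ∷ 4 ∷ 0 ∷ 3 ∷ 7 ∷ []) ∷ [])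
  ((3 ∷ 1 ∷ 8 ∷ 0 ∷ 5 ∷ 9 ∷ 7 ∷ 4 ∷ 2 ∷ 6 ∷ []) ∷ [])
  (0 ∷ 1 ∷ 5 ∷ 8 ∷ 9 ∷ [])
  (7 ∷ 3 ∷ 2 ∷ []) 1 (0 ∷ 8 ∷ []) (9 ∷ 6 ∷ 4 ∷ [])

growing6 : ∀ j → RobustTwo (3 ℕ.+ (j ℕ.+ 4) ∷ 6 ∷ [])
growing6 = growingFamily 4 (6 ∷ [])
  ((8 ∷ 11 ∷ 3 ∷ 0 ∷ 5 ∷ 2 ∷ 10 ∷ []) ∷ (7 ∷ 6 ∷ 4 ∷ 9 ∷ 12 ∷ 1 ∷ []) ∷ [])
  ((1 ∷ 4 ∷ 0 ∷ 8 ∷ 2 ∷ 11 ∷ 9 ∷ []) ∷ (3 ∷ 7 ∷ 10 ∷ 5 ∷ 12 ∷ 6 ∷ []) ∷ [])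
  (2F ∷ 0F ∷ 1F ∷ 0F ∷ 3F ∷ 0F ∷ 1F ∷ 3F ∷ 0F ∷ 1F ∷ 2F ∷ 3F ∷ 2F ∷ [])
  (9 ∷ 2 ∷ 0 ∷ []) 1 (10 ∷ 3 ∷ []) (11 ∷ 8 ∷ 8 ∷ [])
  ((5 ∷ 0 ∷ 12 ∷ 4 ∷ 6 ∷ 1 ∷ 7 ∷ []) ∷ (8 ∷ 10 ∷ 2 ∷ 11 ∷ 9 ∷ 3 ∷ []) ∷ [])
  ((8 ∷ 11 ∷ 3 ∷ 10 ∷ 6 ∷ 7 ∷ 0 ∷ []) ∷ (4 ∷ 9 ∷ 2 ∷ 12 ∷ 5 ∷ 1 ∷ []) ∷ [])
  (2 ∷ 3 ∷ 9 ∷ 10 ∷ 11 ∷ [])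
  (8 ∷ 6 ∷ 0 ∷ []) 1 (4 ∷ 12 ∷ []) (11 ∷ 10 ∷ 7 ∷ [])

growing5 : ∀ j → RobustTwo (3 ℕ.+ (j ℕ.+ 4) ∷ 5 ∷ [])
growing5 = growingFamily 4 (5 ∷ [])
  ((9 ∷ 7 ∷ 6 ∷ 10 ∷ 8 ∷ 0 ∷ 4 ∷ []) ∷ (1 ∷ 3 ∷ 5 ∷ 2 ∷ 11 ∷ []) ∷ [])
  ((9 ∷ 11 ∷ 0 ∷ 7 ∷ 3 ∷ 10 ∷ 5 ∷ []) ∷ (6 ∷ 2 ∷ 8 ∷ 4 ∷ 1 ∷ []) ∷ [])
  (0F ∷ 2F ∷ 3F ∷ 0F ∷ 1F ∷ 2F ∷ 1F ∷ 3F ∷ 2F ∷ 0F ∷ 3F ∷ 1F ∷ [])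
  (5 ∷ 7 ∷ 0 ∷ []) 1 (9 ∷ 8 ∷ []) (10 ∷ 3 ∷ 11 ∷ [])
  ((3 ∷ 10 ∷ 8 ∷ 11 ∷ 9 ∷ 5 ∷ 1 ∷ []) ∷ (6 ∷ 4 ∷ 7 ∷ 0 ∷ 2 ∷ []) ∷ [])
  ((3 ∷ 11 ∷ 5 ∷ 8 ∷ 2 ∷ 4 ∷ 0 ∷ []) ∷ (10 ∷ 1 ∷ 6 ∷ 9 ∷ 7 ∷ []) ∷ [])
  (7 ∷ 8 ∷ 9 ∷ 10 ∷ 11 ∷ [])
  (4 ∷ 5 ∷ 3 ∷ []) 2 (1 ∷ 1 ∷ []) (0 ∷ 8 ∷ 0 ∷ [])

growing4 : ∀ j → RobustTwo (3 ℕ.+ (j ℕ.+ 4) ∷ 4 ∷ [])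
growing4 = growingFamily 4 (4 ∷ [])
  ((2 ∷ 5 ∷ 10 ∷ 6 ∷ 1 ∷ 3 ∷ 8 ∷ []) ∷ (4 ∷ 0 ∷ 9 ∷ 7 ∷ []) ∷ [])
  ((1 ∷ 4 ∷ 10 ∷ 2 ∷ 9 ∷ 6 ∷ 8 ∷ []) ∷ (7 ∷ 3 ∷ 5 ∷ 0 ∷ []) ∷ [])
  (2F ∷ 3F ∷ 1F ∷ 0F ∷ 1F ∷ 3F ∷ 1F ∷ 3F ∷ 2F ∷ 0F ∷ 2F ∷ [])
  (4 ∷ 2 ∷ 1 ∷ []) 0 (5 ∷ 3 ∷ []) (10 ∷ 9 ∷ 8 ∷ [])
  ((8 ∷ 1 ∷ 4 ∷ 6 ∷ 2 ∷ 7 ∷ 3 ∷ []) ∷ (9 ∷ 0 ∷ 10 ∷ 5 ∷ []) ∷ [])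
  ((9 ∷ 6 ∷ 10 ∷ 8 ∷ 2 ∷ 0 ∷ 4 ∷ []) ∷ (3 ∷ 1 ∷ 7 ∷ 5 ∷ []) ∷ [])
  (1 ∷ 2 ∷ 3 ∷ 7 ∷ 8 ∷ [])
  (10 ∷ 6 ∷ 4 ∷ []) 3 (2 ∷ 1 ∷ []) (8 ∷ 9 ∷ 0 ∷ [])

growing3 : ∀ j → RobustTwo (3 ℕ.+ (j ℕ.+ 4) ∷ 3 ∷ [])
growing3 = growingFamily 4 (3 ∷ [])
  ((5 ∷ 3 ∷ 1 ∷ 6 ∷ 8 ∷ 4 ∷ 9 ∷ []) ∷ (0 ∷ 2 ∷ 7 ∷ []) ∷ [])
  ((8 ∷ 2 ∷ 4 ∷ 6 ∷ 9 ∷ 0 ∷ 3 ∷ []) ∷ (7 ∷ 5 ∷ 1 ∷ []) ∷ [])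
  (3F ∷ 2F ∷ 1F ∷ 0F ∷ 2F ∷ 3F ∷ 0F ∷ 0F ∷ 3F ∷ 1F ∷ [])
  (0 ∷ 6 ∷ 3 ∷ []) 2 (1 ∷ 1 ∷ []) (9 ∷ 9 ∷ 8 ∷ [])
  ((4 ∷ 0 ∷ 3 ∷ 7 ∷ 5 ∷ 1 ∷ 8 ∷ []) ∷ (9 ∷ 2 ∷ 6 ∷ []) ∷ [])
  ((8 ∷ 6 ∷ 1 ∷ 7 ∷ 4 ∷ 9 ∷ 3 ∷ []) ∷ (0 ∷ 5 ∷ 2 ∷ []) ∷ [])
  (0 ∷ 1 ∷ 2 ∷ 5 ∷ 6 ∷ [])
  (7 ∷ 4 ∷ 3 ∷ []) 2 (0 ∷ 0 ∷ []) (1 ∷ 9 ∷ 8 ∷ [])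

growing33 : ∀ j → RobustTwo (3 ℕ.+ (j ℕ.+ 4) ∷ 3 ∷ 3 ∷ [])
growing33 = growingFamily 4 (3 ∷ 3 ∷ [])
  ((3 ∷ 1 ∷ 8 ∷ 12 ∷ 0 ∷ 2 ∷ 5 ∷ []) ∷ (9 ∷ 11 ∷ 6 ∷ []) ∷ (4 ∷ 10 ∷ 7 ∷ []) ∷ [])
  ((7 ∷ 2 ∷ 9 ∷ 3 ∷ 10 ∷ 8 ∷ 6 ∷ []) ∷ (5 ∷ 1 ∷ 12 ∷ []) ∷ (0 ∷ 11 ∷ 4 ∷ []) ∷ [])
  (2F ∷ 0F ∷ 1F ∷ 3F ∷ 0F ∷ 2F ∷ 0F ∷ 3F ∷ 1F ∷ 2F ∷ 2F ∷ 1F ∷ 3F ∷ [])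
  (6 ∷ 3 ∷ 2 ∷ []) 1 (5 ∷ 0 ∷ []) (8 ∷ 9 ∷ 9 ∷ [])
  ((7 ∷ 10 ∷ 3 ∷ 8 ∷ 12 ∷ 9 ∷ 6 ∷ []) ∷ (11 ∷ 1 ∷ 4 ∷ []) ∷ (0 ∷ 2 ∷ 5 ∷ []) ∷ [])
  ((8 ∷ 0 ∷ 4 ∷ 2 ∷ 9 ∷ 11 ∷ 6 ∷ []) ∷ (10 ∷ 1 ∷ 5 ∷ []) ∷ (12 ∷ 7 ∷ 3 ∷ []) ∷ [])
  (0 ∷ 1 ∷ 2 ∷ 4 ∷ 5 ∷ [])
  (9 ∷ 8 ∷ 6 ∷ []) 5 (3 ∷ 7 ∷ []) (2 ∷ 0 ∷ 11 ∷ [])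

-- Totals on at most eight vertices

Inj : (Fin m → Fin n) → Set
Inj f = ∀ {i j} → f i ≡ f j → i ≡ j

◂-injective : ∀ {y} {f : Fin m → Fin n} → (∀ i → y ≢ f i) → Inj f → Inj (y ◂ f)
◂-injective y∉f inj {zero}  {zero}  _ = refl
◂-injective y∉f inj {zero}  {suc j} e = contradiction e (y∉f j)
◂-injective y∉f inj {suc i} {zero}  e = contradiction (sym e) (y∉f i)
◂-injective y∉f inj {suc i} {suc j} e = cong suc (inj e)

injective⇒surjective : {f : Fin n → Fin n} → Inj f → ∀ y → ∃ λ x → f x ≡ y
injective⇒surjective {n} {f} inj y with any? (λ x → f x ≟ᶠ y)
... | yes hit = hit
... | no miss = contradiction
  (injective⇒≤ (◂-injective (λ i y≡fi → miss (i , sym y≡fi)) inj)) ℕ.1+n≰n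

missed : m < n → (f : Fin m → Fin n) → ∃ λ y → ∀ x → y ≢ f x
missed m<n f with all? (λ y → any? λ x → f x ≟ᶠ y)
... | yes onto = contradiction
  (injective⇒≤ {f = proj₁ ∘ onto} λ {x} {y} e →
    trans (sym (proj₂ (onto x))) (trans (cong f e) (proj₂ (onto y)))) (ℕ.<⇒≱ m<n)
... | no ¬onto with ¬∀⟶∃¬ _ _ (λ y → any? λ x → f x ≟ᶠ y) ¬onto
...   | y , y∉ = y , λ x e → y∉ (x , sym e)

TwoNeighbours : {U : Set} → Rel U 0ℓ → Set
TwoNeighbours R = ∀ u → ∃₂ λ v w → v ≢ w × R u v × R u w × (∀ x → R u x → x ≡ v ⊎ x ≡ w)

TwoNeighbours-≃ : ∀ {U W} {R : Rel U 0ℓ} {S : Rel W 0ℓ} → R ≃ S → TwoNeighbours S → TwoNeighbours R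
TwoNeighbours-≃ {R = R} φ two u = let v , w , v≢w , e , e′ , only = two (to u) in
  from v , from w , v≢w ∘ from-injective ,
  subst (λ u → R u (from v)) (from-to u) (from-edge e) ,
  subst (λ u → R u (from w)) (from-to u) (from-edge e′) ,
  λ x r → Sum.map pull pull (only (to x) (to-edge r))
  where
  open _≃_ φ
  pull : ∀ {x y} → to x ≡ y → x ≡ from y
  pull refl = sym (from-to _)

twoNeighbours? : (G : Graph n) → Dec (TwoNeighbours (Adj G))
twoNeighbours? G = all? λ u → any? λ v → any? λ w →
  ¬? (v ≟ᶠ w) ×-dec Graph.adj? G u v ×-dec Graph.adj? G u w ×-dec
  all? λ x → Graph.adj? G u x →-dec ((x ≟ᶠ v) ⊎-dec (x ≟ᶠ w))

module _ {G : Graph n} (two : TwoNeighbours (Adj G)) (p : Packing G) where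
  open Packing p
  open Injection using (to; injective)

  private
    origin : Fin 3 → Fin n → Fin n
    origin i x = proj₁ (injective⇒surjective (injective (α i)) x)

    to-origin : ∀ i x → to (α i) (origin i x) ≡ x
    to-origin i x = proj₂ (injective⇒surjective (injective (α i)) x)

    neighbour : Fin 3 → Fin 2 → Fin n → Fin n
    neighbour i 0F x = to (α i) (proj₁ (two (origin i x)))
    neighbour i 1F x = to (α i) (proj₁ (proj₂ (two (origin i x))))

    neighbour-injective : ∀ i {b c} x → neighbour i b x ≡ neighbour i c x → b ≡ c
    neighbour-injective i {0F} {0F} x e = refl
    neighbour-injective i {0F} {1F} x e =
      contradiction (injective (α i) e) (proj₁ (proj₂ (proj₂ (two (origin i x)))))
    neighbour-injective i {1F} {0F} x e =
      contradiction (sym (injective (α i) e)) (proj₁ (proj₂ (proj₂ (two (origin i x)))))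
    neighbour-injective i {1F} {1F} x e = refl

    neighbour-adj : ∀ i b x → Adj (α i [ G ]) x (neighbour i b x)
    neighbour-adj i 0F x = _ , _ , to-origin i x , refl , proj₁ (proj₂ (proj₂ (proj₂ (two (origin i x)))))
    neighbour-adj i 1F x = _ , _ , to-origin i x , refl , proj₁ (proj₂ (proj₂ (proj₂ (proj₂ (two (origin i x))))))

    neighbour-only : ∀ i {x y} → Adj (α i [ G ]) x y → ∃ λ b → y ≡ neighbour i b x
    neighbour-only i {x} (u , v , refl , refl , e) with
      proj₂ (proj₂ (proj₂ (proj₂ (proj₂ (two (origin i x)))))) v
        (subst (λ u → Adj G u v) (sym (injective (α i) (to-origin i x))) e)
    ... | inj₁ v≡ = 0F , cong (to (α i)) v≡
    ... | inj₂ v≡ = 1F , cong (to (α i)) v≡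

    layer⇒total : ∀ i {x y} → Adj (α i [ G ]) x y → Adj total x y
    layer⇒total 0F e = inj₁ e
    layer⇒total 1F e = inj₂ (inj₁ e)
    layer⇒total 2F e = inj₂ (inj₂ e)

  star : Fin n → Fin 6 → Fin n
  star x k = let i , b = remQuot {3} 2 k in neighbour i b x

  star-adj : ∀ x k → Adj total x (star x k)
  star-adj x k = let i , b = remQuot {3} 2 k in layer⇒total i (neighbour-adj i b x)

  -- The two neighbours within a copy differ, and a neighbour common to two copies would give them a
  -- common edge.
  star-injective : ∀ x → Inj (star x)
  star-injective x {k} {l} e = trans (sym (combine-remQuot {3} 2 k))
    (trans (cong (λ (i , b) → combine i b) (same (remQuot {3} 2 k) (remQuot {3} 2 l) e)) (combine-remQuot {3} 2 l))
    where
    same : ∀ ((i , b) (j , c) : Fin 3 × Fin 2) → neighbour i b x ≡ neighbour j c x → (i , b) ≡ (j , c)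
    same (i , b) (j , c) e with i ≟ᶠ j
    ... | yes refl = cong (i ,_) (neighbour-injective i x e)
    ... | no i≢j   = contradiction (subst (Adj (α j [ G ]) x) (sym e) (neighbour-adj j c x))
      (disjoint i j i≢j x _ (neighbour-adj i b x))

  star-only : ∀ {x y} → Adj total x y → ∃ λ k → y ≡ star x k
  star-only e = let i , e′ = which e ; b , y≡ = neighbour-only i e′ in
    combine i b , trans y≡ (cong (λ (i , b) → neighbour i b _) (sym (remQuot-combine i b)))
    where
    which : ∀ {x y} → Adj total x y → ∃ λ i → Adj (α i [ G ]) x y
    which (inj₁ e)        = 0F , e
    which (inj₂ (inj₁ e)) = 1F , e
    which (inj₂ (inj₂ e)) = 2F , e

  star∌centre : ∀ x k → x ≢ star x k
  star∌centre x k e = Graph.irrefl total e (star-adj x k)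

  closedStar-injective : ∀ x → Inj (x ◂ star x)
  closedStar-injective x = ◂-injective (star∌centre x) (star-injective x)

  nonneighbour∉ : ∀ {x y} → ¬ Adj total x y → y ≢ x → ∀ k → y ≢ (x ◂ star x) k
  nonneighbour∉ ¬adj y≢x zero    = y≢x
  nonneighbour∉ ¬adj y≢x (suc k) refl = ¬adj (star-adj _ k)

  tooSmall : n ≤ 6 → ¬ Fin n
  tooSmall n≤6 x = contradiction (injective⇒≤ (closedStar-injective x)) (ℕ.<⇒≱ (ℕ.s≤s n≤6))

  complete : n ≡ 7 → Adj total ≃ _≢_ {A = Fin n}
  complete refl = record
    { to = id ; from = id ; to-from = λ _ → refl ; from-to = λ _ → refl
    ; to-edge   = λ e x≡y → Graph.irrefl total x≡y e
    ; from-edge = λ {x} {y} x≢y → decidable-stable (Graph.adj? total x y) λ ¬adj →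
        contradiction (injective⇒≤ (◂-injective (nonneighbour∉ ¬adj (x≢y ∘ sym)) (closedStar-injective x))) (ℕ.<-irrefl refl) }

  module _ (n≡8 : n ≡ 8) where

    private
      7<n : 7 < n
      7<n = ℕ.≤-reflexive (sym n≡8)

      outside : ∀ x → ∃ λ y → ∀ k → y ≢ (x ◂ star x) k
      outside x = missed 7<n (x ◂ star x)

    mate : Fin n → Fin n
    mate x = proj₁ (outside x)

    -- A second non-neighbour, together with `mate x`, `x` and its six neighbours, would make nine
    -- vertices.
    mate-unique : ∀ {x y} → y ≢ x → ¬ Adj total x y → y ≡ mate x
    mate-unique {x} {y} y≢x ¬adj = decidable-stable (y ≟ᶠ mate x) λ y≢mate →
      contradiction
        (injective⇒≤ (◂-injective (λ { zero → y≢mate ; (suc k) → nonneighbour∉ ¬adj y≢x k })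
          (◂-injective (proj₂ (outside x)) (closedStar-injective x))))
        (ℕ.<⇒≱ (subst (_< 9) (sym n≡8) (ℕ.n<1+n 8)))

    mate≢ : ∀ x → mate x ≢ x
    mate≢ x = proj₂ (outside x) zero

    mate-nonadj : ∀ x → ¬ Adj total x (mate x)
    mate-nonadj x adj = let k , e = star-only adj in proj₂ (outside x) (suc k) e

    mate-involutive : ∀ x → mate (mate x) ≡ x
    mate-involutive x = sym (mate-unique (mate≢ x ∘ sym) (mate-nonadj x ∘ Graph.symm total))

    adj⇔ : ∀ x y → Adj total x y ⇔ (x ≢ y × y ≢ mate x)
    adj⇔ x y = mk⇔
      (λ e → (λ x≡y → Graph.irrefl total x≡y e) , λ { refl → mate-nonadj x e })
      (λ (x≢y , y≢mate) → decidable-stable (Graph.adj? total x y) λ ¬adj →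
        y≢mate (mate-unique (x≢y ∘ sym) ¬adj))

partner : Fin m × Fin 2 → Fin m × Fin 2
partner (i , b) = i , opposite b

Cocktail : ∀ m → Rel (Fin m × Fin 2) 0ℓ
Cocktail m a b = a ≢ b × b ≢ partner a

module _ (μ : Fin n → Fin n) (μ-involutive : ∀ x → μ (μ x) ≡ x) (μ≢ : ∀ x → μ x ≢ x) where

  -- Greedy choice: as long as the pairs found so far do not exhaust the vertices, some vertex is
  -- left, and its image under `μ` is left as well because the chosen set is closed under `μ`.
  pairing : ∀ m → m ℕ.* 2 ≤ n → ∃ λ (f : Fin m × Fin 2 → Fin n) →
    (∀ {a b} → f a ≡ f b → a ≡ b) × (∀ a → μ (f a) ≡ f (partner a))
  pairing zero    _   = (λ ()) , (λ { {()} }) , λ ()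
  pairing (suc m) m<n with pairing m (ℕ.≤-trans (ℕ.m≤n+m _ 2) m<n)
  ... | f , inj , μf with missed (ℕ.≤-trans (ℕ.m≤n+m _ 1) m<n) (f ∘ remQuot 2)
  ...   | y , y∉ = g , g-injective , μg
    where
    fresh : ∀ a → y ≢ f a
    fresh (i , b) y≡ = y∉ (combine i b) (trans y≡ (cong f (sym (remQuot-combine i b))))
    fresh′ : ∀ a → μ y ≢ f a
    fresh′ a e = fresh (partner a) (trans (sym (μ-involutive y)) (trans (cong μ e) (μf a)))
    g : Fin (suc m) × Fin 2 → Fin n
    g (zero  , 0F) = y
    g (zero  , 1F) = μ y
    g (suc i , b)  = f (i , b)
    g-injective : ∀ {a b} → g a ≡ g b → a ≡ b
    g-injective {zero  , 0F} {zero  , 0F} e = refl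
    g-injective {zero  , 0F} {zero  , 1F} e = contradiction (sym e) (μ≢ y)
    g-injective {zero  , 0F} {suc j , c}  e = contradiction e (fresh (j , c))
    g-injective {zero  , 1F} {zero  , 0F} e = contradiction e (μ≢ y)
    g-injective {zero  , 1F} {zero  , 1F} e = refl
    g-injective {zero  , 1F} {suc j , c}  e = contradiction e (fresh′ (j , c))
    g-injective {suc i , b}  {zero  , 0F} e = contradiction (sym e) (fresh (i , b))
    g-injective {suc i , b}  {zero  , 1F} e = contradiction (sym e) (fresh′ (i , b))
    g-injective {suc i , b}  {suc j , c}  e = cong (Product.map₁ suc) (inj e)
    μg : ∀ a → μ (g a) ≡ g (partner a)
    μg (zero  , 0F) = refl
    μg (zero  , 1F) = μ-involutive y
    μg (suc i , b)  = μf (i , b)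

cocktail : ∀ {T : Rel (Fin (m ℕ.* 2)) 0ℓ} (μ : Fin (m ℕ.* 2) → Fin (m ℕ.* 2)) →
  (∀ x → μ (μ x) ≡ x) → (∀ x → μ x ≢ x) →
  (∀ x y → T x y ⇔ (x ≢ y × y ≢ μ x)) → T ≃ Cocktail m
cocktail {m} {T} μ invol μ≢ T⇔ with pairing μ invol μ≢ m ℕ.≤-refl
... | f , inj , μf = ≃-sym record
  { to        = f
  ; from      = λ x → remQuot 2 (proj₁ (onto x))
  ; to-from   = λ x → proj₂ (onto x)
  ; from-to   = λ a → inj (proj₂ (onto (f a)))
  ; to-edge   = λ {a} (a≢b , b≢) → Equivalence.from (T⇔ _ _)
      (a≢b ∘ inj , λ e → b≢ (inj (trans e (μf a))))
  ; from-edge = λ {x} {y} t → let x≢y , y≢ = Equivalence.to (T⇔ _ _) t in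
      (λ e → x≢y (trans (sym (proj₂ (onto x))) (trans (cong f e) (proj₂ (onto y))))) ,
      λ e → y≢ (trans (sym (proj₂ (onto y))) (trans (cong f e) (trans (sym (μf _)) (cong μ (proj₂ (onto x)))))) }
  where
  onto : ∀ y → ∃ λ x → f (remQuot 2 x) ≡ y
  onto = injective⇒surjective λ {x} {y} e → trans (sym (combine-remQuot {m} 2 x))
    (trans (cong (λ (i , b) → combine i b) (inj e)) (combine-remQuot {m} 2 y))

-- Latin squares of order 3 and the packings of three triangles

Distinct₃ : Fin 3 → Fin 3 → Fin 3 → Set
Distinct₃ x y z = x ≢ y × x ≢ z × y ≢ z

distinct₃? : ∀ x y z → Dec (Distinct₃ x y z)
distinct₃? x y z = ¬? (x ≟ᶠ y) ×-dec ¬? (x ≟ᶠ z) ×-dec ¬? (y ≟ᶠ z)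

entry : {A : Set} → A → A → A → Fin 3 → A
entry x y z 0F = x
entry x y z 1F = y
entry x y z 2F = z

Square : Set
Square = Fin 3 → Fin 3 → Fin 3

-- The addition table of the integers modulo 3. As `reflect` is negation there,
-- `cyclic a (reflect b)` is a - b.
cyclic : Square
cyclic = entry (entry 0F 1F 2F) (entry 1F 2F 0F) (entry 2F 0F 1F)

reflect : Fin 3 → Fin 3
reflect = entry 0F 2F 1F

reflect-involutive : ∀ b → reflect (reflect b) ≡ b
reflect-involutive 0F = refl
reflect-involutive 1F = refl
reflect-involutive 2F = refl

-- The Latin square graph only sees which cells carry equal symbols, so comparing level sets spares
-- a permutation of the symbols.
SameLevels : Square → (Fin 3 → Fin 3) → Set
SameLevels L τ = ∀ a b a′ b′ →
  (L a b ≡ L a′ b′ → cyclic a (τ b) ≡ cyclic a′ (τ b′)) ×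
  (cyclic a (τ b) ≡ cyclic a′ (τ b′) → L a b ≡ L a′ b′)

sameLevels? : ∀ L τ → Dec (SameLevels L τ)
sameLevels? L τ = all? λ a → all? λ b → all? λ a′ → all? λ b′ →
  ((L a b ≟ᶠ L a′ b′) →-dec (cyclic a (τ b) ≟ᶠ cyclic a′ (τ b′))) ×-dec
  ((cyclic a (τ b) ≟ᶠ cyclic a′ (τ b′)) →-dec (L a b ≟ᶠ L a′ b′))

-- The level sets of a Latin square of order 3 are three disjoint permutations,
-- so they are either the three even or the three odd ones.
latin-entries : ∀ x₀ x₁ x₂ → Distinct₃ x₀ x₁ x₂ → ∀ y₀ y₁ y₂ → Distinct₃ y₀ y₁ y₂ →
  ∀ z₀ z₁ z₂ → Distinct₃ z₀ z₁ z₂ → Distinct₃ x₀ y₀ z₀ → Distinct₃ x₁ y₁ z₁ → Distinct₃ x₂ y₂ z₂ →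
  let L = entry (entry x₀ x₁ x₂) (entry y₀ y₁ y₂) (entry z₀ z₁ z₂) in
  SameLevels L id ⊎ SameLevels L reflect
latin-entries = toWitness {a? =
  all? λ x₀ → all? λ x₁ → all? λ x₂ → distinct₃? x₀ x₁ x₂ →-dec
  all? λ y₀ → all? λ y₁ → all? λ y₂ → distinct₃? y₀ y₁ y₂ →-dec
  all? λ z₀ → all? λ z₁ → all? λ z₂ → distinct₃? z₀ z₁ z₂ →-dec
  distinct₃? x₀ y₀ z₀ →-dec distinct₃? x₁ y₁ z₁ →-dec distinct₃? x₂ y₂ z₂ →-dec
  (let L = entry (entry x₀ x₁ x₂) (entry y₀ y₁ y₂) (entry z₀ z₁ z₂) in
   sameLevels? L id ⊎-dec sameLevels? L reflect)} _

latin-levels : ∀ L → (∀ a {b b′} → L a b ≡ L a b′ → b ≡ b′) → (∀ {a a′} b → L a b ≡ L a′ b → a ≡ a′) →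
  SameLevels L id ⊎ SameLevels L reflect
latin-levels L row col = Sum.map copy copy
  (latin-entries (L 0F 0F) (L 0F 1F) (L 0F 2F) (rows 0F) (L 1F 0F) (L 1F 1F) (L 1F 2F) (rows 1F)
    (L 2F 0F) (L 2F 1F) (L 2F 2F) (rows 2F) (cols 0F) (cols 1F) (cols 2F))
  where
  rows : ∀ a → Distinct₃ (L a 0F) (L a 1F) (L a 2F)
  rows a = (λ e → contradiction (row a e) λ ()) , (λ e → contradiction (row a e) λ ()) , λ e → contradiction (row a e) λ ()
  cols : ∀ b → Distinct₃ (L 0F b) (L 1F b) (L 2F b)
  cols b = (λ e → contradiction (col b e) λ ()) , (λ e → contradiction (col b e) λ ()) , λ e → contradiction (col b e) λ ()
  -- The finite check speaks of squares tabulated from nine entries; without function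
  -- extensionality, `L` agrees with its table only pointwise.
  L′ = entry (entry (L 0F 0F) (L 0F 1F) (L 0F 2F)) (entry (L 1F 0F) (L 1F 1F) (L 1F 2F)) (entry (L 2F 0F) (L 2F 1F) (L 2F 2F))
  L′≡L : ∀ a b → L′ a b ≡ L a b
  L′≡L 0F 0F = refl
  L′≡L 0F 1F = refl
  L′≡L 0F 2F = refl
  L′≡L 1F 0F = refl
  L′≡L 1F 1F = refl
  L′≡L 1F 2F = refl
  L′≡L 2F 0F = refl
  L′≡L 2F 1F = refl
  L′≡L 2F 2F = refl
  copy : ∀ {τ} → SameLevels L′ τ → SameLevels L τ
  copy same a b a′ b′ =
    (λ e → proj₁ (same a b a′ b′) (trans (L′≡L a b) (trans e (sym (L′≡L a′ b′))))) ,
    (λ e → trans (sym (L′≡L a b)) (trans (proj₂ (same a b a′ b′) e) (L′≡L a′ b′)))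

LatinSquareGraph : Square → Rel (Fin 3 × Fin 3) 0ℓ
LatinSquareGraph L (a , b) (a′ , b′) = (a , b) ≢ (a′ , b′) × (a ≡ a′ ⊎ b ≡ b′ ⊎ L a b ≡ L a′ b′)

relabelColumns : ∀ {L} τ → (∀ b → τ (τ b) ≡ b) → SameLevels L τ → LatinSquareGraph L ≃ LatinSquareGraph cyclic
relabelColumns {L} τ invol same = record
  { to        = Product.map₂ τ
  ; from      = Product.map₂ τ
  ; to-from   = λ (a , b) → cong (a ,_) (invol b)
  ; from-to   = λ (a , b) → cong (a ,_) (invol b)
  ; to-edge   = λ {(a , b)} {(a′ , b′)} (x≢y , e) → x≢y ∘ unmap , Sum.map₂ (Sum.map (cong τ) (proj₁ (same a b a′ b′))) e
  ; from-edge = λ {(a , b)} {(a′ , b′)} (x≢y , e) → x≢y ∘ unmap , Sum.map₂ (Sum.map (cong τ)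
      λ e → proj₂ (same a (τ b) a′ (τ b′)) (subst₂ (λ b b′ → cyclic a b ≡ cyclic a′ b′) (sym (invol b)) (sym (invol b′)) e)) e }
  where
  unmap : ∀ {x y} → Product.map₂ τ x ≡ Product.map₂ τ y → x ≡ y
  unmap {a , b} {a′ , b′} e = cong₂ _,_ (cong proj₁ e) (trans (sym (invol b)) (trans (cong (τ ∘ proj₂) e) (invol b′)))

latinSquareGraph-unique : ∀ L → (∀ a {b b′} → L a b ≡ L a b′ → b ≡ b′) → (∀ {a a′} b → L a b ≡ L a′ b → a ≡ a′) →
  LatinSquareGraph L ≃ LatinSquareGraph cyclic
latinSquareGraph-unique L row col =
  Sum.[ relabelColumns id (λ _ → refl) , relabelColumns reflect reflect-involutive ]′ (latin-levels L row col)

Triangles : {U : Set} → Rel U 0ℓ → (U → Fin 3) → Set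
Triangles R class = ∀ u v → (R u v → u ≢ v × class u ≡ class v) × (u ≢ v × class u ≡ class v → R u v)

Triangles-≃ : ∀ {U W} {R : Rel U 0ℓ} {S : Rel W 0ℓ} {class} (φ : R ≃ S) → Triangles S class → Triangles R (class ∘ _≃_.to φ)
Triangles-≃ {R = R} φ tri u v =
  (λ e → let x≢y , c≡ = proj₁ (tri _ _) (to-edge e) in x≢y ∘ cong to , c≡) ,
  (λ (u≢v , c≡) → subst₂ R (from-to u) (from-to v) (from-edge (proj₂ (tri _ _) (u≢v ∘ to-injective , c≡))))
  where open _≃_ φ

-- The intended `c i x` is the triangle of copy `i` that contains `x`. Triangles of different copies
-- share at most one vertex, which is `determined`. The third coordinate as a function of the first
-- two is then a Latin square: it repeats no symbol in a row or column, since any two coordinates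
-- fix the vertex.
module Coordinates {U : Set} {T : Rel U 0ℓ} (c : Fin 3 → U → Fin 3)
  (determined : ∀ {i j} → i ≢ j → ∀ {x y} → c i x ≡ c i y → c j x ≡ c j y → x ≡ y)
  (onto : ∀ a b → ∃ λ x → c 0F x ≡ a × c 1F x ≡ b)
  (T⇔ : ∀ {x y} → T x y ⇔ (x ≢ y × ∃ λ i → c i x ≡ c i y)) where

  private
    at : Fin 3 → Fin 3 → U
    at a b = proj₁ (onto a b)

    row : ∀ a b → c 0F (at a b) ≡ a
    row a b = proj₁ (proj₂ (onto a b))

    column : ∀ a b → c 1F (at a b) ≡ b
    column a b = proj₂ (proj₂ (onto a b))

    at-cell : ∀ x → at (c 0F x) (c 1F x) ≡ x
    at-cell x = determined {0F} {1F} (λ ()) (row _ _) (column _ _)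

    L : Square
    L a b = c 2F (at a b)

    L-cell : ∀ x → L (c 0F x) (c 1F x) ≡ c 2F x
    L-cell x = cong (c 2F) (at-cell x)

    T≃LatinSquareGraph : T ≃ LatinSquareGraph L
    T≃LatinSquareGraph = record
      { to        = λ x → c 0F x , c 1F x
      ; from      = λ (a , b) → at a b
      ; to-from   = λ (a , b) → cong₂ _,_ (row a b) (column a b)
      ; from-to   = at-cell
      ; to-edge   = λ t → let x≢y , i , e = Equivalence.to T⇔ t in
          (λ c≡ → x≢y (determined {0F} {1F} (λ ()) (cong proj₁ c≡) (cong proj₂ c≡))) , shares i e
      ; from-edge = λ {x} {y} (x≢y , e) → Equivalence.from T⇔
          ((λ e → x≢y (trans (sym (cong₂ _,_ (row _ _) (column _ _)))
            (trans (cong (λ x → c 0F x , c 1F x) e) (cong₂ _,_ (row _ _) (column _ _))))) , reflects x y e) }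
      where
      shares : ∀ i {x y} → c i x ≡ c i y → c 0F x ≡ c 0F y ⊎ c 1F x ≡ c 1F y ⊎ L (c 0F x) (c 1F x) ≡ L (c 0F y) (c 1F y)
      shares 0F e = inj₁ e
      shares 1F e = inj₂ (inj₁ e)
      shares 2F e = inj₂ (inj₂ (trans (L-cell _) (trans e (sym (L-cell _)))))
      reflects : ∀ ((a , b) (a′ , b′) : Fin 3 × Fin 3) → a ≡ a′ ⊎ b ≡ b′ ⊎ L a b ≡ L a′ b′ →
             ∃ λ i → c i (at a b) ≡ c i (at a′ b′)
      reflects (a , b) (a′ , b′) (inj₁ e)        = 0F , trans (row a b) (trans e (sym (row a′ b′)))
      reflects (a , b) (a′ , b′) (inj₂ (inj₁ e)) = 1F , trans (column a b) (trans e (sym (column a′ b′)))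
      reflects (a , b) (a′ , b′) (inj₂ (inj₂ e)) = 2F , e

  T≃cyclic : T ≃ LatinSquareGraph cyclic
  T≃cyclic = ≃-trans T≃LatinSquareGraph (latinSquareGraph-unique L
    (λ a {b} {b′} e → trans (sym (column a b)) (trans (cong (c 1F)
      (determined {0F} {2F} (λ ()) (trans (row a b) (sym (row a b′))) e)) (column a b′)))
    (λ {a} {a′} b e → trans (sym (row a b)) (trans (cong (c 0F)
      (determined {1F} {2F} (λ ()) (trans (column a b) (sym (column a′ b))) e)) (row a′ b))))

module _ {G : Graph 9} {class : Fin 9 → Fin 3} (tri : Triangles (Adj G) class) (p : Packing G) where
  open Packing p
  open Injection using (to; injective)

  private
    origin : Fin 3 → Fin 9 → Fin 9
    origin i x = proj₁ (injective⇒surjective (injective (α i)) x)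

    to-origin : ∀ i x → to (α i) (origin i x) ≡ x
    to-origin i x = proj₂ (injective⇒surjective (injective (α i)) x)

    coordinate : Fin 3 → Fin 9 → Fin 3
    coordinate i x = class (origin i x)

    layer⇒ : ∀ i {x y} → Adj (α i [ G ]) x y → coordinate i x ≡ coordinate i y
    layer⇒ i (u , v , refl , refl , e) = trans (cong class (injective (α i) (to-origin i _)))
      (trans (proj₂ (proj₁ (tri u v) e)) (sym (cong class (injective (α i) (to-origin i _)))))

    layer⇐ : ∀ i {x y} → x ≢ y → coordinate i x ≡ coordinate i y → Adj (α i [ G ]) x y
    layer⇐ i {x} {y} x≢y e = _ , _ , to-origin i x , to-origin i y , proj₂ (tri _ _)
      ((λ o≡ → x≢y (trans (sym (to-origin i x)) (trans (cong (to (α i)) o≡) (to-origin i y)))) , e)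

    determined : ∀ {i j} → i ≢ j → ∀ {x y} → coordinate i x ≡ coordinate i y → coordinate j x ≡ coordinate j y → x ≡ y
    determined i≢j {x} {y} e e′ = decidable-stable (x ≟ᶠ y) λ x≢y →
      disjoint _ _ i≢j x y (layer⇐ _ x≢y e) (layer⇐ _ x≢y e′)

    onto : ∀ a b → ∃ λ x → coordinate 0F x ≡ a × coordinate 1F x ≡ b
    onto a b =
      -- There are as many vertices as cells, so it suffices that the first two coordinates
      -- determine the vertex.
      let x , e = injective⇒surjective {f = cell} (λ e → uncurry (determined {0F} {1F} (λ ())) (combine-injective _ _ _ _ e))
                    (combine a b)
      in x , combine-injective _ _ _ _ e
      where
      cell : Fin 9 → Fin 9
      cell x = combine (coordinate 0F x) (coordinate 1F x)

    total⇔ : ∀ {x y} → Adj total x y ⇔ (x ≢ y × ∃ λ i → coordinate i x ≡ coordinate i y)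
    total⇔ {x} {y} = mk⇔
      (λ e → (λ x≡y → Graph.irrefl total x≡y e) , share e)
      λ { (x≢y , 0F , e) → inj₁ (layer⇐ 0F x≢y e)
        ; (x≢y , 1F , e) → inj₂ (inj₁ (layer⇐ 1F x≢y e))
        ; (x≢y , 2F , e) → inj₂ (inj₂ (layer⇐ 2F x≢y e)) }
      where
      share : Adj total x y → ∃ λ i → coordinate i x ≡ coordinate i y
      share (inj₁ e)        = 0F , layer⇒ 0F e
      share (inj₂ (inj₁ e)) = 1F , layer⇒ 1F e
      share (inj₂ (inj₂ e)) = 2F , layer⇒ 2F e

  triangles-total : Adj total ≃ LatinSquareGraph cyclic
  triangles-total = Coordinates.T≃cyclic coordinate determined onto total⇔

-- Nonexistence and uniqueness for the exceptional graphs

sameTotals : ∀ {U} {G : Graph n} {T : Rel U 0ℓ} → (∀ p → Adj (Packing.total {G = G} p) ≃ T) →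
  ∀ (p q : Packing G) → ¬ Distinct p q
sameTotals ≃T p q distinct = distinct (≃⇒≅ (≃-trans (≃T p) (≃-sym (≃T q))))

size : {G : Graph m} {H : Graph n} → G ≅ H → m ≡ n
size φ = ↔⇒≡ (_≅_.bijection φ)

regular : (H : Graph n) {t : True (twoNeighbours? H)} → TwoNeighbours (Adj H)
regular H {t} = toWitness t

notPackable : {G : Graph m} {H : Graph n} → TwoNeighbours (Adj H) → n ≤ 6 → Fin n → G ≅ H → ¬ Packing G
notPackable two n≤6 x φ p with size φ
... | refl = tooSmall (TwoNeighbours-≃ (≅⇒≃ φ) two) p n≤6 x

unique₇ : {G : Graph m} {H : Graph 7} → TwoNeighbours (Adj H) → G ≅ H → ∀ (p q : Packing G) → ¬ Distinct p q
unique₇ two φ with size φ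
... | refl = sameTotals λ p → complete (TwoNeighbours-≃ (≅⇒≃ φ) two) p refl

unique₈ : {G : Graph m} {H : Graph 8} → TwoNeighbours (Adj H) → G ≅ H → ∀ (p q : Packing G) → ¬ Distinct p q
unique₈ {G = G} two φ with size φ
... | refl = sameTotals λ p →
  cocktail {4} (mate nb p refl) (mate-involutive nb p refl) (mate≢ nb p refl) (adj⇔ nb p refl)
  where nb = TwoNeighbours-≃ (≅⇒≃ φ) two

unique₃₃₃ : {G : Graph m} → G ≅ (C 3 ∪ C 3 ∪ C 3) → ∀ (p q : Packing G) → ¬ Distinct p q
unique₃₃₃ φ with size φ
... | refl = sameTotals (triangles-total (Triangles-≃ (≅⇒≃ φ) triangles))
  where
  H = C 3 ∪ C 3 ∪ C 3
  class : Fin 9 → Fin 3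
  class x = proj₁ (remQuot {3} 3 x)
  triangles : Triangles (Adj H) class
  triangles = toWitness {a? = all? λ u → all? λ v →
    (Graph.adj? H u v →-dec (¬? (u ≟ᶠ v) ×-dec (class u ≟ᶠ class v))) ×-dec
    ((¬? (u ≟ᶠ v) ×-dec (class u ≟ᶠ class v)) →-dec Graph.adj? H u v)} _

unpackable⇒ : {G : Graph n} → G IsOneOf unpackable → ¬ Packing G
unpackable⇒ (here φ)                                 = notPackable (regular (C 3)) (toWitness {a? = 3 ℕ.≤? 6} _) zero φ
unpackable⇒ (there (here φ))                         = notPackable (regular (C 4)) (toWitness {a? = 4 ℕ.≤? 6} _) zero φ
unpackable⇒ (there (there (here φ)))                 = notPackable (regular (C 5)) (toWitness {a? = 5 ℕ.≤? 6} _) zero φ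
unpackable⇒ (there (there (there (here φ))))         = notPackable (regular (C 6)) ℕ.≤-refl zero φ
unpackable⇒ (there (there (there (there (here φ))))) = notPackable (regular (C 3 ∪ C 3)) ℕ.≤-refl zero φ

uniquelyPackable⇒ : {G : Graph n} → G IsOneOf uniquelyPackable → ∀ (p q : Packing G) → ¬ Distinct p q
uniquelyPackable⇒ (here φ)                                         = unique₇ (regular (C 7)) φ
uniquelyPackable⇒ (there (here φ))                                 = unique₈ (regular (C 8)) φ
uniquelyPackable⇒ (there (there (here φ)))                         = unique₇ (regular (C 3 ∪ C 4)) φ
uniquelyPackable⇒ (there (there (there (here φ))))                 = unique₈ (regular (C 4 ∪ C 4)) φ
uniquelyPackable⇒ (there (there (there (there (here φ)))))         = unique₈ (regular (C 3 ∪ C 5)) φ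
uniquelyPackable⇒ (there (there (there (there (there (here φ)))))) = unique₃₃₃ φ

-- Splitting a list of cycle lengths

insert : ℕ → List ℕ → List ℕ
insert x []       = x ∷ []
insert x (y ∷ ys) with y ℕ.≤? x
... | yes _ = x ∷ y ∷ ys
... | no  _ = y ∷ insert x ys

-- Decreasing order, in which the tables list each shape.
sort : List ℕ → List ℕ
sort []       = []
sort (x ∷ xs) = insert x (sort xs)

insert-↭ : ∀ x xs → insert x xs ↭ x ∷ xs
insert-↭ x []       = ↭-refl
insert-↭ x (y ∷ ys) with y ℕ.≤? x
... | yes _ = ↭-refl
... | no  _ = ↭-trans (Perm.prep y (insert-↭ x ys)) (Perm.swap y x ↭-refl)

sort-↭ : ∀ xs → sort xs ↭ xs
sort-↭ []       = ↭-refl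
sort-↭ (x ∷ xs) = ↭-trans (insert-↭ x (sort xs)) (Perm.prep x (sort-↭ xs))

uniqueShapes : List (List ℕ)
uniqueShapes = (7 ∷ []) ∷ (8 ∷ []) ∷ (3 ∷ 4 ∷ []) ∷ (4 ∷ 4 ∷ []) ∷ (3 ∷ 5 ∷ []) ∷ (3 ∷ 3 ∷ 3 ∷ []) ∷ []

-- When a part is split off and something remains, only its robustness counts, so the uniquely
-- packable shapes qualify too. Two totals are asked of it only if nothing remains.
Base : List ℕ → Set
Base ms = RobustTwo ms ⊎ (Robust ms × Any (ms ↭_) uniqueShapes)

base-robust : ∀ {ms} → Base ms → Robust ms
base-robust (inj₁ (r , _)) = r
base-robust (inj₂ (r , _)) = r

Listed : {P : List ℕ → Set} → List (∃ P) → List ℕ → Set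
Listed table ms = Any (λ e → proj₁ e ≡ ms) table

listed? : {P : List ℕ → Set} (table : List (∃ P)) → ∀ ms → Dec (Listed table ms)
listed? table ms = Any.any? (λ e → List.≡-dec ℕ._≟_ (proj₁ e) ms) table

listed : {P : List ℕ → Set} {table : List (∃ P)} → ∀ {ms} → Listed table ms → P ms
listed l with find l
... | (_ , p) , _ , refl = p

Tabulated : List ℕ → Set
Tabulated ms = Listed robustTwoTable (sort ms) ⊎
  (Listed robustTable (sort ms) × Any (λ us → sort us ≡ sort ms) uniqueShapes)

tabulated? : ∀ ms → Dec (Tabulated ms)
tabulated? ms = listed? robustTwoTable (sort ms) ⊎-dec
  (listed? robustTable (sort ms) ×-dec Any.any? (λ us → List.≡-dec ℕ._≟_ (sort us) (sort ms)) uniqueShapes)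

base : ∀ {ms} → Tabulated ms → Base ms
base {ms} (inj₁ l)       = let r , t = listed l ; φ = Edge-↭ (sort-↭ ms) in
  inj₁ (transport-HasRobust φ r , transport-TwoTotals φ t)
base {ms} (inj₂ (l , u)) = inj₂ (transport-HasRobust (Edge-↭ (sort-↭ ms)) (listed l) , Any.map same u)
  where
  same : ∀ {us} → sort us ≡ sort ms → ms ↭ us
  same {us} e = ↭-trans (↭-sym (sort-↭ ms)) (↭-trans (↭-reflexive (sym e)) (sort-↭ us))

-- One of the lengths has to exceed 3, because two triangles have no packing.
pairs : ∀ (i j : Fin 4) → 0 < toℕ i → Tabulated (3 + toℕ i ∷ 3 + toℕ j ∷ [])
pairs = toWitness {a? = all? λ i → all? λ j → (0 ℕ.<? toℕ i) →-dec tabulated? (3 + toℕ i ∷ 3 + toℕ j ∷ [])} _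

triples : ∀ (i j k : Fin 4) → Tabulated (3 + toℕ i ∷ 3 + toℕ j ∷ 3 + toℕ k ∷ [])
triples = toWitness {a? = all? λ i → all? λ j → all? λ k → tabulated? (3 + toℕ i ∷ 3 + toℕ j ∷ 3 + toℕ k ∷ [])} _

quadruples : ∀ (i : Fin 4) → Tabulated (3 + toℕ i ∷ 3 ∷ 3 ∷ 3 ∷ [])
quadruples = toWitness {a? = all? λ i → tabulated? (3 + toℕ i ∷ 3 ∷ 3 ∷ 3 ∷ [])} _

fiveTriangles : Tabulated (3 ∷ 3 ∷ 3 ∷ 3 ∷ 3 ∷ [])
fiveTriangles = toWitness {a? = tabulated? (3 ∷ 3 ∷ 3 ∷ 3 ∷ 3 ∷ [])} _

data Small : ℕ → Set where
  small : (i : Fin 4) → Small (3 + toℕ i)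

toSmall : ∀ {a} → 3 ≤ a → a < 7 → Small a
toSmall (s≤s (s≤s (s≤s _))) (s≤s (s≤s (s≤s a<4))) =
  subst (Small ∘ (3 +_)) (toℕ-fromℕ< a<4) (small (fromℕ< a<4))

data Short : List ℕ → Set where
  none          : Short []
  one           : ∀ {a} → Small a → Short (a ∷ [])
  two-triangles : Short (3 ∷ 3 ∷ [])

3≤sum : ∀ {m ms} → Allᴸ (3 ≤_) (m ∷ ms) → 3 ≤ sum (m ∷ ms)
3≤sum {m} {ms} (3≤m ∷ _) = ℕ.≤-trans 3≤m (ℕ.m≤m+n m (sum ms))

bothThree : ∀ {a s} → 3 ≤ a → 3 ≤ s → a + s < 7 → a ≡ 3 × s ≡ 3
bothThree {a} {s} 3≤a 3≤s (s≤s a+s≤6) =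
  ℕ.≤-antisym (ℕ.+-cancelʳ-≤ 3 a 3 (ℕ.≤-trans (ℕ.+-monoʳ-≤ a 3≤s) a+s≤6)) 3≤a ,
  ℕ.≤-antisym (ℕ.+-cancelˡ-≤ 3 s 3 (ℕ.≤-trans (ℕ.+-monoˡ-≤ s 3≤a) a+s≤6)) 3≤s

short : ∀ {ms} → Allᴸ (3 ≤_) ms → sum ms < 7 → Short ms
short []                           _   = none
short {a ∷ []}         (3≤a ∷ [])  s<7 = one (toSmall 3≤a (subst (_< 7) (ℕ.+-identityʳ a) s<7))
short {a ∷ b ∷ ms}     (3≤a ∷ all) s<7 with bothThree 3≤a (3≤sum all) s<7
short {a ∷ b ∷ []}     (_ ∷ _)     _ | refl , b≡3 with trans (sym (ℕ.+-identityʳ b)) b≡3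
... | refl = two-triangles
short {a ∷ b ∷ c ∷ ms} (_ ∷ 3≤b ∷ all) _ | refl , b+≡3 =
  contradiction (ℕ.≤-trans (ℕ.+-mono-≤ 3≤b (3≤sum all)) (ℕ.≤-reflexive b+≡3)) (ℕ.m+1+n≰m 3)

shortOrLong : ∀ {ms} → Allᴸ (3 ≤_) ms → Short ms ⊎ 7 ≤ sum ms
shortOrLong {ms} all with 7 ℕ.≤? sum ms
... | yes long = inj₂ long
... | no ¬long = inj₁ (short all (ℕ.≰⇒> ¬long))

-- A remainder of order 1 to 6 would have no packing; `large` rules it out, which forces such cycles
-- into the base.
record Decomposition (ns : List ℕ) : Set where
  constructor decomposition
  field
    {head} : ℕ
    {tail} : List ℕ
    rest   : List ℕ
    perm   : ns ↭ (head ∷ tail) ++ rest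
    isBase : Base (head ∷ tail)
    large  : rest ≡ [] ⊎ 7 ≤ sum rest

whole : ∀ {m ms} → Base (m ∷ ms) → Decomposition (m ∷ ms)
whole {m} {ms} b = decomposition [] (↭-reflexive (sym (List.++-identityʳ (m ∷ ms)))) b (inj₁ refl)

family : ∀ {a k} {ss : List ℕ} → (∀ j → RobustTwo (3 + (j + k) ∷ ss)) → 3 + k ≤ a → Base (a ∷ ss)
family {a} {k} {ss} f k≤a = inj₁ (subst (λ a → RobustTwo (a ∷ ss)) eq (f (a ∸ (3 + k))))
  where
  eq : 3 + ((a ∸ (3 + k)) + k) ≡ a
  eq = trans (trans (cong (3 +_) (ℕ.+-comm _ k)) (sym (ℕ.+-assoc 3 k _))) (ℕ.m+[n∸m]≡n k≤a)

oneLarge : ∀ {a} → 7 ≤ a → Base (a ∷ [])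
oneLarge {7} _ = base (toWitness {a? = tabulated? (7 ∷ [])} _)
oneLarge {8} _ = base (toWitness {a? = tabulated? (8 ∷ [])} _)
oneLarge {9} _ = base (toWitness {a? = tabulated? (9 ∷ [])} _)
oneLarge {suc (suc (suc (suc (suc (suc (suc (suc (suc (suc a)))))))))} _ =
  family growing (ℕ.m≤m+n 10 a)
oneLarge {0} ()
oneLarge {1} (s≤s ())
oneLarge {2} (s≤s (s≤s ()))
oneLarge {3} (s≤s (s≤s (s≤s ())))
oneLarge {4} (s≤s (s≤s (s≤s (s≤s ()))))
oneLarge {5} (s≤s (s≤s (s≤s (s≤s (s≤s ())))))
oneLarge {6} (s≤s (s≤s (s≤s (s≤s (s≤s (s≤s ()))))))

-- A cycle of length at least 7 is a base by itself. If the other cycles are too few to be packed on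
-- their own, they form one of five short remainders, and each of these has its own family.
decomposeLarge : ∀ {a as} → 7 ≤ a → Allᴸ (3 ≤_) as → Decomposition (a ∷ as)
decomposeLarge {a} {as} 7≤a all with shortOrLong all
... | inj₂ long             = decomposition as ↭-refl (oneLarge 7≤a) (inj₂ long)
... | inj₁ none             = whole (oneLarge 7≤a)
... | inj₁ (one (small 0F)) = whole (family growing3 7≤a)
... | inj₁ (one (small 1F)) = whole (family growing4 7≤a)
... | inj₁ (one (small 2F)) = whole (family growing5 7≤a)
... | inj₁ (one (small 3F)) = whole (family growing6 7≤a)
... | inj₁ two-triangles    = whole (family growing33 7≤a)

-- The head has length at least 4, so together with any second cycle it has order at least 7. A
-- remainder that is still too short joins them, which leads to the tabulated triples and
-- quadruples.
decomposeMedium : ∀ {as} (i : Fin 4) → 0 < toℕ i → Allᴸ (3 ≤_) as → Allᴸ (_< 7) as →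
                  7 ≤ sum (3 + toℕ i ∷ as) → Decomposition (3 + toℕ i ∷ as)
decomposeMedium i 0<i [] _ 7≤ = contradiction 7≤ (ℕ.<⇒≱ (subst (_< 7) (sym (ℕ.+-identityʳ _)) (ℕ.+-monoʳ-< 3 (toℕ<n i))))
decomposeMedium {_ ∷ bs} i 0<i (3≤b ∷ all) (b<7 ∷ _) _ with toSmall 3≤b b<7 | shortOrLong all
... | small j | inj₂ long            = decomposition {tail = _ ∷ []} bs ↭-refl (base (pairs i j 0<i)) (inj₂ long)
... | small j | inj₁ none            = whole (base (pairs i j 0<i))
... | small j | inj₁ (one (small k)) = whole (base (triples i j k))
... | small zero | inj₁ two-triangles = whole (base (quadruples i))
-- Two cycles longer than 3 and two triangles: giving a triangle to each of the longer cycles yields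
-- two parts of order at least 7.
... | small (suc j) | inj₁ two-triangles = decomposition {tail = 3 ∷ []} (4 + toℕ j ∷ 3 ∷ [])
  (Perm.prep _ (Perm.swap (4 + toℕ j) 3 ↭-refl))
  (base (pairs i zero 0<i)) (inj₂ (ℕ.+-monoʳ-≤ 4 (ℕ.m≤n+m 3 (toℕ j))))

-- A part of order at least 7 contains three triangles or more. Up to five triangles therefore
-- cannot be split and are tabulated; from six on, three can be set apart.
decomposeTriangles : ∀ {as} → Allᴸ (_≡ 3) as → 7 ≤ sum as → Decomposition as
decomposeTriangles (refl ∷ refl ∷ refl ∷ []) _ = whole (base (triples zero zero zero))
decomposeTriangles (refl ∷ refl ∷ refl ∷ refl ∷ []) _ = whole (base (quadruples zero))
decomposeTriangles (refl ∷ refl ∷ refl ∷ refl ∷ refl ∷ []) _ = whole (base fiveTriangles)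
decomposeTriangles (refl ∷ refl ∷ refl ∷ refl ∷ refl ∷ refl ∷ _) _ =
  decomposition {tail = 3 ∷ 3 ∷ []} (3 ∷ 3 ∷ 3 ∷ _) ↭-refl (base (triples zero zero zero)) (inj₂ (ℕ.≤-trans (ℕ.m≤n+m 7 2) (ℕ.m≤m+n 9 _)))
decomposeTriangles [] ()
decomposeTriangles (refl ∷ []) (s≤s (s≤s (s≤s ())))
decomposeTriangles (refl ∷ refl ∷ []) (s≤s (s≤s (s≤s (s≤s (s≤s (s≤s ()))))))

bringForward : ∀ {P : ℕ → Set} {ns} → Any P ns → ∃₂ λ a as → P a × ns ↭ a ∷ as
bringForward (here p)          = _ , _ , p , ↭-refl
bringForward {ns = n ∷ _} (there any) = let a , as , p , π = bringForward any in
  a , n ∷ as , p , ↭-trans (Perm.prep n π) (Perm.swap n a ↭-refl)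

Decomposition-↭ : ∀ {ns ms} → ns ↭ ms → Decomposition ms → Decomposition ns
Decomposition-↭ π (decomposition rest perm b large) = decomposition rest (↭-trans π perm) b large

decompose : ∀ {ns} → Allᴸ (3 ≤_) ns → 7 ≤ sum ns → Decomposition ns
decompose {ns} all 7≤ with Any.any? (7 ℕ.≤?_) ns
... | yes any with bringForward any
...   | a , as , 7≤a , π = Decomposition-↭ π (decomposeLarge 7≤a (All.tail (All-resp-↭ π all)))
decompose {ns} all 7≤ | no ¬any with Any.any? (4 ℕ.≤?_) ns
...   | no ¬any₄ = decomposeTriangles (All.zipWith (λ (3≤n , 4≰n) → ℕ.≤-antisym (ℕ.≤-pred (ℕ.≰⇒> 4≰n)) 3≤n)
                     (all , ¬Any⇒All¬ ns ¬any₄)) 7≤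
...   | yes any with bringForward any
...     | a , as , 4≤a , π with All-resp-↭ π all | All-resp-↭ π (All.map ℕ.≰⇒> (¬Any⇒All¬ ns ¬any))
...       | 3≤a ∷ all′ | a<7 ∷ <7 with toSmall 3≤a a<7
...         | small i = Decomposition-↭ π (decomposeMedium i (ℕ.+-cancelˡ-≤ 3 1 (toℕ i) 4≤a) all′ <7 (subst (7 ≤_) (sum-↭ π) 7≤))

-- Induction on the number of cycles

firstEdge : ∀ {m ms} → 3 ≤ m → ∃₂ λ u v → Edge (m ∷ ms) u v
firstEdge (s≤s (s≤s _)) = inj₁ zero , inj₁ (suc zero) , inj₁ ((λ ()) , inj₁ (inj₁ refl))

someVertex : ∀ {ns} → Allᴸ (3 ≤_) ns → 7 ≤ sum ns → Vertex ns
someVertex (s≤s _ ∷ _) _ = inj₁ zero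
someVertex [] ()

module _ {m ms rest} (all : Allᴸ (3 ≤_) ((m ∷ ms) ++ rest)) (long : 7 ≤ sum rest)
         (r : Robust (m ∷ ms)) (c : HasConnected (Edge rest)) where
  private
    edge : ∃₂ λ u v → Edge (m ∷ ms) u v
    edge = firstEdge (All.head all)

    vertex : Vertex rest
    vertex = someVertex (++⁻ʳ (m ∷ ms) all) long

    irrefl : ∀ ns → Nonloop (Edge ns)
    irrefl ns {u} = Edge-irrefl ns {u}

  ++-connected : HasConnected (Edge ((m ∷ ms) ++ rest))
  ++-connected = transport-HasConnected (≃-sym (Edge-++ (m ∷ ms) rest))
    (union-connected _≟ⱽ_ _≟ⱽ_ (irrefl (m ∷ ms)) (irrefl rest) (proj₂ (proj₂ edge)) vertex r c)

  ++-twoTotals : TwoTotals (Edge ((m ∷ ms) ++ rest))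
  ++-twoTotals = transport-TwoTotals (≃-sym (Edge-++ (m ∷ ms) rest))
    (union-twoTotals _≟ⱽ_ _≟ⱽ_ (irrefl (m ∷ ms)) (irrefl rest) (proj₂ (proj₂ edge)) vertex r c)

-- The twisted union asks for robustness only of the base, so plain connectedness is the invariant
-- to carry through the remainders.
connected : ∀ {ns} → Acc _<_ (length ns) → Allᴸ (3 ≤_) ns → 7 ≤ sum ns → HasConnected (Edge ns)
connected {ns} (acc rec) all 7≤ with decompose all 7≤
... | decomposition {m} {ms} .[] π b (inj₁ refl) =
  transport-HasConnected (Edge-↭ (↭-sym (↭-trans π (↭-reflexive (List.++-identityʳ (m ∷ ms))))))
    (robust⇒connected (base-robust b))
... | decomposition {m} {ms} rest π b (inj₂ long) =
  transport-HasConnected (Edge-↭ (↭-sym π)) (++-connected {ms = ms} all′ long (base-robust b)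
    (connected (rec shorter) (++⁻ʳ (m ∷ ms) all′) long))
  where
  all′ = All-resp-↭ π all
  shorter : length rest < length ns
  shorter = subst (length rest <_) (sym (trans (↭-length π) (cong suc (List.length-++ ms))))
    (s≤s (ℕ.m≤n+m (length rest) (length ms)))

twoTotals : ∀ {ns} → Allᴸ (3 ≤_) ns → 7 ≤ sum ns → TwoTotals (Edge ns) ⊎ Any (ns ↭_) uniqueShapes
twoTotals all 7≤ with decompose all 7≤
... | decomposition {m} {ms} .[] π b (inj₁ refl) = finish b
  where
  π′ = ↭-trans π (↭-reflexive (List.++-identityʳ (m ∷ ms)))
  finish : Base (m ∷ ms) → _
  finish (inj₁ (_ , two)) = inj₁ (transport-TwoTotals (Edge-↭ (↭-sym π′)) two)
  finish (inj₂ (_ , any)) = inj₂ (Any.map (↭-trans π′) any)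
... | decomposition {m} {ms} rest π b (inj₂ long) =
  inj₁ (transport-TwoTotals (Edge-↭ (↭-sym π)) (++-twoTotals {ms = ms} all′ long (base-robust b)
    (connected (<-wellFounded _) (++⁻ʳ (m ∷ ms) all′) long)))
  where all′ = All-resp-↭ π all

-- From lists of lengths back to the graphs of the statement

Edge₁ : ∀ {n} → Edge (n ∷ []) ≃ Adj (C n)
Edge₁ = record
  { to = λ { (inj₁ u) → u } ; from = inj₁ ; to-from = λ _ → refl ; from-to = λ { (inj₁ _) → refl }
  ; to-edge = λ { (inj₁ e) → e } ; from-edge = inj₁ }

Edge₂ : ∀ {m n} → Edge (m ∷ n ∷ []) ≃ Adj (C m ∪ C n)
Edge₂ {m} {n} = ≃-trans (⊎-cong ≃-refl Edge₁) (≃-sym (∪≃⊎ {G = C m} {H = C n}))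

Edge₃ : ∀ {l m n} → Edge (l ∷ m ∷ n ∷ []) ≃ Adj (C l ∪ C m ∪ C n)
Edge₃ {l} {m} {n} = ≃-trans (⊎-cong ≃-refl Edge₂) (≃-sym (∪≃⊎ {G = C l} {H = C m ∪ C n}))

module _ {n} {G : Graph n} where

  shortUnpackable : ∀ {ns} → 1 ≤ length ns → Short ns → Adj G ≃ Edge ns → G IsOneOf unpackable
  shortUnpackable () none
  shortUnpackable _ (one (small 0F)) φ = here (≃⇒≅ (≃-trans φ Edge₁))
  shortUnpackable _ (one (small 1F)) φ = there (here (≃⇒≅ (≃-trans φ Edge₁)))
  shortUnpackable _ (one (small 2F)) φ = there (there (here (≃⇒≅ (≃-trans φ Edge₁))))
  shortUnpackable _ (one (small 3F)) φ = there (there (there (here (≃⇒≅ (≃-trans φ Edge₁)))))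
  shortUnpackable _ two-triangles    φ = there (there (there (there (here (≃⇒≅ (≃-trans φ Edge₂))))))

  uniqueShape⇒ : ∀ {ns} → Any (ns ↭_) uniqueShapes → Adj G ≃ Edge ns → G IsOneOf uniquelyPackable
  uniqueShape⇒ (here π) φ = here (≃⇒≅ (≃-trans φ (≃-trans (Edge-↭ π) Edge₁)))
  uniqueShape⇒ (there (here π)) φ = there (here (≃⇒≅ (≃-trans φ (≃-trans (Edge-↭ π) Edge₁))))
  uniqueShape⇒ (there (there (here π))) φ = there (there (here (≃⇒≅ (≃-trans φ (≃-trans (Edge-↭ π) Edge₂)))))
  uniqueShape⇒ (there (there (there (here π)))) φ =
    there (there (there (here (≃⇒≅ (≃-trans φ (≃-trans (Edge-↭ π) Edge₂))))))
  uniqueShape⇒ (there (there (there (there (here π))))) φ =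
    there (there (there (there (here (≃⇒≅ (≃-trans φ (≃-trans (Edge-↭ π) Edge₂)))))))
  uniqueShape⇒ (there (there (there (there (there (here π)))))) φ =
    there (there (there (there (there (here (≃⇒≅ (≃-trans φ (≃-trans (Edge-↭ π) Edge₃))))))))

  uniquelyPackable⇒shape : G IsOneOf uniquelyPackable → ∃ λ ns → ns ∈ uniqueShapes × Edge ns ≃ Adj G
  uniquelyPackable⇒shape (here φ) = _ , here refl , ≃-trans Edge₁ (≃-sym (≅⇒≃ φ))
  uniquelyPackable⇒shape (there (here φ)) = _ , there (here refl) , ≃-trans Edge₁ (≃-sym (≅⇒≃ φ))
  uniquelyPackable⇒shape (there (there (here φ))) = _ , there (there (here refl)) , ≃-trans Edge₂ (≃-sym (≅⇒≃ φ))
  uniquelyPackable⇒shape (there (there (there (here φ)))) =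
    _ , there (there (there (here refl))) , ≃-trans Edge₂ (≃-sym (≅⇒≃ φ))
  uniquelyPackable⇒shape (there (there (there (there (here φ))))) =
    _ , there (there (there (there (here refl)))) , ≃-trans Edge₂ (≃-sym (≅⇒≃ φ))
  uniquelyPackable⇒shape (there (there (there (there (there (here φ)))))) =
    _ , there (there (there (there (there (here refl))))) , ≃-trans Edge₃ (≃-sym (≅⇒≃ φ))

  uniquelyPackable⇒packing : G IsOneOf uniquelyPackable → Packing G
  uniquelyPackable⇒packing G∈ = let ns , ns∈ , φ = uniquelyPackable⇒shape G∈ in
    toPacking (transport φ (proj₁ (base-robust (base (All.lookup shapesTabulated ns∈)))))
    where
    shapesTabulated : Allᴸ Tabulated uniqueShapes
    shapesTabulated = toWitness {a? = All.all? tabulated? uniqueShapes} _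

toList⁺ : ∀ {k} {ns : Vec ℕ k} → All (3 ≤_) ns → Allᴸ (3 ≤_) (Vec.toList ns)
toList⁺ []         = []
toList⁺ (p ∷ all)  = p ∷ toList⁺ all

theorem10 : ∀ {n} (G : Graph n) (k : ℕ) (ns : Vec ℕ k) →
    1 ≤ k → All (3 ≤_) ns → G ≅ ⋃C ns →
    (G IsOneOf unpackable → ¬ Packing G) ×
    (G IsOneOf uniquelyPackable → HasUniquePacking G) ×
    (¬ (G IsOneOf unpackable) → ¬ (G IsOneOf uniquelyPackable) → HasDistinctPackings G)
theorem10 G k ns 1≤k all G≅ =
  unpackable⇒ ,
  (λ G∈ → uniquelyPackable⇒packing G∈ , uniquelyPackable⇒ G∈) ,
  distinct
  where
  φ : Adj G ≃ Edge (Vec.toList ns)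
  φ = ≃-trans (≅⇒≃ G≅) (⋃C≃Edge ns)
  distinct : ¬ (G IsOneOf unpackable) → ¬ (G IsOneOf uniquelyPackable) → HasDistinctPackings G
  distinct ¬un ¬uq with shortOrLong (toList⁺ all)
  ... | inj₁ s = contradiction (shortUnpackable (subst (1 ≤_) (sym (length-toList ns)) 1≤k) s φ) ¬un
  ... | inj₂ long with twoTotals (toList⁺ all) long
  ...   | inj₁ two = distinctPackings (≃-sym φ) two
  ...   | inj₂ shape = contradiction (uniqueShape⇒ shape φ) ¬uq
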